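{- Let $q,z\in\mathbb{C}$ with $|q|<1$ and $z\ne0$. Then $$\sum_{n=0}^\infty(-1)^n\frac{(-1/z)_{n+1}(-zq,q)_n}{(q)_{2n+1}}q^{\binom{n+1}{2}}=\sum_{n=0}^\infty(-1)^nq^{n(n+1)}z^n-\sum_{n=-\infty}^{ -1}(-1)^nq^{n(n+1)}z^n.$$
   Context: $(a)_n=(a;q)_n=\prod_{j=1}^{n}(1-aq^{j-1})$ for $n\ge0$ (with $(a)_0=1$), and $(a,b)_n=(a)_n(b)_n$. Here $(-1)^n$ is an ordinary power. -}

module Defs where

open import Data.Nat.Base as ℕ using (ℕ; zero; suc)
import Data.Nat.Properties as ℕ
open import Data.Integer.Base as ℤ using (ℤ; +_; -[1+_])
open import Data.Rational.Base as ℚ using (ℚ; 0ℚ; 1ℚ; ½; ∣_∣)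
import Data.Rational.Properties as ℚ
open import Data.Rational.Solver using (module +-*-Solver)
open import Data.Product.Base using (∃-syntax; _×_; _,_; proj₁; proj₂)
open import Data.Sum.Base using (inj₁; inj₂)
open import Data.Empty using (⊥-elim)
open import Relation.Nullary.Decidable.Core using (yes; no)
open import Relation.Binary.PropositionalEquality.Core
  using (_≡_; refl; sym; trans; cong; cong₂; subst)
open import Relation.Binary.PropositionalEquality.Properties using (module ≡-Reasoning)

open +-*-Solver using (solve; _:+_; _:*_; _:-_; :-_; _:=_; con)

0<½ : 0ℚ ℚ.< ½
0<½ = ℚ.positive⁻¹ ½

0<1 : 0ℚ ℚ.< 1ℚ
0<1 = ℚ.positive⁻¹ 1ℚ

*-pos : ∀ {p q} → 0ℚ ℚ.< p → 0ℚ ℚ.< q → 0ℚ ℚ.< p ℚ.* q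
*-pos {p} {q} 0<p 0<q = subst (ℚ._< p ℚ.* q) (ℚ.*-zeroʳ p)
  (ℚ.*-monoʳ-<-pos p {{ℚ.positive 0<p}} 0<q)

*-nonneg : ∀ {p q} → 0ℚ ℚ.≤ p → 0ℚ ℚ.≤ q → 0ℚ ℚ.≤ p ℚ.* q
*-nonneg {p} {q} 0≤p 0≤q = subst (ℚ._≤ p ℚ.* q) (ℚ.*-zeroʳ p)
  (ℚ.*-monoˡ-≤-nonNeg p {{ℚ.nonNegative 0≤p}} 0≤q)

+-nonneg : ∀ {p q} → 0ℚ ℚ.≤ p → 0ℚ ℚ.≤ q → 0ℚ ℚ.≤ p ℚ.+ q
+-nonneg = ℚ.+-mono-≤

square-nonneg : ∀ p → 0ℚ ℚ.≤ p ℚ.* p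
square-nonneg p with ℚ.≤-total 0ℚ p
... | inj₁ 0≤p = *-nonneg 0≤p 0≤p
... | inj₂ p≤0 = subst (0ℚ ℚ.≤_)
        (solve 1 (λ x → (:- x) :* (:- x) := x :* x) refl p)
        (*-nonneg (ℚ.neg-antimono-≤ p≤0) (ℚ.neg-antimono-≤ p≤0))

*-mono : ∀ {p q r s} → 0ℚ ℚ.≤ p → 0ℚ ℚ.≤ r → p ℚ.≤ q → r ℚ.≤ s →
         p ℚ.* r ℚ.≤ q ℚ.* s
*-mono {p} {q} {r} {s} 0≤p 0≤r p≤q r≤s = ℚ.≤-trans
  (ℚ.*-monoʳ-≤-nonNeg r {{ℚ.nonNegative 0≤r}} p≤q)
  (ℚ.*-monoˡ-≤-nonNeg q {{ℚ.nonNegative (ℚ.≤-trans 0≤p p≤q)}} r≤s)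

p≤q⇒0≤q-p : ∀ {p q} → p ℚ.≤ q → 0ℚ ℚ.≤ q ℚ.- p
p≤q⇒0≤q-p {p} {q} p≤q = subst (ℚ._≤ q ℚ.- p) (ℚ.+-inverseʳ p)
  (ℚ.+-monoˡ-≤ (ℚ.- p) p≤q)

0≤q-p⇒p≤q : ∀ {p q} → 0ℚ ℚ.≤ q ℚ.- p → p ℚ.≤ q
0≤q-p⇒p≤q {p} {q} h = subst₂′ (ℚ.+-identityˡ p)
  (solve 2 (λ p q → (q :- p) :+ p := q) refl p q) (ℚ.+-monoˡ-≤ p h)
  where
  subst₂′ : ∀ {a b c d} → a ≡ b → c ≡ d → a ℚ.≤ c → b ℚ.≤ d
  subst₂′ refl refl x = x

halves : ∀ ε → ½ ℚ.* ε ℚ.+ ½ ℚ.* ε ≡ ε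
halves ε = trans (sym (ℚ.*-distribʳ-+ ε ½ ½)) (ℚ.*-identityˡ ε)

-- The reciprocal in ℚ with the junk value 0 at 0.
recip : ℚ → ℚ
recip p with p ℚ.≟ 0ℚ
... | yes _   = 0ℚ
... | no p≢0 = ℚ.1/_ p {{ℚ.≢-nonZero p≢0}}

*-recip : ∀ {p} → 0ℚ ℚ.< p → p ℚ.* recip p ≡ 1ℚ
*-recip {p} 0<p with p ℚ.≟ 0ℚ
... | yes p≡0 = ⊥-elim (ℚ.<-irrefl (sym p≡0) 0<p)
... | no p≢0  = ℚ.*-inverseʳ p {{ℚ.≢-nonZero p≢0}}

recip-pos : ∀ {p} → 0ℚ ℚ.< p → 0ℚ ℚ.< recip p
recip-pos {p} 0<p with p ℚ.≟ 0ℚ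
... | yes p≡0 = ⊥-elim (ℚ.<-irrefl (sym p≡0) 0<p)
... | no p≢0  = ℚ.positive⁻¹ _ {{ℚ.1/pos⇒pos p {{ℚ.positive 0<p}}}}

-- Real numbers are Cauchy sequences of rationals up to _≃ℝ_.  The Σ-type
-- in Cauchy makes a modulus of convergence part of the data.
Cauchy : (ℕ → ℚ) → Set
Cauchy x = ∀ ε → 0ℚ ℚ.< ε →
  ∃[ N ] (∀ m n → N ℕ.≤ m → N ℕ.≤ n → ∣ x m ℚ.- x n ∣ ℚ.< ε)

record ℝ : Set where
  constructor real
  field
    seq    : ℕ → ℚ
    cauchy : Cauchy seq
open ℝ public

infix 4 _≃ℝ_ _<ℝ_

_≃ℝ_ : ℝ → ℝ → Set
x ≃ℝ y = ∀ ε → 0ℚ ℚ.< ε →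
  ∃[ N ] (∀ n → N ℕ.≤ n → ∣ seq x n ℚ.- seq y n ∣ ℚ.< ε)

_<ℝ_ : ℝ → ℝ → Set
x <ℝ y = ∃[ ε ] (0ℚ ℚ.< ε ×
  ∃[ N ] (∀ n → N ℕ.≤ n → seq x n ℚ.+ ε ℚ.≤ seq y n))

fromℚ : ℚ → ℝ
fromℚ p = real (λ _ → p) λ ε 0<ε → 0 , λ _ _ _ _ →
  subst (ℚ._< ε) (sym (cong ∣_∣ (ℚ.+-inverseʳ p))) 0<ε

0ℝ 1ℝ : ℝ
0ℝ = fromℚ 0ℚ
1ℝ = fromℚ 1ℚ

+-cauchy : ∀ {x y} → Cauchy x → Cauchy y → Cauchy (λ n → x n ℚ.+ y n)
+-cauchy {x} {y} cx cy ε 0<ε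
  with cx (½ ℚ.* ε) (*-pos 0<½ 0<ε) | cy (½ ℚ.* ε) (*-pos 0<½ 0<ε)
... | M , hx | N , hy = M ℕ.⊔ N , λ m n m≥ n≥ → ℚ.≤-<-trans
  (subst (ℚ._≤ ∣ x m ℚ.- x n ∣ ℚ.+ ∣ y m ℚ.- y n ∣)
    (cong ∣_∣ (solve 4 (λ a b c d → (a :- b) :+ (c :- d) := (a :+ c) :- (b :+ d))
                refl (x m) (x n) (y m) (y n)))
    (ℚ.∣p+q∣≤∣p∣+∣q∣ (x m ℚ.- x n) (y m ℚ.- y n)))
  (subst (∣ x m ℚ.- x n ∣ ℚ.+ ∣ y m ℚ.- y n ∣ ℚ.<_) (halves ε)
    (ℚ.+-mono-<
      (hx m n (ℕ.≤-trans (ℕ.m≤m⊔n M N) m≥) (ℕ.≤-trans (ℕ.m≤m⊔n M N) n≥))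
      (hy m n (ℕ.≤-trans (ℕ.m≤n⊔m M N) m≥) (ℕ.≤-trans (ℕ.m≤n⊔m M N) n≥))))

neg-cauchy : ∀ {x} → Cauchy x → Cauchy (λ n → ℚ.- x n)
neg-cauchy {x} cx ε 0<ε with cx ε 0<ε
... | N , h = N , λ m n m≥ n≥ → subst (ℚ._< ε)
  (trans (sym (ℚ.∣-p∣≡∣p∣ (x m ℚ.- x n)))
    (cong ∣_∣ (solve 2 (λ a b → :- (a :- b) := (:- a) :- (:- b)) refl (x m) (x n))))
  (h m n m≥ n≥)

bounded : ∀ {x} → Cauchy x →
  ∃[ B ] (0ℚ ℚ.< B × ∃[ N ] (∀ n → N ℕ.≤ n → ∣ x n ∣ ℚ.≤ B))
bounded {x} cx with cx 1ℚ 0<1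
... | N , h = 1ℚ ℚ.+ ∣ x N ∣
  , ℚ.+-mono-<-≤ 0<1 (ℚ.0≤∣p∣ (x N))
  , N , λ n n≥ → ℚ.≤-trans
      (subst (λ t → ∣ t ∣ ℚ.≤ ∣ x n ℚ.- x N ∣ ℚ.+ ∣ x N ∣)
        (solve 2 (λ a b → (a :- b) :+ b := a) refl (x n) (x N))
        (ℚ.∣p+q∣≤∣p∣+∣q∣ (x n ℚ.- x N) (x N)))
      (ℚ.+-monoˡ-≤ ∣ x N ∣ (ℚ.<⇒≤ (h n N n≥ ℕ.≤-refl)))

scaled : ∀ {P Q s t ε} → 0ℚ ℚ.< P → P ℚ.* Q ≡ 1ℚ → ∣ s ∣ ℚ.≤ P →
         ∣ t ∣ ℚ.< ε ℚ.* Q → ∣ s ℚ.* t ∣ ℚ.< ε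
scaled {P} {Q} {s} {t} {ε} 0<P PQ≡1 s≤P t< = begin-strict
  ∣ s ℚ.* t ∣         ≡⟨ ℚ.∣p*q∣≡∣p∣*∣q∣ s t ⟩
  ∣ s ∣ ℚ.* ∣ t ∣     ≤⟨ ℚ.*-monoʳ-≤-nonNeg ∣ t ∣ {{ℚ.nonNegative (ℚ.0≤∣p∣ t)}} s≤P ⟩
  P ℚ.* ∣ t ∣         <⟨ ℚ.*-monoʳ-<-pos P {{ℚ.positive 0<P}} t< ⟩
  P ℚ.* (ε ℚ.* Q)     ≡⟨ solve 3 (λ p e r → p :* (e :* r) := e :* (p :* r)) refl P ε Q ⟩
  ε ℚ.* (P ℚ.* Q)     ≡⟨ cong (ε ℚ.*_) PQ≡1 ⟩
  ε ℚ.* 1ℚ            ≡⟨ ℚ.*-identityʳ ε ⟩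
  ε                   ∎
  where open ℚ.≤-Reasoning

product-close : ∀ {a b c d ε} →
  ∣ a ℚ.* (c ℚ.- d) ∣ ℚ.< ½ ℚ.* ε → ∣ d ℚ.* (a ℚ.- b) ∣ ℚ.< ½ ℚ.* ε →
  ∣ a ℚ.* c ℚ.- b ℚ.* d ∣ ℚ.< ε
product-close {a} {b} {c} {d} {ε} h k = begin-strict
  ∣ a ℚ.* c ℚ.- b ℚ.* d ∣
    ≡⟨ cong ∣_∣ (solve 4 (λ a b c d → a :* c :- b :* d := a :* (c :- d) :+ d :* (a :- b))
                  refl a b c d) ⟩
  ∣ a ℚ.* (c ℚ.- d) ℚ.+ d ℚ.* (a ℚ.- b) ∣
    ≤⟨ ℚ.∣p+q∣≤∣p∣+∣q∣ (a ℚ.* (c ℚ.- d)) (d ℚ.* (a ℚ.- b)) ⟩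
  ∣ a ℚ.* (c ℚ.- d) ∣ ℚ.+ ∣ d ℚ.* (a ℚ.- b) ∣
    <⟨ ℚ.+-mono-< h k ⟩
  ½ ℚ.* ε ℚ.+ ½ ℚ.* ε
    ≡⟨ halves ε ⟩
  ε ∎
  where open ℚ.≤-Reasoning

*-cauchy : ∀ {x y} → Cauchy x → Cauchy y → Cauchy (λ n → x n ℚ.* y n)
*-cauchy {x} {y} cx cy ε 0<ε = go (bounded cx) (bounded cy)
  where
  0<½ε : 0ℚ ℚ.< ½ ℚ.* ε
  0<½ε = *-pos 0<½ 0<ε

  go : ∃[ A ] (0ℚ ℚ.< A × ∃[ N ] (∀ n → N ℕ.≤ n → ∣ x n ∣ ℚ.≤ A)) →
       ∃[ B ] (0ℚ ℚ.< B × ∃[ N ] (∀ n → N ℕ.≤ n → ∣ y n ∣ ℚ.≤ B)) →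
       ∃[ N ] (∀ m n → N ℕ.≤ m → N ℕ.≤ n → ∣ x m ℚ.* y m ℚ.- x n ℚ.* y n ∣ ℚ.< ε)
  go (A , 0<A , M , hA) (B , 0<B , N , hB) =
    (M ℕ.⊔ N) ℕ.⊔ (K ℕ.⊔ L) , λ m n m≥ n≥ →
      product-close {x m} {x n} {y m} {y n}
        (scaled 0<A (*-recip 0<A) (hA m (left (ℕ.m≤m⊔n M N) m≥))
          (proj₂ Y m n (right (ℕ.m≤n⊔m K L) m≥) (right (ℕ.m≤n⊔m K L) n≥)))
        (scaled 0<B (*-recip 0<B) (hB n (left (ℕ.m≤n⊔m M N) n≥))
          (proj₂ X m n (right (ℕ.m≤m⊔n K L) m≥) (right (ℕ.m≤m⊔n K L) n≥)))
    where
    X = cx (½ ℚ.* ε ℚ.* recip B) (*-pos 0<½ε (recip-pos 0<B))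
    Y = cy (½ ℚ.* ε ℚ.* recip A) (*-pos 0<½ε (recip-pos 0<A))
    K = proj₁ X
    L = proj₁ Y
    left : ∀ {i k} → i ℕ.≤ M ℕ.⊔ N → (M ℕ.⊔ N) ℕ.⊔ (K ℕ.⊔ L) ℕ.≤ k → i ℕ.≤ k
    left p q = ℕ.≤-trans p (ℕ.≤-trans (ℕ.m≤m⊔n (M ℕ.⊔ N) (K ℕ.⊔ L)) q)
    right : ∀ {i k} → i ℕ.≤ K ℕ.⊔ L → (M ℕ.⊔ N) ℕ.⊔ (K ℕ.⊔ L) ℕ.≤ k → i ℕ.≤ k
    right p q = ℕ.≤-trans p (ℕ.≤-trans (ℕ.m≤n⊔m (M ℕ.⊔ N) (K ℕ.⊔ L)) q)

-- |1/a - 1/b| · ab = |b - a|, with r and s the reciprocals of a and b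
recip-diff : ∀ {a b r s} → 0ℚ ℚ.< a → 0ℚ ℚ.< b → a ℚ.* r ≡ 1ℚ → b ℚ.* s ≡ 1ℚ →
             ∣ r ℚ.- s ∣ ℚ.* (a ℚ.* b) ≡ ∣ b ℚ.- a ∣
recip-diff {a} {b} {r} {s} 0<a 0<b ar≡1 bs≡1 = begin
  ∣ r ℚ.- s ∣ ℚ.* (a ℚ.* b)
    ≡⟨ cong (∣ r ℚ.- s ∣ ℚ.*_) (ℚ.0≤p⇒∣p∣≡p (ℚ.<⇒≤ (*-pos 0<a 0<b))) ⟨
  ∣ r ℚ.- s ∣ ℚ.* ∣ a ℚ.* b ∣
    ≡⟨ ℚ.∣p*q∣≡∣p∣*∣q∣ (r ℚ.- s) (a ℚ.* b) ⟨
  ∣ (r ℚ.- s) ℚ.* (a ℚ.* b) ∣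
    ≡⟨ cong ∣_∣ (solve 4 (λ a b r s → (r :- s) :* (a :* b) := (a :* r) :* b :- (b :* s) :* a)
                  refl a b r s) ⟩
  ∣ (a ℚ.* r) ℚ.* b ℚ.- (b ℚ.* s) ℚ.* a ∣
    ≡⟨ cong₂ (λ u v → ∣ u ℚ.* b ℚ.- v ℚ.* a ∣) ar≡1 bs≡1 ⟩
  ∣ 1ℚ ℚ.* b ℚ.- 1ℚ ℚ.* a ∣
    ≡⟨ cong₂ (λ u v → ∣ u ℚ.- v ∣) (ℚ.*-identityˡ b) (ℚ.*-identityˡ a) ⟩
  ∣ b ℚ.- a ∣ ∎
  where open ≡-Reasoning

recip-close : ∀ {a b r s δ ε} → 0ℚ ℚ.< δ → δ ℚ.≤ a → δ ℚ.≤ b →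
              a ℚ.* r ≡ 1ℚ → b ℚ.* s ≡ 1ℚ →
              ∣ b ℚ.- a ∣ ℚ.< ε ℚ.* (δ ℚ.* δ) → ∣ r ℚ.- s ∣ ℚ.< ε
recip-close {a} {b} {r} {s} {δ} {ε} 0<δ δ≤a δ≤b ar≡1 bs≡1 close =
  ℚ.*-cancelʳ-<-nonNeg (δ ℚ.* δ) {{ℚ.nonNegative (ℚ.<⇒≤ (*-pos 0<δ 0<δ))}}
    (ℚ.≤-<-trans
      (ℚ.*-monoˡ-≤-nonNeg ∣ r ℚ.- s ∣ {{ℚ.nonNegative (ℚ.0≤∣p∣ (r ℚ.- s))}}
        (*-mono (ℚ.<⇒≤ 0<δ) (ℚ.<⇒≤ 0<δ) δ≤a δ≤b))
      (subst (ℚ._< ε ℚ.* (δ ℚ.* δ))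
        (sym (recip-diff (ℚ.<-≤-trans 0<δ δ≤a) (ℚ.<-≤-trans 0<δ δ≤b) ar≡1 bs≡1))
        close))

recip-cauchy : ∀ {x} → Cauchy x → ∀ {δ} → 0ℚ ℚ.< δ → ∀ {N} →
               (∀ n → N ℕ.≤ n → δ ℚ.≤ x n) → Cauchy (λ n → recip (x n))
recip-cauchy {x} cx {δ} 0<δ {N} low ε 0<ε
  with cx (ε ℚ.* (δ ℚ.* δ)) (*-pos 0<ε (*-pos 0<δ 0<δ))
... | M , h = M ℕ.⊔ N , λ m n m≥ n≥ →
  let δ≤m = low m (ℕ.≤-trans (ℕ.m≤n⊔m M N) m≥)
      δ≤n = low n (ℕ.≤-trans (ℕ.m≤n⊔m M N) n≥)
  in recip-close {x m} {x n} {recip (x m)} {recip (x n)} 0<δ δ≤m δ≤n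
       (*-recip (ℚ.<-≤-trans 0<δ δ≤m)) (*-recip (ℚ.<-≤-trans 0<δ δ≤n))
       (h n m (ℕ.≤-trans (ℕ.m≤m⊔n M N) n≥) (ℕ.≤-trans (ℕ.m≤m⊔n M N) m≥))

infix  8 -ℝ_
infixl 7 _*ℝ_
infixl 6 _+ℝ_ _-ℝ_

_+ℝ_ _*ℝ_ : ℝ → ℝ → ℝ
real x cx +ℝ real y cy = real (λ n → x n ℚ.+ y n) (+-cauchy {x} {y} cx cy)
real x cx *ℝ real y cy = real (λ n → x n ℚ.* y n) (*-cauchy {x} {y} cx cy)

-ℝ_ : ℝ → ℝ
-ℝ real x cx = real (λ n → ℚ.- x n) (neg-cauchy {x} cx)

_-ℝ_ : ℝ → ℝ → ℝ
x -ℝ y = x +ℝ (-ℝ y)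

-- Only finitely many terms of the sequence are affected by the junk value
-- of recip, because the sequence is eventually bounded away from 0.
recipℝ : (x : ℝ) → 0ℝ <ℝ x → ℝ
recipℝ (real x cx) (δ , 0<δ , N , low) = real (λ n → recip (x n))
  (recip-cauchy {x} cx 0<δ (λ n n≥ → subst (ℚ._≤ x n) (ℚ.+-identityˡ δ) (low n n≥)))

record ℂ : Set where
  constructor _+i_
  field
    re im : ℝ
open ℂ public

infix 4 _≃_

_≃_ : ℂ → ℂ → Set
w ≃ z = re w ≃ℝ re z × im w ≃ℝ im z

infix  8 -_
infixl 7 _*_
infixl 6 _+_ _-_

0ℂ 1ℂ : ℂ
0ℂ = 0ℝ +i 0ℝ
1ℂ = 1ℝ +i 0ℝ

-_ : ℂ → ℂ
- (a +i b) = (-ℝ a) +i (-ℝ b)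

_+_ _*_ : ℂ → ℂ → ℂ
(a +i b) + (c +i d) = (a +ℝ c) +i (b +ℝ d)
(a +i b) * (c +i d) = (a *ℝ c -ℝ b *ℝ d) +i (a *ℝ d +ℝ b *ℝ c)

_-_ : ℂ → ℂ → ℂ
w - z = w + (- z)

-- The square of the usual absolute value.
∣_∣² : ℂ → ℝ
∣ a +i b ∣² = a *ℝ a +ℝ b *ℝ b

-- For a rational r > 0, the relation |z| < r, squared to avoid roots.
infix 4 ∣_∣<_
∣_∣<_ : ℂ → ℚ → Set
∣ z ∣< r = ∣ z ∣² <ℝ fromℚ (r ℚ.* r)

-- Being nonzero, in the constructive sense of |z| > 0.  This is what makes
-- the reciprocal of a Cauchy real or complex number definable; classically
-- it is the same as ¬ (z ≃ 0ℂ).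
infix 4 _≄0
_≄0 : ℂ → Set
z ≄0 = 0ℝ <ℝ ∣ z ∣²

-- The reciprocal, conj z / |z|².
inv : (z : ℂ) → z ≄0 → ℂ
inv z z≄0 = (re z *ℝ r) +i ((-ℝ im z) *ℝ r)
  where r = recipℝ ∣ z ∣² z≄0

infixr 9 _^_
_^_ : ℂ → ℕ → ℂ
z ^ zero  = 1ℂ
z ^ suc n = z * z ^ n

zpow : (z : ℂ) → z ≄0 → ℤ → ℂ
zpow z z≄0 (+ n)    = z ^ n
zpow z z≄0 -[1+ n ] = inv z z≄0 ^ suc n

-1≄0 : - 1ℂ ≄0
-1≄0 = 1ℚ , 0<1 , 0 , λ _ _ → ℚ.≤-refl

-- ∑< N f = f 0 + f 1 + ⋯ + f (N - 1)
∑< : ℕ → (ℕ → ℂ) → ℂ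
∑< zero    f = 0ℂ
∑< (suc N) f = ∑< N f + f N

-- The series f 0 + f 1 + f 2 + ⋯ converges and its sum is S.
HasSum : (ℕ → ℂ) → ℂ → Set
HasSum f S = ∀ ε → 0ℚ ℚ.< ε →
  ∃[ N ] (∀ n → N ℕ.≤ n → ∣ ∑< n f - S ∣< ε)

-- The q-shifted factorial (a;q)ₙ.
poch : ℂ → ℂ → ℕ → ℂ
poch a q zero    = 1ℂ
poch a q (suc n) = poch a q n * (1ℂ - a * q ^ n)

nsq : ℂ → ℕ → ℚ
nsq z = seq ∣ z ∣²

nsq-nonneg : ∀ z n → 0ℚ ℚ.≤ nsq z n
nsq-nonneg z n = +-nonneg (square-nonneg (seq (re z) n)) (square-nonneg (seq (im z) n))

nsq-* : ∀ w z n → nsq (w * z) n ≡ nsq w n ℚ.* nsq z n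
nsq-* w z n = solve 4
  (λ a b c d → (a :* c :- b :* d) :* (a :* c :- b :* d)
            :+ (a :* d :+ b :* c) :* (a :* d :+ b :* c)
            := (a :* a :+ b :* b) :* (c :* c :+ d :* d))
  refl (seq (re w) n) (seq (im w) n) (seq (re z) n) (seq (im z) n)

*-≄0 : ∀ {w z} → w ≄0 → z ≄0 → w * z ≄0
*-≄0 {w} {z} (δ , 0<δ , M , hw) (η , 0<η , N , hz) =
  δ ℚ.* η , *-pos 0<δ 0<η , M ℕ.⊔ N , λ n n≥ →
    subst (0ℚ ℚ.+ δ ℚ.* η ℚ.≤_) (sym (nsq-* w z n))
      (subst (ℚ._≤ nsq w n ℚ.* nsq z n) (sym (ℚ.+-identityˡ _))
        (*-mono (ℚ.<⇒≤ 0<δ) (ℚ.<⇒≤ 0<η)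
          (subst (ℚ._≤ nsq w n) (ℚ.+-identityˡ δ) (hw n (ℕ.≤-trans (ℕ.m≤m⊔n M N) n≥)))
          (subst (ℚ._≤ nsq z n) (ℚ.+-identityˡ η) (hz n (ℕ.≤-trans (ℕ.m≤n⊔m M N) n≥)))))

^-≤1 : ∀ q n → nsq q n ℚ.≤ 1ℚ → ∀ k → nsq (q ^ k) n ℚ.≤ 1ℚ
^-≤1 q n h zero    = ℚ.≤-refl
^-≤1 q n h (suc k) = subst (ℚ._≤ 1ℚ) (sym (nsq-* q (q ^ k) n))
  (*-mono (nsq-nonneg q n) (nsq-nonneg (q ^ k) n) h (^-≤1 q n h k))

1-≄0 : ∀ {w} → ∣ w ∣< 1ℚ → 1ℂ - w ≄0
1-≄0 {w} (ε , 0<ε , N , h) =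
  (½ ℚ.* ε) ℚ.* (½ ℚ.* ε) , *-pos (*-pos 0<½ 0<ε) (*-pos 0<½ 0<ε) , N , λ n n≥ →
    bound (seq (re w) n) (seq (im w) n) (h n n≥)
  where
  t = ½ ℚ.* ε
  bound : ∀ a b → a ℚ.* a ℚ.+ b ℚ.* b ℚ.+ ε ℚ.≤ 1ℚ ℚ.* 1ℚ →
          0ℚ ℚ.+ t ℚ.* t ℚ.≤
          (1ℚ ℚ.+ ℚ.- a) ℚ.* (1ℚ ℚ.+ ℚ.- a) ℚ.+ (0ℚ ℚ.+ ℚ.- b) ℚ.* (0ℚ ℚ.+ ℚ.- b)
  bound a b ab≤1 = 0≤q-p⇒p≤q (subst (0ℚ ℚ.≤_) identity
    (+-nonneg (square-nonneg b)
      (+-nonneg (square-nonneg (1ℚ ℚ.- a ℚ.- t))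
        (*-nonneg (ℚ.<⇒≤ (*-pos 0<½ 0<ε))
          (+-nonneg (square-nonneg (1ℚ ℚ.- a))
            (+-nonneg (square-nonneg b) (p≤q⇒0≤q-p ab≤1)))))))
    where
    identity : b ℚ.* b ℚ.+ ((1ℚ ℚ.- a ℚ.- t) ℚ.* (1ℚ ℚ.- a ℚ.- t) ℚ.+
        t ℚ.* ((1ℚ ℚ.- a) ℚ.* (1ℚ ℚ.- a) ℚ.+
          (b ℚ.* b ℚ.+ (1ℚ ℚ.* 1ℚ ℚ.- (a ℚ.* a ℚ.+ b ℚ.* b ℚ.+ ε)))))
      ≡ (1ℚ ℚ.+ ℚ.- a) ℚ.* (1ℚ ℚ.+ ℚ.- a) ℚ.+ (0ℚ ℚ.+ ℚ.- b) ℚ.* (0ℚ ℚ.+ ℚ.- b)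
        ℚ.- (0ℚ ℚ.+ t ℚ.* t)
    identity = solve 3
      (λ a b e → let 𝟙 = con 1ℚ ; 𝟘 = con 0ℚ ; t = con ½ :* e in
        b :* b :+ ((𝟙 :- a :- t) :* (𝟙 :- a :- t) :+
          t :* ((𝟙 :- a) :* (𝟙 :- a) :+
            (b :* b :+ (𝟙 :* 𝟙 :- (a :* a :+ b :* b :+ e)))))
        := (𝟙 :+ :- a) :* (𝟙 :+ :- a) :+ (𝟘 :+ :- b) :* (𝟘 :+ :- b)
           :- (𝟘 :+ t :* t))
      refl a b ε

*^-<1 : ∀ {q} → ∣ q ∣< 1ℚ → ∀ k → ∣ q * q ^ k ∣< 1ℚ
*^-<1 {q} (ε , 0<ε , N , h) k = ε , 0<ε , N , λ n n≥ →
  ℚ.≤-trans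
    (ℚ.+-monoˡ-≤ ε (subst (ℚ._≤ nsq q n) (sym (nsq-* q (q ^ k) n))
      (subst (nsq q n ℚ.* nsq (q ^ k) n ℚ.≤_) (ℚ.*-identityʳ (nsq q n))
        (ℚ.*-monoˡ-≤-nonNeg (nsq q n) {{ℚ.nonNegative (nsq-nonneg q n)}}
          (^-≤1 q n
            (ℚ.≤-trans
              (subst (ℚ._≤ nsq q n ℚ.+ ε) (ℚ.+-identityʳ _)
                (ℚ.+-monoʳ-≤ (nsq q n) (ℚ.<⇒≤ 0<ε)))
              (h n n≥))
            k)))))
    (h n n≥)

-- (q;q)ₙ ≠ 0 when |q| < 1, so that it may be used as a denominator.
poch≄0 : ∀ {q} → ∣ q ∣< 1ℚ → ∀ n → poch q q n ≄0
poch≄0 q<1 zero    = 1ℚ , 0<1 , 0 , λ _ _ → ℚ.≤-refl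
poch≄0 {q} q<1 (suc n) =
  *-≄0 {poch q q n} {1ℂ - q * q ^ n} (poch≄0 q<1 n) (1-≄0 {q * q ^ n} (*^-<1 {q} q<1 n))

{-# OPTIONS --safe #-}
module Submission where

-- Expanding (-1/z)ₙ₊₁(-zq)ₙ by the finite Jacobi triple product and summing over n with a
-- terminating q-Chu–Vandermonde sum gives, for every N,
--   ∑ₙ≤N (q)_N/(q)_{N-n} lhsₙ = ∑ⱼ≤N (q)_N²/((q)_{N-j}(q)_{N+j+1}) (-1)ʲ qʲ⁽ʲ⁺¹⁾ (zʲ + z⁻ʲ⁻¹).
-- The weights on both sides differ from 1 by at most |q|^(N-n) times an exponential in n, which the
-- factors q^(n(n+1)/2) absorb, so the unweighted partial sums differ by O(|q|^N).
-- Complex numbers are Cauchy sequences of Gaussian rationals, and the identity and the estimates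
-- hold exactly and uniformly at each late index of these sequences.

-- The finite identity is one step of Bailey's lemma with a = q, ρ₁ = q and ρ₂ → ∞. Up to a factor 1
-- - q, the Bailey pair is α_j = q^(j(j+1)/2) (z^j + z^(-j-1)) and β_n = (-1/z)_(n+1) (-zq)_n /
-- (q)_(2n+1). The lemma multiplies α_j by (-1)^j q^(j(j+1)/2), whence the exponent j(j+1). The
-- indices j and -1-j have the same exponent n(n+1) and opposite signs (-1)^n, so the difference of
-- the two halves of the bilateral series is a single sum over z^j + z^(-j-1). Truncation at N keeps
-- the interchange of summations finite; the price is the weights. Sums of series are taken along
-- the diagonal of a sequence of Cauchy sequences, so each bound has to hold with the same constants
-- at all late indices. At a late index |q| is already below a fixed r < 1 and z is already away
-- from 0, so that the reciprocals there are genuine and not default values.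

open import Defs
open import Level using (0ℓ)
open import Algebra.Bundles using (CommutativeRing)
open import Algebra.Structures using (IsCommutativeRing)
import Algebra.Properties.CommutativeSemiring.Exp as Exp
import Algebra.Solver.Ring.AlmostCommutativeRing as ACR
import Algebra.Solver.Ring.Simple as RingSolver
open import Data.Integer.Base as ℤ using (ℤ; +_; -[1+_])
import Data.Integer.Properties as ℤ
open import Data.Nat.Base as ℕ using (ℕ; zero; suc)
open import Data.Nat.Combinatorics using (_C_; nC1≡n; nCk+nC[k+1]≡[n+1]C[k+1])
import Data.Nat.Coprimality as Coprime
import Data.Nat.Properties as ℕ
import Data.Nat.Solver as ℕSolver
open import Data.Product.Base using (∃-syntax; _×_; _,_; proj₁; proj₂)
open import Data.Rational.Base as ℚ using (ℚ; 0ℚ; 1ℚ; ½; mkℚ)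
import Data.Rational.Properties as ℚ
import Data.Rational.Solver as ℚSolver
import Data.Rational.Unnormalised.Base as ℚᵘ
import Data.Rational.Unnormalised.Properties as ℚᵘ
open import Data.Unit.Base using (tt)
open import Relation.Binary.Definitions using (DecidableEquality)
open import Relation.Binary.PropositionalEquality.Core
  using (_≡_; refl; sym; trans; cong; cong₂; subst)
open import Relation.Binary.PropositionalEquality.Properties using (module ≡-Reasoning; isEquivalence)
open import Relation.Nullary.Decidable.Core using (yes; no; toWitness)

-- Gaussian rationals

-- A data type and not a record, so that the operations do not unfold on variables.
infix  7 _,i_
data ℚ[i] : Set where
  _,i_ : ℚ → ℚ → ℚ[i]

infix  8 ⊖_
infixl 7 _⊗_
infixl 6 _⊕_ _⊝_

_⊕_ _⊗_ _⊝_ : ℚ[i] → ℚ[i] → ℚ[i]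
(a ,i b) ⊕ (c ,i d) = (a ℚ.+ c) ,i (b ℚ.+ d)
(a ,i b) ⊗ (c ,i d) = (a ℚ.* c ℚ.- b ℚ.* d) ,i (a ℚ.* d ℚ.+ b ℚ.* c)

⊖_ : ℚ[i] → ℚ[i]
⊖ (a ,i b) = (ℚ.- a) ,i (ℚ.- b)

x ⊝ y = x ⊕ ⊖ y

𝟘 𝟙 : ℚ[i]
𝟘 = 0ℚ ,i 0ℚ
𝟙 = 1ℚ ,i 0ℚ

_≟_ : DecidableEquality ℚ[i]
(a ,i b) ≟ (c ,i d) with a ℚ.≟ c | b ℚ.≟ d
... | yes refl | yes refl = yes refl
... | no a≢c   | _        = no λ { refl → a≢c refl }
... | yes _    | no b≢d   = no λ { refl → b≢d refl }

⊕-⊗-isCommutativeRing : IsCommutativeRing _≡_ _⊕_ _⊗_ ⊖_ 𝟘 𝟙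
⊕-⊗-isCommutativeRing = record
  { isRing = record
    { +-isAbelianGroup = record
      { isGroup = record
        { isMonoid = record
          { isSemigroup = record
            { isMagma = record { isEquivalence = isEquivalence ; ∙-cong = cong₂ _⊕_ }
            ; assoc = λ { (a ,i b) (c ,i d) (e ,i f) →
                cong₂ _,i_ (ℚ.+-assoc a c e) (ℚ.+-assoc b d f) }
            }
          ; identity =
              (λ { (a ,i b) → cong₂ _,i_ (ℚ.+-identityˡ a) (ℚ.+-identityˡ b) })
            , (λ { (a ,i b) → cong₂ _,i_ (ℚ.+-identityʳ a) (ℚ.+-identityʳ b) })
          }
        ; inverse =
            (λ { (a ,i b) → cong₂ _,i_ (ℚ.+-inverseˡ a) (ℚ.+-inverseˡ b) })
          , (λ { (a ,i b) → cong₂ _,i_ (ℚ.+-inverseʳ a) (ℚ.+-inverseʳ b) })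
        ; ⁻¹-cong = cong ⊖_
        }
      ; comm = λ { (a ,i b) (c ,i d) → cong₂ _,i_ (ℚ.+-comm a c) (ℚ.+-comm b d) }
      }
    ; *-cong = cong₂ _⊗_
    ; *-assoc = λ { (a ,i b) (c ,i d) (e ,i f) → cong₂ _,i_
        (solve 6 (λ a b c d e f →
          (a :* c :- b :* d) :* e :- (a :* d :+ b :* c) :* f
          := a :* (c :* e :- d :* f) :- b :* (c :* f :+ d :* e)) refl a b c d e f)
        (solve 6 (λ a b c d e f →
          (a :* c :- b :* d) :* f :+ (a :* d :+ b :* c) :* e
          := a :* (c :* f :+ d :* e) :+ b :* (c :* e :- d :* f)) refl a b c d e f) }
    ; *-identity =
        (λ { (a ,i b) → cong₂ _,i_
          (solve 2 (λ a b → con 1ℚ :* a :- con 0ℚ :* b := a) refl a b)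
          (solve 2 (λ a b → con 1ℚ :* b :+ con 0ℚ :* a := b) refl a b) })
      , (λ { (a ,i b) → cong₂ _,i_
          (solve 2 (λ a b → a :* con 1ℚ :- b :* con 0ℚ := a) refl a b)
          (solve 2 (λ a b → a :* con 0ℚ :+ b :* con 1ℚ := b) refl a b) })
    ; distrib =
        (λ { (a ,i b) (c ,i d) (e ,i f) → cong₂ _,i_
          (solve 6 (λ a b c d e f →
            a :* (c :+ e) :- b :* (d :+ f) := (a :* c :- b :* d) :+ (a :* e :- b :* f))
            refl a b c d e f)
          (solve 6 (λ a b c d e f →
            a :* (d :+ f) :+ b :* (c :+ e) := (a :* d :+ b :* c) :+ (a :* f :+ b :* e))
            refl a b c d e f) })
      , (λ { (a ,i b) (c ,i d) (e ,i f) → cong₂ _,i_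
          (solve 6 (λ a b c d e f →
            (c :+ e) :* a :- (d :+ f) :* b := (c :* a :- d :* b) :+ (e :* a :- f :* b))
            refl a b c d e f)
          (solve 6 (λ a b c d e f →
            (c :+ e) :* b :+ (d :+ f) :* a := (c :* b :+ d :* a) :+ (e :* b :+ f :* a))
            refl a b c d e f) })
    }
  ; *-comm = λ { (a ,i b) (c ,i d) → cong₂ _,i_
      (solve 4 (λ a b c d → a :* c :- b :* d := c :* a :- d :* b) refl a b c d)
      (solve 4 (λ a b c d → a :* d :+ b :* c := c :* b :+ d :* a) refl a b c d) }
  }
  where open ℚSolver.+-*-Solver

ℚ[i]-commutativeRing : CommutativeRing 0ℓ 0ℓ
ℚ[i]-commutativeRing = record { isCommutativeRing = ⊕-⊗-isCommutativeRing }

module G = RingSolver (ACR.fromCommutativeRing ℚ[i]-commutativeRing) _≟_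

open CommutativeRing ℚ[i]-commutativeRing using () renaming
  ( +-identityˡ to ⊕-identityˡ; +-identityʳ to ⊕-identityʳ; +-assoc to ⊕-assoc
  ; *-identityˡ to ⊗-identityˡ; *-identityʳ to ⊗-identityʳ
  ; distribˡ to ⊗-distribˡ-⊕; zeroˡ to ⊗-zeroˡ; zeroʳ to ⊗-zeroʳ)

open Exp (CommutativeRing.commutativeSemiring ℚ[i]-commutativeRing) using () renaming
  (_^_ to _^ᵍ_; ^-homo-* to ^ᵍ-homo-⊗)

I : ∀ {n} → G.Polynomial n
I = G.con 𝟙

O : ∀ {n} → G.Polynomial n
O = G.con 𝟘

-- Finite sums, shifted factorials and triangular numbers

∑ : ℕ → (ℕ → ℚ[i]) → ℚ[i]
∑ zero    f = 𝟘
∑ (suc N) f = ∑ N f ⊕ f N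

∑-cong : ∀ N {f h} → (∀ {n} → n ℕ.< N → f n ≡ h n) → ∑ N f ≡ ∑ N h
∑-cong zero    eq = refl
∑-cong (suc N) eq = cong₂ _⊕_ (∑-cong N (λ n<N → eq (ℕ.m<n⇒m<1+n n<N))) (eq ℕ.≤-refl)

∑-zero : ∀ N {f} → (∀ {n} → n ℕ.< N → f n ≡ 𝟘) → ∑ N f ≡ 𝟘
∑-zero zero    eq = refl
∑-zero (suc N) eq =
  trans (cong₂ _⊕_ (∑-zero N (λ n<N → eq (ℕ.m<n⇒m<1+n n<N))) (eq ℕ.≤-refl)) (⊕-identityˡ 𝟘)

⊗-distribˡ-∑ : ∀ c N f → c ⊗ ∑ N f ≡ ∑ N (λ n → c ⊗ f n)
⊗-distribˡ-∑ c zero    f = ⊗-zeroʳ c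
⊗-distribˡ-∑ c (suc N) f =
  trans (⊗-distribˡ-⊕ c (∑ N f) (f N)) (cong (_⊕ c ⊗ f N) (⊗-distribˡ-∑ c N f))

∑-⊕ : ∀ N f h → ∑ N (λ n → f n ⊕ h n) ≡ ∑ N f ⊕ ∑ N h
∑-⊕ zero    f h = refl
∑-⊕ (suc N) f h = trans (cong (_⊕ (f N ⊕ h N)) (∑-⊕ N f h))
  (solve 4 (λ a b c d → (a :+ b) :+ (c :+ d) := (a :+ c) :+ (b :+ d)) refl
    (∑ N f) (∑ N h) (f N) (h N))
  where open G

∑-⊝ : ∀ N f h → ∑ N (λ n → f n ⊝ h n) ≡ ∑ N f ⊝ ∑ N h
∑-⊝ zero    f h = refl
∑-⊝ (suc N) f h = trans (cong (_⊕ (f N ⊝ h N)) (∑-⊝ N f h))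
  (solve 4 (λ a b c d → (a :- b) :+ (c :- d) := (a :+ c) :- (b :+ d)) refl
    (∑ N f) (∑ N h) (f N) (h N))
  where open G

∑-head : ∀ N f → ∑ (suc N) f ≡ f 0 ⊕ ∑ N (λ n → f (suc n))
∑-head zero    f = solve 1 (λ a → O :+ a := a :+ O) refl (f 0) where open G
∑-head (suc N) f = trans (cong (_⊕ f (suc N)) (∑-head N f)) (⊕-assoc (f 0) _ (f (suc N)))

∑-drop : ∀ j K f → (∀ {n} → n ℕ.< j → f n ≡ 𝟘) → ∑ (j ℕ.+ K) f ≡ ∑ K (λ m → f (j ℕ.+ m))
∑-drop zero    K f f≡𝟘 = refl
∑-drop (suc j) K f f≡𝟘 = begin
  ∑ (suc (j ℕ.+ K)) f                       ≡⟨ ∑-head (j ℕ.+ K) f ⟩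
  f 0 ⊕ ∑ (j ℕ.+ K) (λ n → f (suc n))       ≡⟨ cong (_⊕ ∑ (j ℕ.+ K) (λ n → f (suc n))) (f≡𝟘 ℕ.z<s) ⟩
  𝟘 ⊕ ∑ (j ℕ.+ K) (λ n → f (suc n))         ≡⟨ ⊕-identityˡ _ ⟩
  ∑ (j ℕ.+ K) (λ n → f (suc n))             ≡⟨ ∑-drop j K (λ n → f (suc n)) (λ n<j → f≡𝟘 (ℕ.s<s n<j)) ⟩
  ∑ K (λ m → f (suc (j ℕ.+ m)))             ∎
  where open ≡-Reasoning

∑-swap : ∀ N K (f : ℕ → ℕ → ℚ[i]) → ∑ N (λ n → ∑ K (f n)) ≡ ∑ K (λ j → ∑ N (λ n → f n j))
∑-swap zero    K f = sym (∑-zero K (λ _ → refl))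
∑-swap (suc N) K f = trans (cong (_⊕ ∑ K (f N)) (∑-swap N K f))
  (sym (∑-⊕ K (λ j → ∑ N (λ n → f n j)) (f N)))

pochᵍ : ℚ[i] → ℚ[i] → ℕ → ℚ[i]
pochᵍ a q zero    = 𝟙
pochᵍ a q (suc n) = pochᵍ a q n ⊗ (𝟙 ⊝ a ⊗ q ^ᵍ n)

tri : ℕ → ℕ
tri zero    = 0
tri (suc n) = suc n ℕ.+ tri n

tri-+ : ∀ j m → tri (j ℕ.+ m) ≡ tri j ℕ.+ (tri m ℕ.+ j ℕ.* m)
tri-+ zero    m = sym (ℕ.+-identityʳ (tri m))
tri-+ (suc j) m = trans (cong (suc (j ℕ.+ m) ℕ.+_) (tri-+ j m))
  (solve 4 (λ j m t u → (con 1 :+ (j :+ m)) :+ (t :+ (u :+ j :* m))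
      := (con 1 :+ j :+ t) :+ (u :+ (m :+ j :* m)))
    refl j m (tri j) (tri m))
  where open ℕSolver.+-*-Solver

sgn : ℕ → ℚ[i]
sgn n = (⊖ 𝟙) ^ᵍ n

-- The finite identity

-- The reciprocals 1/(q;q)ₙ enter as a family `g` with its defining equation, so that everything
-- below is a ring identity.
module QSeries (q : ℚ[i]) (g : ℕ → ℚ[i]) (⟨q⟩⊗g : ∀ n → pochᵍ q q n ⊗ g n ≡ 𝟙) where

  ⟨q⟩ : ℕ → ℚ[i]
  ⟨q⟩ = pochᵍ q q

  g-step : ∀ n → g n ≡ g (suc n) ⊗ (𝟙 ⊝ q ^ᵍ suc n)
  g-step n = begin
    g n                                               ≡⟨ ⊗-identityʳ (g n) ⟨
    g n ⊗ 𝟙                                           ≡⟨ cong (g n ⊗_) (⟨q⟩⊗g (suc n)) ⟨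
    g n ⊗ (⟨q⟩ n ⊗ (𝟙 ⊝ q ^ᵍ suc n) ⊗ g (suc n))      ≡⟨ solve 4 (λ a b c d →
                                                           a :* (b :* c :* d) := b :* a :* (d :* c)) refl
                                                           (g n) (⟨q⟩ n) (𝟙 ⊝ q ^ᵍ suc n) (g (suc n)) ⟩
    ⟨q⟩ n ⊗ g n ⊗ (g (suc n) ⊗ (𝟙 ⊝ q ^ᵍ suc n))      ≡⟨ cong (_⊗ (g (suc n) ⊗ (𝟙 ⊝ q ^ᵍ suc n))) (⟨q⟩⊗g n) ⟩
    𝟙 ⊗ (g (suc n) ⊗ (𝟙 ⊝ q ^ᵍ suc n))                ≡⟨ ⊗-identityˡ _ ⟩
    g (suc n) ⊗ (𝟙 ⊝ q ^ᵍ suc n)                      ∎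
    where
    open ≡-Reasoning
    open G

  -- 1 / (q;q)ₙ₋ⱼ, which is 0 for n < j.
  g- : ℕ → ℕ → ℚ[i]
  g- n       zero    = g n
  g- zero    (suc j) = 𝟘
  g- (suc n) (suc j) = g- n j

  g-+ : ∀ j d → g- (j ℕ.+ d) j ≡ g d
  g-+ zero    d = refl
  g-+ (suc j) d = g-+ j d

  g-+-+ : ∀ j n m → g- (j ℕ.+ n) (j ℕ.+ m) ≡ g- n m
  g-+-+ zero    n m = refl
  g-+-+ (suc j) n m = g-+-+ j n m

  g-< : ∀ {n j} → n ℕ.< j → g- n j ≡ 𝟘
  g-< {zero}  {suc j} _   = refl
  g-< {suc n} {suc j} n<j = g-< (ℕ.s<s⁻¹ n<j)

  g--step : ∀ m d → g- (m ℕ.+ d) (suc m) ≡ g d ⊗ (𝟙 ⊝ q ^ᵍ d)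
  g--step zero    zero    = sym (solve 1 (λ a → a :* (I :- I) := O) refl (g 0)) where open G
  g--step zero    (suc d) = g-step d
  g--step (suc m) d       = g--step m d

  -- Multiplied by q so that it also holds for d < 2, where the left side vanishes.
  g--step₂ : ∀ m d → q ⊗ g- (m ℕ.+ d) (suc (suc m)) ≡ g d ⊗ (𝟙 ⊝ q ^ᵍ d) ⊗ (q ⊝ q ^ᵍ d)
  g--step₂ zero zero = solve 2 (λ q a → q :* O := a :* (I :- I) :* (q :- I)) refl q (g 0)
    where open G
  g--step₂ zero (suc d) = begin
    q ⊗ g- d 1
      ≡⟨ cong (q ⊗_) (g--step 0 d) ⟩
    q ⊗ (g d ⊗ (𝟙 ⊝ q ^ᵍ d))
      ≡⟨ solve 3 (λ q a x → q :* (a :* (I :- x)) := a :* (q :- q :* x)) refl q (g d) (q ^ᵍ d) ⟩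
    g d ⊗ (q ⊝ q ^ᵍ suc d)
      ≡⟨ cong (_⊗ (q ⊝ q ^ᵍ suc d)) (g-step d) ⟩
    g (suc d) ⊗ (𝟙 ⊝ q ^ᵍ suc d) ⊗ (q ⊝ q ^ᵍ suc d) ∎
    where
    open ≡-Reasoning
    open G
  g--step₂ (suc m) d = g--step₂ m d

  -- Gaussian binomials and the q-Chu-Vandermonde sum

  gauss : ℕ → ℕ → ℚ[i]
  gauss M m = ⟨q⟩ M ⊗ g- M m ⊗ g m

  gauss-zero : ∀ M → gauss M 0 ≡ g 0
  gauss-zero M = trans (cong (_⊗ g 0) (⟨q⟩⊗g M)) (⊗-identityˡ (g 0))

  -- Splits 1 - q^(M+1) into q^(m+1) (1 - q^(M-m)) and 1 - q^(m+1); each part cancels the last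
  -- factor of one denominator. At m = M the first part is 0, in accordance with `g-`.
  gauss-pascal : ∀ M m → m ℕ.≤ M →
    gauss (suc M) (suc m) ≡ q ^ᵍ suc m ⊗ gauss M (suc m) ⊕ gauss M m
  gauss-pascal M m m≤M with ℕ.m≤n⇒∃[o]m+o≡n m≤M
  ... | d , refl = begin
    ⟨q⟩ (m ℕ.+ d) ⊗ (𝟙 ⊝ q ⊗ q ^ᵍ (m ℕ.+ d)) ⊗ g- (m ℕ.+ d) m ⊗ g (suc m)
      ≡⟨ cong₂ (λ x y → ⟨q⟩ (m ℕ.+ d) ⊗ (𝟙 ⊝ q ⊗ x) ⊗ y ⊗ g (suc m)) (^ᵍ-homo-⊗ q m d) (g-+ m d) ⟩
    ⟨q⟩ (m ℕ.+ d) ⊗ (𝟙 ⊝ q ⊗ (q ^ᵍ m ⊗ q ^ᵍ d)) ⊗ g d ⊗ g (suc m)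
      ≡⟨ solve 6 (λ P gd gm q X Y →
        P :* (I :- q :* (X :* Y)) :* gd :* gm
        := q :* X :* (P :* (gd :* (I :- Y)) :* gm) :+ P :* gd :* (gm :* (I :- q :* X)))
        refl (⟨q⟩ (m ℕ.+ d)) (g d) (g (suc m)) q (q ^ᵍ m) (q ^ᵍ d) ⟩
    q ^ᵍ suc m ⊗ (⟨q⟩ (m ℕ.+ d) ⊗ (g d ⊗ (𝟙 ⊝ q ^ᵍ d)) ⊗ g (suc m))
      ⊕ ⟨q⟩ (m ℕ.+ d) ⊗ g d ⊗ (g (suc m) ⊗ (𝟙 ⊝ q ^ᵍ suc m))
      ≡⟨ cong₂ _⊕_
           (cong (λ x → q ^ᵍ suc m ⊗ (⟨q⟩ (m ℕ.+ d) ⊗ x ⊗ g (suc m))) (g--step m d))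
           (cong₂ (λ x y → ⟨q⟩ (m ℕ.+ d) ⊗ x ⊗ y) (g-+ m d) (g-step m)) ⟨
    q ^ᵍ suc m ⊗ gauss (m ℕ.+ d) (suc m) ⊕ gauss (m ℕ.+ d) m ∎
    where
    open G
    open ≡-Reasoning

  -- Pascal's rule moved onto `f`: M drops by one, and f m becomes q^m f m + f (m+1). This drives
  -- the induction of `chu-vandermonde`.
  gauss-sum : ∀ M (f : ℕ → ℚ[i]) → ∑ (suc (suc M)) (λ m → gauss (suc M) m ⊗ f m) ≡
              ∑ (suc M) (λ m → gauss M m ⊗ (q ^ᵍ m ⊗ f m ⊕ f (suc m)))
  gauss-sum M f = begin
    ∑ (suc (suc M)) (λ m → gauss (suc M) m ⊗ f m)
      ≡⟨ ∑-head (suc M) (λ m → gauss (suc M) m ⊗ f m) ⟩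
    gauss (suc M) 0 ⊗ f 0 ⊕ ∑ (suc M) (λ m → gauss (suc M) (suc m) ⊗ f (suc m))
      ≡⟨ cong₂ _⊕_
           (cong (_⊗ f 0) (trans (gauss-zero (suc M)) (sym (gauss-zero M))))
           (trans
             (∑-cong (suc M) {λ m → gauss (suc M) (suc m) ⊗ f (suc m)} {λ m → F (suc m) ⊕ H m}
               λ {m} m<1+M → trans
               (cong (_⊗ f (suc m)) (gauss-pascal M m (ℕ.s≤s⁻¹ m<1+M)))
               (solve 4 (λ x a b y → (x :* a :+ b) :* y := a :* (x :* y) :+ b :* y) refl
                 (q ^ᵍ suc m) (gauss M (suc m)) (gauss M m) (f (suc m))))
             (∑-⊕ (suc M) (λ m → F (suc m)) H)) ⟩
    gauss M 0 ⊗ f 0 ⊕ (∑ (suc M) (λ m → F (suc m)) ⊕ ∑ (suc M) H)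
      ≡⟨ solve 4 (λ a x b c → a :* x :+ (b :+ c) := a :* (I :* x) :+ b :+ c) refl
           (gauss M 0) (f 0) (∑ (suc M) (λ m → F (suc m))) (∑ (suc M) H) ⟩
    F 0 ⊕ ∑ (suc M) (λ m → F (suc m)) ⊕ ∑ (suc M) H
      ≡⟨ cong (_⊕ ∑ (suc M) H) (∑-head (suc M) F) ⟨
    ∑ (suc M) F ⊕ F (suc M) ⊕ ∑ (suc M) H
      ≡⟨ cong (λ x → ∑ (suc M) F ⊕ ⟨q⟩ M ⊗ x ⊗ g (suc M) ⊗ (q ^ᵍ suc M ⊗ f (suc M)) ⊕ ∑ (suc M) H)
           (g-< (ℕ.n<1+n M)) ⟩
    ∑ (suc M) F ⊕ ⟨q⟩ M ⊗ 𝟘 ⊗ g (suc M) ⊗ (q ^ᵍ suc M ⊗ f (suc M)) ⊕ ∑ (suc M) H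
      ≡⟨ solve 5 (λ a b c d e → a :+ b :* O :* c :* d :+ e := a :+ e) refl
           (∑ (suc M) F) (⟨q⟩ M) (g (suc M)) (q ^ᵍ suc M ⊗ f (suc M)) (∑ (suc M) H) ⟩
    ∑ (suc M) F ⊕ ∑ (suc M) H
      ≡⟨ ∑-⊕ (suc M) F H ⟨
    ∑ (suc M) (λ m → F m ⊕ H m)
      ≡⟨ ∑-cong (suc M) (λ {m} _ → sym (⊗-distribˡ-⊕ (gauss M m) _ _)) ⟩
    ∑ (suc M) (λ m → gauss M m ⊗ (q ^ᵍ m ⊗ f m ⊕ f (suc m))) ∎
    where
    open ≡-Reasoning
    open G
    F H : ℕ → ℚ[i]
    F m = gauss M m ⊗ (q ^ᵍ m ⊗ f m)
    H m = gauss M m ⊗ f (suc m)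

  -- The summand of the terminating ₂φ₁ with parameters q^(i+1) and q^(i+l+2).
  chuTerm : ℕ → ℕ → ℕ → ℚ[i]
  chuTerm i l m = sgn m ⊗ q ^ᵍ (tri m ℕ.+ l ℕ.* m) ⊗ ⟨q⟩ (i ℕ.+ m) ⊗ g (i ℕ.+ suc l ℕ.+ m)

  -- After removal of the common factor the left side is (1 - q^(i+l+m+2)) - q^(l+1) (1 -
  -- q^(i+m+1)), in which everything that depends on m cancels.
  chuTerm-step : ∀ i l m →
    q ^ᵍ m ⊗ chuTerm i l m ⊕ chuTerm i l (suc m) ≡ (𝟙 ⊝ q ^ᵍ suc l) ⊗ chuTerm i (suc l) m
  chuTerm-step i l m = factor
    (^ᵍ-homo-⊗ q (tri m) (l ℕ.* m))
    (trans (cong (q ^ᵍ_) (cong (tri (suc m) ℕ.+_) (ℕ.*-suc l m)))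
      (trans (^ᵍ-homo-⊗ q (tri (suc m)) (l ℕ.+ l ℕ.* m))
        (cong₂ _⊗_ (^ᵍ-homo-⊗ q (suc m) (tri m)) (^ᵍ-homo-⊗ q l (l ℕ.* m)))))
    (trans (^ᵍ-homo-⊗ q (tri m) (m ℕ.+ l ℕ.* m))
      (cong (q ^ᵍ tri m ⊗_) (^ᵍ-homo-⊗ q m (l ℕ.* m))))
    (trans (cong ⟨q⟩ (ℕ.+-suc i m)) (cong (λ x → ⟨q⟩ (i ℕ.+ m) ⊗ (𝟙 ⊝ q ⊗ x)) (^ᵍ-homo-⊗ q i m)))
    (trans (g-step (i ℕ.+ suc l ℕ.+ m))
      (cong (λ x → g (suc (i ℕ.+ suc l ℕ.+ m)) ⊗ (𝟙 ⊝ q ⊗ x))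
        (trans (^ᵍ-homo-⊗ q (i ℕ.+ suc l) m) (cong (_⊗ q ^ᵍ m) (^ᵍ-homo-⊗ q i (suc l))))))
    (cong g (ℕ.+-suc (i ℕ.+ suc l) m))
    (cong (λ n → g (n ℕ.+ m)) (ℕ.+-suc i (suc l)))
    where
    s = sgn m ; T = q ^ᵍ tri m ; X = q ^ᵍ m ; L = q ^ᵍ l ; Y = q ^ᵍ i ; V = q ^ᵍ (l ℕ.* m)
    P = ⟨q⟩ (i ℕ.+ m) ; γ = g (suc (i ℕ.+ suc l ℕ.+ m))
    -- The ring solver treats a power such as q ^ᵍ (i + m) as opaque, so the equations first express
    -- all powers and factorials through nine atoms.
    factor : ∀ {T₁ T₂ T₃ P′ γ₁ γ₂ γ₃} →
      T₁ ≡ T ⊗ V → T₂ ≡ q ⊗ X ⊗ T ⊗ (L ⊗ V) → T₃ ≡ T ⊗ (X ⊗ V) →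
      P′ ≡ P ⊗ (𝟙 ⊝ q ⊗ (Y ⊗ X)) → γ₁ ≡ γ ⊗ (𝟙 ⊝ q ⊗ (Y ⊗ (q ⊗ L) ⊗ X)) → γ₂ ≡ γ → γ₃ ≡ γ →
      X ⊗ (s ⊗ T₁ ⊗ P ⊗ γ₁) ⊕ ⊖ 𝟙 ⊗ s ⊗ T₂ ⊗ P′ ⊗ γ₂ ≡ (𝟙 ⊝ q ⊗ L) ⊗ (s ⊗ T₃ ⊗ P ⊗ γ₃)
    factor refl refl refl refl refl refl refl = solve 9 (λ s q T X L Y V P γ →
      X :* (s :* (T :* V) :* P :* (γ :* (I :- q :* (Y :* (q :* L) :* X))))
      :+ (:- I) :* s :* (q :* X :* T :* (L :* V)) :* (P :* (I :- q :* (Y :* X))) :* γ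
      := (I :- q :* L) :* (s :* (T :* (X :* V)) :* P :* γ)) refl s q T X L Y V P γ
      where open G

  -- The sum for (M+1, l) is 1 - q^(l+1) times the sum for (M, l+1), and this factor turns
  -- 1/(q)_(l+1) into 1/(q)_l. Since `l` grows while `i` stays fixed, the case i = l = j wanted
  -- later is proved with two parameters.
  chu-vandermonde : ∀ M i l → ∑ (suc M) (λ m → gauss M m ⊗ chuTerm i l m) ≡
                    ⟨q⟩ (l ℕ.+ M) ⊗ g l ⊗ ⟨q⟩ i ⊗ g (i ℕ.+ suc l ℕ.+ M)
  chu-vandermonde zero i l = unit (⟨q⟩⊗g 0) (⟨q⟩⊗g l)
    (cong (q ^ᵍ_) (ℕ.*-zeroʳ l)) (cong ⟨q⟩ (ℕ.+-identityʳ l)) (cong ⟨q⟩ (ℕ.+-identityʳ i))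
    where
    γ = g (i ℕ.+ suc l ℕ.+ 0)
    unit : ∀ {a b c d x t y} → 𝟙 ⊗ a ≡ 𝟙 → b ⊗ c ≡ 𝟙 → t ≡ 𝟙 → d ≡ b → y ≡ x →
           𝟘 ⊕ 𝟙 ⊗ a ⊗ a ⊗ (𝟙 ⊗ t ⊗ y ⊗ γ) ≡ d ⊗ c ⊗ x ⊗ γ
    unit {a} {b} {c} {x = x} a≡1 bc≡1 refl refl refl = begin
      𝟘 ⊕ 𝟙 ⊗ a ⊗ a ⊗ (𝟙 ⊗ 𝟙 ⊗ x ⊗ γ)
        ≡⟨ solve 3 (λ a x γ → O :+ I :* a :* a :* (I :* I :* x :* γ)
               := I :* a :* (I :* a) :* (x :* γ)) refl a x γ ⟩
      𝟙 ⊗ a ⊗ (𝟙 ⊗ a) ⊗ (x ⊗ γ)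
        ≡⟨ cong₂ (λ u v → u ⊗ v ⊗ (x ⊗ γ)) a≡1 a≡1 ⟩
      𝟙 ⊗ 𝟙 ⊗ (x ⊗ γ)
        ≡⟨ solve 2 (λ x γ → I :* I :* (x :* γ) := I :* x :* γ) refl x γ ⟩
      𝟙 ⊗ x ⊗ γ
        ≡⟨ cong (λ u → u ⊗ x ⊗ γ) bc≡1 ⟨
      b ⊗ c ⊗ x ⊗ γ ∎
      where
      open ≡-Reasoning
      open G
  chu-vandermonde (suc M) i l = begin
    ∑ (suc (suc M)) (λ m → gauss (suc M) m ⊗ chuTerm i l m)
      ≡⟨ gauss-sum M (chuTerm i l) ⟩
    ∑ (suc M) (λ m → gauss M m ⊗ (q ^ᵍ m ⊗ chuTerm i l m ⊕ chuTerm i l (suc m)))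
      ≡⟨ ∑-cong (suc M) (λ {m} _ → trans (cong (gauss M m ⊗_) (chuTerm-step i l m))
           (solve 3 (λ a b c → a :* (b :* c) := b :* (a :* c)) refl
             (gauss M m) (𝟙 ⊝ q ^ᵍ suc l) (chuTerm i (suc l) m))) ⟩
    ∑ (suc M) (λ m → (𝟙 ⊝ q ^ᵍ suc l) ⊗ (gauss M m ⊗ chuTerm i (suc l) m))
      ≡⟨ ⊗-distribˡ-∑ (𝟙 ⊝ q ^ᵍ suc l) (suc M) (λ m → gauss M m ⊗ chuTerm i (suc l) m) ⟨
    (𝟙 ⊝ q ^ᵍ suc l) ⊗ ∑ (suc M) (λ m → gauss M m ⊗ chuTerm i (suc l) m)
      ≡⟨ cong ((𝟙 ⊝ q ^ᵍ suc l) ⊗_) (chu-vandermonde M i (suc l)) ⟩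
    (𝟙 ⊝ q ^ᵍ suc l) ⊗ (⟨q⟩ (suc l ℕ.+ M) ⊗ g (suc l) ⊗ ⟨q⟩ i ⊗ g (i ℕ.+ suc (suc l) ℕ.+ M))
      ≡⟨ solve 5 (λ a b c d e → a :* (b :* c :* d :* e) := b :* (c :* a) :* d :* e) refl
           (𝟙 ⊝ q ^ᵍ suc l) (⟨q⟩ (suc l ℕ.+ M)) (g (suc l)) (⟨q⟩ i) (g (i ℕ.+ suc (suc l) ℕ.+ M)) ⟩
    ⟨q⟩ (suc l ℕ.+ M) ⊗ (g (suc l) ⊗ (𝟙 ⊝ q ^ᵍ suc l)) ⊗ ⟨q⟩ i ⊗ g (i ℕ.+ suc (suc l) ℕ.+ M)
      ≡⟨ cong (λ x → ⟨q⟩ (suc l ℕ.+ M) ⊗ x ⊗ ⟨q⟩ i ⊗ g (i ℕ.+ suc (suc l) ℕ.+ M)) (g-step l) ⟨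
    ⟨q⟩ (suc l ℕ.+ M) ⊗ g l ⊗ ⟨q⟩ i ⊗ g (i ℕ.+ suc (suc l) ℕ.+ M)
      ≡⟨ cong₂ (λ a b → ⟨q⟩ a ⊗ g l ⊗ ⟨q⟩ i ⊗ g b) (sym (ℕ.+-suc l M))
           (trans (cong (ℕ._+ M) (ℕ.+-suc i (suc l))) (sym (ℕ.+-suc (i ℕ.+ suc l) M))) ⟩
    ⟨q⟩ (l ℕ.+ suc M) ⊗ g l ⊗ ⟨q⟩ i ⊗ g (i ℕ.+ suc l ℕ.+ suc M) ∎
    where
    open ≡-Reasoning
    open G

  q^tri : ℕ → ℚ[i]
  q^tri n = q ^ᵍ tri n

  -- The inner sum of Bailey's lemma. Terms with n < j vanish; for n = j + m the exponent splits as
  -- tri j + tri m + j m, which leaves a Chu-Vandermonde sum of length N - j with i = l = j.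
  bailey-pair-sum : ∀ N j → j ℕ.≤ N →
    ∑ (suc N) (λ n → g- N n ⊗ (sgn n ⊗ q^tri n ⊗ ⟨q⟩ n ⊗ g- n j ⊗ g (n ℕ.+ suc j))) ≡
    sgn j ⊗ q^tri j ⊗ ⟨q⟩ N ⊗ g- N j ⊗ g (N ℕ.+ suc j)
  bailey-pair-sum N j j≤N with ℕ.m≤n⇒∃[o]m+o≡n j≤N
  ... | M , refl = begin
    ∑ (suc (j ℕ.+ M)) F
      ≡⟨ cong (λ n → ∑ n F) (ℕ.+-suc j M) ⟨
    ∑ (j ℕ.+ suc M) F
      ≡⟨ ∑-drop j (suc M) F (λ {n} n<j → vanish {n} (g-< n<j)) ⟩
    ∑ (suc M) (λ m → F (j ℕ.+ m))
      ≡⟨ ∑-cong (suc M) {λ m → F (j ℕ.+ m)} (λ {m} _ → term m) ⟩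
    ∑ (suc M) (λ m → g M ⊗ sgn j ⊗ q^tri j ⊗ (gauss M m ⊗ chuTerm j j m))
      ≡⟨ ⊗-distribˡ-∑ (g M ⊗ sgn j ⊗ q^tri j) (suc M) (λ m → gauss M m ⊗ chuTerm j j m) ⟨
    g M ⊗ sgn j ⊗ q^tri j ⊗ ∑ (suc M) (λ m → gauss M m ⊗ chuTerm j j m)
      ≡⟨ cong (g M ⊗ sgn j ⊗ q^tri j ⊗_) (chu-vandermonde M j j) ⟩
    g M ⊗ sgn j ⊗ q^tri j ⊗ (⟨q⟩ (j ℕ.+ M) ⊗ g j ⊗ ⟨q⟩ j ⊗ g (j ℕ.+ suc j ℕ.+ M))
      ≡⟨ solve 7 (λ a b c d e f h → a :* b :* c :* (d :* e :* f :* h)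
             := f :* e :* (b :* c :* d :* a :* h)) refl
           (g M) (sgn j) (q^tri j) (⟨q⟩ (j ℕ.+ M)) (g j) (⟨q⟩ j) (g (j ℕ.+ suc j ℕ.+ M)) ⟩
    ⟨q⟩ j ⊗ g j ⊗ (sgn j ⊗ q^tri j ⊗ ⟨q⟩ (j ℕ.+ M) ⊗ g M ⊗ g (j ℕ.+ suc j ℕ.+ M))
      ≡⟨ cong (_⊗ (sgn j ⊗ q^tri j ⊗ ⟨q⟩ (j ℕ.+ M) ⊗ g M ⊗ g (j ℕ.+ suc j ℕ.+ M))) (⟨q⟩⊗g j) ⟩
    𝟙 ⊗ (sgn j ⊗ q^tri j ⊗ ⟨q⟩ (j ℕ.+ M) ⊗ g M ⊗ g (j ℕ.+ suc j ℕ.+ M))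
      ≡⟨ ⊗-identityˡ _ ⟩
    sgn j ⊗ q^tri j ⊗ ⟨q⟩ (j ℕ.+ M) ⊗ g M ⊗ g (j ℕ.+ suc j ℕ.+ M)
      ≡⟨ cong₂ (λ x n → sgn j ⊗ q^tri j ⊗ ⟨q⟩ (j ℕ.+ M) ⊗ x ⊗ g n) (g-+ j M) (xyz j M (suc j)) ⟨
    sgn j ⊗ q^tri j ⊗ ⟨q⟩ (j ℕ.+ M) ⊗ g- (j ℕ.+ M) j ⊗ g (j ℕ.+ M ℕ.+ suc j) ∎
    where
    open ≡-Reasoning
    open G
    xyz : ∀ a b c → a ℕ.+ b ℕ.+ c ≡ a ℕ.+ c ℕ.+ b
    xyz a b c = trans (ℕ.+-assoc a b c)
      (trans (cong (a ℕ.+_) (ℕ.+-comm b c)) (sym (ℕ.+-assoc a c b)))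
    F : ℕ → ℚ[i]
    F n = g- (j ℕ.+ M) n ⊗ (sgn n ⊗ q^tri n ⊗ ⟨q⟩ n ⊗ g- n j ⊗ g (n ℕ.+ suc j))
    vanish : ∀ {n} → g- n j ≡ 𝟘 → F n ≡ 𝟘
    vanish {n} eq = trans
      (cong (λ x → g- (j ℕ.+ M) n ⊗ (sgn n ⊗ q^tri n ⊗ ⟨q⟩ n ⊗ x ⊗ g (n ℕ.+ suc j))) eq)
      (solve 3 (λ a b c → a :* (b :* O :* c) := O) refl
        (g- (j ℕ.+ M) n) (sgn n ⊗ q^tri n ⊗ ⟨q⟩ n) (g (n ℕ.+ suc j)))
    -- The factor 1 = (q)_M / (q)_M is inserted: its numerator completes the Gaussian binomial, and
    -- its denominator is constant in m and leaves the sum.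
    regroup : ∀ {a b c d e f gM εj tj εm tm gm P γ PM} →
      a ≡ b → c ≡ εj ⊗ εm → d ≡ tj ⊗ tm → e ≡ gm → f ≡ γ → PM ⊗ gM ≡ 𝟙 →
      a ⊗ (c ⊗ d ⊗ P ⊗ e ⊗ f) ≡ gM ⊗ εj ⊗ tj ⊗ (PM ⊗ b ⊗ gm ⊗ (εm ⊗ tm ⊗ P ⊗ γ))
    regroup {a} {gM = gM} {εj} {tj} {εm} {tm} {gm} {P} {γ} {PM} refl refl refl refl refl PM≡1 =
      trans (sym (⊗-identityˡ _)) (trans
        (cong (_⊗ (a ⊗ (εj ⊗ εm ⊗ (tj ⊗ tm) ⊗ P ⊗ gm ⊗ γ))) (sym PM≡1))
        (solve 10 (λ a gM εj tj εm tm gm P γ PM →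
          PM :* gM :* (a :* (εj :* εm :* (tj :* tm) :* P :* gm :* γ))
          := gM :* εj :* tj :* (PM :* a :* gm :* (εm :* tm :* P :* γ))) refl
          a gM εj tj εm tm gm P γ PM))
    term : ∀ m → F (j ℕ.+ m) ≡ g M ⊗ sgn j ⊗ q^tri j ⊗ (gauss M m ⊗ chuTerm j j m)
    term m = regroup (g-+-+ j M m) (^ᵍ-homo-⊗ (⊖ 𝟙) j m)
      (trans (cong (q ^ᵍ_) (tri-+ j m)) (^ᵍ-homo-⊗ q (tri j) (tri m ℕ.+ j ℕ.* m)))
      (g-+ j m) (cong g (xyz j m (suc j))) (⟨q⟩⊗g M)

  -- The finite Jacobi triple product

  module Theta (z z⁻¹ : ℚ[i]) (z⊗z⁻¹ : z ⊗ z⁻¹ ≡ 𝟙) where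

    -- The powers at the indices j and −1 − j, whose coefficients agree up to sign throughout.
    zpair : ℕ → ℚ[i]
    zpair j = z ^ᵍ j ⊕ z⁻¹ ^ᵍ suc j

    -- The recurrence `zpair-suc` at the edge: the lower neighbour of 0 is -1, which the reflection
    -- sends back to 0.
    zpair-zero : (z ⊕ z⁻¹) ⊗ zpair 0 ≡ zpair 1 ⊕ zpair 0
    zpair-zero = begin
      (z ⊕ z⁻¹) ⊗ (𝟙 ⊕ z⁻¹ ⊗ 𝟙)
        ≡⟨ solve 2 (λ z y → (z :+ y) :* (I :+ y :* I) := z :+ y :+ y :* y :+ z :* y) refl z z⁻¹ ⟩
      z ⊕ z⁻¹ ⊕ z⁻¹ ⊗ z⁻¹ ⊕ z ⊗ z⁻¹
        ≡⟨ cong (z ⊕ z⁻¹ ⊕ z⁻¹ ⊗ z⁻¹ ⊕_) z⊗z⁻¹ ⟩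
      z ⊕ z⁻¹ ⊕ z⁻¹ ⊗ z⁻¹ ⊕ 𝟙
        ≡⟨ solve 2 (λ z y → z :+ y :+ y :* y :+ I
               := z :* I :+ y :* (y :* I) :+ (I :+ y :* I)) refl z z⁻¹ ⟩
      zpair 1 ⊕ zpair 0 ∎
      where
      open ≡-Reasoning
      open G

    zpair-suc : ∀ j → (z ⊕ z⁻¹) ⊗ zpair (suc j) ≡ zpair (suc (suc j)) ⊕ zpair j
    zpair-suc j = begin
      (z ⊕ z⁻¹) ⊗ (z ⊗ a ⊕ z⁻¹ ⊗ (z⁻¹ ⊗ b))
        ≡⟨ solve 4 (λ z y a b → (z :+ y) :* (z :* a :+ y :* (y :* b))
               := z :* (z :* a) :+ y :* (y :* (y :* b)) :+ z :* y :* (a :+ y :* b)) refl z z⁻¹ a b ⟩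
      z ⊗ (z ⊗ a) ⊕ z⁻¹ ⊗ (z⁻¹ ⊗ (z⁻¹ ⊗ b)) ⊕ z ⊗ z⁻¹ ⊗ zpair j
        ≡⟨ cong (zpair (suc (suc j)) ⊕_) (trans (cong (_⊗ zpair j) z⊗z⁻¹) (⊗-identityˡ (zpair j))) ⟩
      zpair (suc (suc j)) ⊕ zpair j ∎
      where
      open ≡-Reasoning
      open G
      a = z ^ᵍ j
      b = z⁻¹ ^ᵍ j

    -- The coefficient at index j - 1, under the reflection j ↦ -1 - j that fixes zpair.
    pred : (ℕ → ℚ[i]) → ℕ → ℚ[i]
    pred c zero    = c 0
    pred c (suc j) = c j

    -- Multiplication by z + 1/z shifts `zpair` both ways; transferring the shifts to `c` costs the
    -- boundary terms at the upper end.
    ∑-by-parts : ∀ (c : ℕ → ℚ[i]) K →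
      ∑ (suc K) (λ j → (pred c j ⊕ c (suc j)) ⊗ zpair j) ≡
      (z ⊕ z⁻¹) ⊗ ∑ (suc K) (λ j → c j ⊗ zpair j)
        ⊕ (c (suc K) ⊗ zpair K ⊝ c K ⊗ zpair (suc K))
    ∑-by-parts c zero = begin
      𝟘 ⊕ (c 0 ⊕ c 1) ⊗ zpair 0
        ≡⟨ solve 4 (λ a b x y → O :+ (a :+ b) :* x
               := a :* (y :+ x) :+ (b :* x :- a :* y)) refl (c 0) (c 1) (zpair 0) (zpair 1) ⟩
      c 0 ⊗ (zpair 1 ⊕ zpair 0) ⊕ (c 1 ⊗ zpair 0 ⊝ c 0 ⊗ zpair 1)
        ≡⟨ cong (λ u → c 0 ⊗ u ⊕ (c 1 ⊗ zpair 0 ⊝ c 0 ⊗ zpair 1)) zpair-zero ⟨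
      c 0 ⊗ ((z ⊕ z⁻¹) ⊗ zpair 0) ⊕ (c 1 ⊗ zpair 0 ⊝ c 0 ⊗ zpair 1)
        ≡⟨ cong (_⊕ (c 1 ⊗ zpair 0 ⊝ c 0 ⊗ zpair 1))
             (solve 3 (λ a w x → a :* (w :* x) := w :* (O :+ a :* x)) refl (c 0) (z ⊕ z⁻¹) (zpair 0)) ⟩
      (z ⊕ z⁻¹) ⊗ (𝟘 ⊕ c 0 ⊗ zpair 0) ⊕ (c 1 ⊗ zpair 0 ⊝ c 0 ⊗ zpair 1) ∎
      where
      open ≡-Reasoning
      open G
    ∑-by-parts c (suc K) = begin
      ∑ (suc K) (λ j → (pred c j ⊕ c (suc j)) ⊗ zpair j) ⊕ (a ⊕ d) ⊗ y
        ≡⟨ cong (_⊕ (a ⊕ d) ⊗ y) (∑-by-parts c K) ⟩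
      w ⊗ S ⊕ (b ⊗ x ⊝ a ⊗ y) ⊕ (a ⊕ d) ⊗ y
        ≡⟨ solve 8 (λ w S a b d x y u → w :* S :+ (b :* x :- a :* y) :+ (a :+ d) :* y
               := w :* S :+ b :* (u :+ x) :+ (d :* y :- b :* u)) refl w S a b d x y u ⟩
      w ⊗ S ⊕ b ⊗ (u ⊕ x) ⊕ (d ⊗ y ⊝ b ⊗ u)
        ≡⟨ cong (λ v → w ⊗ S ⊕ b ⊗ v ⊕ (d ⊗ y ⊝ b ⊗ u)) (zpair-suc K) ⟨
      w ⊗ S ⊕ b ⊗ (w ⊗ y) ⊕ (d ⊗ y ⊝ b ⊗ u)
        ≡⟨ cong (_⊕ (d ⊗ y ⊝ b ⊗ u))
             (solve 4 (λ w S b y → w :* S :+ b :* (w :* y) := w :* (S :+ b :* y)) refl w S b y) ⟩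
      w ⊗ (S ⊕ b ⊗ y) ⊕ (d ⊗ y ⊝ b ⊗ u) ∎
      where
      open ≡-Reasoning
      open G
      w = z ⊕ z⁻¹
      S = ∑ (suc K) (λ j → c j ⊗ zpair j)
      a = c K ; b = c (suc K) ; d = c (suc (suc K))
      x = zpair K ; y = zpair (suc K) ; u = zpair (suc (suc K))

    theta : ℕ → ℚ[i]
    theta n = pochᵍ (⊖ z⁻¹) q (suc n) ⊗ pochᵍ (⊖ (z ⊗ q)) q n

    -- This is q^(j(j+1)/2) times the Gaussian binomial of 2n+1 over n-j.
    thetaCoeff : ℕ → ℕ → ℚ[i]
    thetaCoeff n j = q^tri j ⊗ ⟨q⟩ (suc (n ℕ.+ n)) ⊗ g- n j ⊗ g (n ℕ.+ suc j)

    thetaCoeff-< : ∀ {n j} → n ℕ.< j → thetaCoeff n j ≡ 𝟘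
    thetaCoeff-< {n} {j} n<j = trans
      (cong (λ x → q^tri j ⊗ ⟨q⟩ (suc (n ℕ.+ n)) ⊗ x ⊗ g (n ℕ.+ suc j)) (g-< n<j))
      (solve 2 (λ a b → a :* O :* b := O) refl (q^tri j ⊗ ⟨q⟩ (suc (n ℕ.+ n))) (g (n ℕ.+ suc j)))
      where open G

    -- The two new factors are 1 + q^(n+1)/z and 1 + z q^(n+1). Their product involves z only
    -- through z + 1/z, which acts on sums over `zpair`.
    theta-suc : ∀ n → theta (suc n) ≡
      theta n ⊗ (𝟙 ⊕ q ^ᵍ suc n ⊗ q ^ᵍ suc n ⊕ q ^ᵍ suc n ⊗ (z ⊕ z⁻¹))
    theta-suc n = begin
      A ⊗ (𝟙 ⊝ ⊖ z⁻¹ ⊗ (q ⊗ X)) ⊗ (B ⊗ (𝟙 ⊝ ⊖ (z ⊗ q) ⊗ X))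
        ≡⟨ solve 6 (λ A B q X z y →
             A :* (I :- (:- y) :* (q :* X)) :* (B :* (I :- (:- (z :* q)) :* X))
             := A :* B :* (I :+ z :* y :* ((q :* X) :* (q :* X)) :+ (q :* X) :* (z :+ y))) refl
             A B q X z z⁻¹ ⟩
      A ⊗ B ⊗ (𝟙 ⊕ z ⊗ z⁻¹ ⊗ (q ⊗ X ⊗ (q ⊗ X)) ⊕ q ⊗ X ⊗ (z ⊕ z⁻¹))
        ≡⟨ cong (λ u → A ⊗ B ⊗ (𝟙 ⊕ u ⊕ q ⊗ X ⊗ (z ⊕ z⁻¹)))
             (trans (cong (_⊗ (q ⊗ X ⊗ (q ⊗ X))) z⊗z⁻¹) (⊗-identityˡ _)) ⟩
      A ⊗ B ⊗ (𝟙 ⊕ q ⊗ X ⊗ (q ⊗ X) ⊕ q ⊗ X ⊗ (z ⊕ z⁻¹)) ∎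
      where
      open ≡-Reasoning
      open G
      A = pochᵍ (⊖ z⁻¹) q (suc n)
      B = pochᵍ (⊖ (z ⊗ q)) q n
      X = q ^ᵍ n

    -- Two steps of Pascal's rule, from 2n+1 to 2n+3. All coefficients are written over the
    -- denominators of the left side, which reduces the claim to a polynomial identity.
    thetaCoeff-suc : ∀ n j → thetaCoeff (suc n) j ≡
      (𝟙 ⊕ q ^ᵍ suc n ⊗ q ^ᵍ suc n) ⊗ thetaCoeff n j
        ⊕ q ^ᵍ suc n ⊗ (pred (thetaCoeff n) j ⊕ thetaCoeff n (suc j))
    thetaCoeff-suc n zero = expand
      (cong (λ m → ⟨q⟩ (suc (suc m))) (ℕ.+-suc n n))
      (trans (^ᵍ-homo-⊗ q n n) refl)
      (g-step n) (g--step 0 n) (cong g (ℕ.+-comm (suc n) 1))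
      (trans (cong g (ℕ.+-comm n 1)) (g-step (suc n))) (cong g (ℕ.+-comm n 2))
      where
      P = ⟨q⟩ (suc (n ℕ.+ n)) ; X = q ^ᵍ n ; γ = g (suc n) ; h = g (suc (suc n))
      expand : ∀ {P′ X² γ₀ γ₁ h₀ h₁ h₂} →
        P′ ≡ P ⊗ (𝟙 ⊝ q ⊗ (q ⊗ X²)) ⊗ (𝟙 ⊝ q ⊗ (q ⊗ (q ⊗ X²))) → X² ≡ X ⊗ X →
        γ₀ ≡ γ ⊗ (𝟙 ⊝ q ⊗ X) → γ₁ ≡ γ₀ ⊗ (𝟙 ⊝ X) → h₀ ≡ h → h₁ ≡ h ⊗ (𝟙 ⊝ q ⊗ (q ⊗ X)) → h₂ ≡ h →
        𝟙 ⊗ P′ ⊗ γ ⊗ h₀ ≡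
        (𝟙 ⊕ q ⊗ X ⊗ (q ⊗ X)) ⊗ (𝟙 ⊗ P ⊗ γ₀ ⊗ h₁)
          ⊕ q ⊗ X ⊗ (𝟙 ⊗ P ⊗ γ₀ ⊗ h₁ ⊕ q ⊗ 𝟙 ⊗ P ⊗ γ₁ ⊗ h₂)
      expand refl refl refl refl refl refl refl = solve 5 (λ q X P γ h →
        I :* (P :* (I :- q :* (q :* (X :* X))) :* (I :- q :* (q :* (q :* (X :* X))))) :* γ :* h
        := (I :+ q :* X :* (q :* X)) :* (I :* P :* (γ :* (I :- q :* X)) :* (h :* (I :- q :* (q :* X))))
          :+ q :* X :* (I :* P :* (γ :* (I :- q :* X)) :* (h :* (I :- q :* (q :* X)))
            :+ q :* I :* P :* (γ :* (I :- q :* X) :* (I :- X)) :* h)) refl q X P γ h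
        where open G
    thetaCoeff-suc n (suc i) with i ℕ.≤? n
    ... | no i≰n = begin
      thetaCoeff (suc n) (suc i)
        ≡⟨ thetaCoeff-< (ℕ.s<s n<i) ⟩
      𝟘
        ≡⟨ solve 2 (λ a b → O := a :* O :+ b :* (O :+ O)) refl
             (𝟙 ⊕ q ^ᵍ suc n ⊗ q ^ᵍ suc n) (q ^ᵍ suc n) ⟩
      (𝟙 ⊕ q ^ᵍ suc n ⊗ q ^ᵍ suc n) ⊗ 𝟘 ⊕ q ^ᵍ suc n ⊗ (𝟘 ⊕ 𝟘)
        ≡⟨ cong₂ (λ a b → (𝟙 ⊕ q ^ᵍ suc n ⊗ q ^ᵍ suc n) ⊗ a ⊕ q ^ᵍ suc n ⊗ b)
             (thetaCoeff-< (ℕ.m<n⇒m<1+n n<i))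
             (cong₂ _⊕_ (thetaCoeff-< n<i) (thetaCoeff-< (ℕ.m<n⇒m<1+n (ℕ.m<n⇒m<1+n n<i)))) ⟨
      (𝟙 ⊕ q ^ᵍ suc n ⊗ q ^ᵍ suc n) ⊗ thetaCoeff n (suc i)
        ⊕ q ^ᵍ suc n ⊗ (thetaCoeff n i ⊕ thetaCoeff n (suc (suc i))) ∎
      where
      open ≡-Reasoning
      open G
      n<i = ℕ.≰⇒> i≰n
    -- Here e = n - i. For e = 0 and e = 1 some coefficients on the right vanish; the zeros of the
    -- factors in `g--step` and `g--step₂` account for this.
    ... | yes i≤n with ℕ.m≤n⇒∃[o]m+o≡n i≤n
    ... | e , refl = expand
      (^ᵍ-homo-⊗ q (suc i) (tri i)) (^ᵍ-homo-⊗ q (suc (suc i)) (tri (suc i)))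
      (cong (λ m → ⟨q⟩ (suc (suc m))) (ℕ.+-suc n n)) (^ᵍ-homo-⊗ q n n) (^ᵍ-homo-⊗ q i e)
      (g-+ i e) (g--step i e) (g--step₂ i e)
      (trans (cong g (ℕ.+-suc n (suc i)))
        (trans (g-step (suc (n ℕ.+ suc i)))
          (cong₂ (λ m x → g m ⊗ (𝟙 ⊝ q ⊗ (q ⊗ x)))
            (cong suc (sym (ℕ.+-suc n (suc i)))) (^ᵍ-homo-⊗ q n (suc i)))))
      (trans (g-step (n ℕ.+ suc i))
        (cong₂ (λ m x → g m ⊗ (𝟙 ⊝ q ⊗ x)) (sym (ℕ.+-suc n (suc i))) (^ᵍ-homo-⊗ q n (suc i))))
      (cong g (ℕ.+-suc n (suc (suc i))))
      where
      T = q^tri i ; Y = q ^ᵍ i ; E = q ^ᵍ e ; P = ⟨q⟩ (suc (n ℕ.+ n)) ; γ = g e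
      h = g (suc (n ℕ.+ suc (suc i)))
      expand : ∀ {v₁ v₂ P′ X² X γ₀ γ₁ γ₂ h₀ h₁ h₂} →
        v₁ ≡ q ⊗ Y ⊗ T → v₂ ≡ q ⊗ (q ⊗ Y) ⊗ v₁ →
        P′ ≡ P ⊗ (𝟙 ⊝ q ⊗ (q ⊗ X²)) ⊗ (𝟙 ⊝ q ⊗ (q ⊗ (q ⊗ X²))) → X² ≡ X ⊗ X → X ≡ Y ⊗ E →
        γ₀ ≡ γ → γ₁ ≡ γ ⊗ (𝟙 ⊝ E) → q ⊗ γ₂ ≡ γ ⊗ (𝟙 ⊝ E) ⊗ (q ⊝ E) →
        h₁ ≡ h ⊗ (𝟙 ⊝ q ⊗ (q ⊗ (X ⊗ (q ⊗ Y)))) → h₀ ≡ h₁ ⊗ (𝟙 ⊝ q ⊗ (X ⊗ (q ⊗ Y))) → h₂ ≡ h →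
        v₁ ⊗ P′ ⊗ γ₀ ⊗ h ≡
        (𝟙 ⊕ q ⊗ X ⊗ (q ⊗ X)) ⊗ (v₁ ⊗ P ⊗ γ₁ ⊗ h₁)
          ⊕ q ⊗ X ⊗ (T ⊗ P ⊗ γ₀ ⊗ h₀ ⊕ v₂ ⊗ P ⊗ γ₂ ⊗ h₂)
      expand {γ₂ = γ₂} refl refl refl refl refl refl refl qγ₂ refl refl refl = begin
        q ⊗ Y ⊗ T ⊗ (P ⊗ (𝟙 ⊝ q ⊗ (q ⊗ (X ⊗ X))) ⊗ (𝟙 ⊝ q ⊗ (q ⊗ (q ⊗ (X ⊗ X))))) ⊗ γ ⊗ h
          ≡⟨ solve 7 (λ q Y E T P γ h → let X = Y :* E ; h₁ = h :* (I :- q :* (q :* (X :* (q :* Y)))) in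
               q :* Y :* T :* (P :* (I :- q :* (q :* (X :* X))) :* (I :- q :* (q :* (q :* (X :* X))))) :* γ :* h
               := (I :+ q :* X :* (q :* X)) :* (q :* Y :* T :* P :* (γ :* (I :- E)) :* h₁)
                 :+ q :* X :* (T :* P :* γ :* (h₁ :* (I :- q :* (X :* (q :* Y))))
                   :+ q :* Y :* (q :* Y :* T) :* P :* (γ :* (I :- E) :* (q :- E)) :* h))
               refl q Y E T P γ h ⟩
        (𝟙 ⊕ q ⊗ X ⊗ (q ⊗ X)) ⊗ (q ⊗ Y ⊗ T ⊗ P ⊗ (γ ⊗ (𝟙 ⊝ E)) ⊗ h₁)
          ⊕ q ⊗ X ⊗ (T ⊗ P ⊗ γ ⊗ h₀ ⊕ q ⊗ Y ⊗ (q ⊗ Y ⊗ T) ⊗ P ⊗ (γ ⊗ (𝟙 ⊝ E) ⊗ (q ⊝ E)) ⊗ h)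
          -- Only q γ₂ is known, from `g--step₂`. The spare q is taken from the power q^tri(i+2).
          ≡⟨ cong (λ u → (𝟙 ⊕ q ⊗ X ⊗ (q ⊗ X)) ⊗ (q ⊗ Y ⊗ T ⊗ P ⊗ (γ ⊗ (𝟙 ⊝ E)) ⊗ h₁)
               ⊕ q ⊗ X ⊗ (T ⊗ P ⊗ γ ⊗ h₀ ⊕ u))
               (trans (cong (λ u → q ⊗ Y ⊗ (q ⊗ Y ⊗ T) ⊗ P ⊗ u ⊗ h) (sym qγ₂))
                 (solve 6 (λ q Y T P γ h → q :* Y :* (q :* Y :* T) :* P :* (q :* γ) :* h
                   := q :* (q :* Y) :* (q :* Y :* T) :* P :* γ :* h) refl q Y T P γ₂ h)) ⟩
        (𝟙 ⊕ q ⊗ X ⊗ (q ⊗ X)) ⊗ (q ⊗ Y ⊗ T ⊗ P ⊗ (γ ⊗ (𝟙 ⊝ E)) ⊗ h₁)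
          ⊕ q ⊗ X ⊗ (T ⊗ P ⊗ γ ⊗ h₀ ⊕ q ⊗ (q ⊗ Y) ⊗ (q ⊗ Y ⊗ T) ⊗ P ⊗ γ₂ ⊗ h) ∎
        where
        open ≡-Reasoning
        open G
        X = Y ⊗ E
        h₁ = h ⊗ (𝟙 ⊝ q ⊗ (q ⊗ (X ⊗ (q ⊗ Y))))
        h₀ = h₁ ⊗ (𝟙 ⊝ q ⊗ (X ⊗ (q ⊗ Y)))

    -- Any length K > n is allowed, so that all rows of `finite-identity` run over one range and can
    -- be interchanged with the columns. In the induction step the boundary terms of `∑-by-parts`
    -- carry coefficients beyond n, which are 0.
    theta-expansion : ∀ n K → n ℕ.< K → theta n ≡ ∑ K (λ j → thetaCoeff n j ⊗ zpair j)
    theta-expansion zero (suc K) _ = sym (begin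
      ∑ (suc K) (λ j → thetaCoeff 0 j ⊗ zpair j)
        ≡⟨ ∑-head K (λ j → thetaCoeff 0 j ⊗ zpair j) ⟩
      thetaCoeff 0 0 ⊗ zpair 0 ⊕ ∑ K (λ j → thetaCoeff 0 (suc j) ⊗ zpair (suc j))
        ≡⟨ cong (thetaCoeff 0 0 ⊗ zpair 0 ⊕_) (∑-zero K λ {j} _ →
             trans (cong (_⊗ zpair (suc j)) (thetaCoeff-< {0} {suc j} ℕ.z<s)) (⊗-zeroˡ (zpair (suc j)))) ⟩
      𝟙 ⊗ ⟨q⟩ 1 ⊗ g 0 ⊗ g 1 ⊗ zpair 0 ⊕ 𝟘
        ≡⟨ solve 4 (λ P a b x → I :* P :* a :* b :* x :+ O := P :* b :* (I :* a) :* x) refl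
             (⟨q⟩ 1) (g 0) (g 1) (zpair 0) ⟩
      ⟨q⟩ 1 ⊗ g 1 ⊗ (⟨q⟩ 0 ⊗ g 0) ⊗ zpair 0
        ≡⟨ cong₂ (λ a b → a ⊗ b ⊗ zpair 0) (⟨q⟩⊗g 1) (⟨q⟩⊗g 0) ⟩
      𝟙 ⊗ 𝟙 ⊗ (𝟙 ⊕ z⁻¹ ⊗ 𝟙)
        ≡⟨ solve 1 (λ y → I :* I :* (I :+ y :* I) := I :* (I :- (:- y) :* I) :* I) refl z⁻¹ ⟩
      𝟙 ⊗ (𝟙 ⊝ ⊖ z⁻¹ ⊗ 𝟙) ⊗ 𝟙 ∎)
      where
      open ≡-Reasoning
      open G
    theta-expansion (suc n) (suc zero) (ℕ.s≤s ())
    theta-expansion (suc n) (suc (suc K)) 1+n<2+K = begin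
      theta (suc n)
        ≡⟨ theta-suc n ⟩
      theta n ⊗ (𝟙 ⊕ u ⊗ u ⊕ u ⊗ w)
        ≡⟨ cong (_⊗ (𝟙 ⊕ u ⊗ u ⊕ u ⊗ w)) (theta-expansion n (suc (suc K)) (ℕ.m<n⇒m<1+n n<1+K)) ⟩
      S ⊗ (𝟙 ⊕ u ⊗ u ⊕ u ⊗ w)
        ≡⟨ solve 5 (λ S u w x y → S :* (I :+ u :* u :+ u :* w)
               := (I :+ u :* u) :* S :+ u :* (w :* S :+ (O :* x :- O :* y))) refl
             S u w (zpair (suc K)) (zpair (suc (suc K))) ⟩
      (𝟙 ⊕ u ⊗ u) ⊗ S ⊕ u ⊗ (w ⊗ S ⊕ (𝟘 ⊗ zpair (suc K) ⊝ 𝟘 ⊗ zpair (suc (suc K))))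
        ≡⟨ cong₂ (λ a b → (𝟙 ⊕ u ⊗ u) ⊗ S ⊕ u ⊗ (w ⊗ S ⊕ (a ⊗ zpair (suc K) ⊝ b ⊗ zpair (suc (suc K)))))
             (thetaCoeff-< (ℕ.m<n⇒m<1+n n<1+K)) (thetaCoeff-< n<1+K) ⟨
      (𝟙 ⊕ u ⊗ u) ⊗ S ⊕ u ⊗ (w ⊗ S ⊕ (c (suc (suc K)) ⊗ zpair (suc K) ⊝ c (suc K) ⊗ zpair (suc (suc K))))
        ≡⟨ cong (λ v → (𝟙 ⊕ u ⊗ u) ⊗ S ⊕ u ⊗ v) (∑-by-parts c (suc K)) ⟨
      (𝟙 ⊕ u ⊗ u) ⊗ S ⊕ u ⊗ ∑ (suc (suc K)) D
        ≡⟨ cong₂ _⊕_ (⊗-distribˡ-∑ (𝟙 ⊕ u ⊗ u) (suc (suc K)) (λ j → c j ⊗ zpair j))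
             (⊗-distribˡ-∑ u (suc (suc K)) D) ⟩
      ∑ (suc (suc K)) (λ j → (𝟙 ⊕ u ⊗ u) ⊗ (c j ⊗ zpair j)) ⊕ ∑ (suc (suc K)) (λ j → u ⊗ D j)
        ≡⟨ ∑-⊕ (suc (suc K)) (λ j → (𝟙 ⊕ u ⊗ u) ⊗ (c j ⊗ zpair j)) (λ j → u ⊗ D j) ⟨
      ∑ (suc (suc K)) (λ j → (𝟙 ⊕ u ⊗ u) ⊗ (c j ⊗ zpair j) ⊕ u ⊗ D j)
        ≡⟨ ∑-cong (suc (suc K)) (λ {j} _ → trans
             (solve 5 (λ a c x u d → a :* (c :* x) :+ u :* (d :* x) := (a :* c :+ u :* d) :* x) refl
               (𝟙 ⊕ u ⊗ u) (c j) (zpair j) u (pred c j ⊕ c (suc j)))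
             (cong (_⊗ zpair j) (sym (thetaCoeff-suc n j)))) ⟩
      ∑ (suc (suc K)) (λ j → thetaCoeff (suc n) j ⊗ zpair j) ∎
      where
      open ≡-Reasoning
      open G
      n<1+K = ℕ.s<s⁻¹ 1+n<2+K
      u = q ^ᵍ suc n
      w = z ⊕ z⁻¹
      c = thetaCoeff n
      S = ∑ (suc (suc K)) (λ j → c j ⊗ zpair j)
      D : ℕ → ℚ[i]
      D j = (pred c j ⊕ c (suc j)) ⊗ zpair j

    -- The identity for each N

    lhsTerm : ℕ → ℚ[i]
    lhsTerm n = sgn n
      ⊗ (pochᵍ (⊖ z⁻¹) q (suc n) ⊗ (pochᵍ (⊖ (z ⊗ q)) q n ⊗ ⟨q⟩ n) ⊗ g (suc (n ℕ.+ n)))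
      ⊗ q^tri n

    rhsTerm : ℕ → ℚ[i]
    rhsTerm j = sgn j ⊗ (q^tri j ⊗ q^tri j) ⊗ zpair j

    finite-identity : ∀ N →
      ∑ (suc N) (λ n → ⟨q⟩ N ⊗ g- N n ⊗ lhsTerm n) ≡
      ∑ (suc N) (λ j → ⟨q⟩ N ⊗ g- N j ⊗ (⟨q⟩ N ⊗ g (N ℕ.+ suc j)) ⊗ rhsTerm j)
    finite-identity N = begin
      ∑ (suc N) (λ n → ⟨q⟩ N ⊗ g- N n ⊗ lhsTerm n)
        ≡⟨ ∑-cong (suc N) (λ {n} n<1+N → row n n<1+N) ⟩
      ∑ (suc N) (λ n → ∑ (suc N) (λ j → ⟨q⟩ N ⊗ q^tri j ⊗ zpair j ⊗ B j n))
        ≡⟨ ∑-swap (suc N) (suc N) (λ n j → ⟨q⟩ N ⊗ q^tri j ⊗ zpair j ⊗ B j n) ⟩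
      ∑ (suc N) (λ j → ∑ (suc N) (λ n → ⟨q⟩ N ⊗ q^tri j ⊗ zpair j ⊗ B j n))
        ≡⟨ ∑-cong (suc N) (λ {j} j<1+N → column j j<1+N) ⟩
      ∑ (suc N) (λ j → ⟨q⟩ N ⊗ g- N j ⊗ (⟨q⟩ N ⊗ g (N ℕ.+ suc j)) ⊗ rhsTerm j) ∎
      where
      open ≡-Reasoning
      open G
      B : ℕ → ℕ → ℚ[i]
      B j n = g- N n ⊗ (sgn n ⊗ q^tri n ⊗ ⟨q⟩ n ⊗ g- n j ⊗ g (n ℕ.+ suc j))
      row : ∀ n → n ℕ.< suc N →
        ⟨q⟩ N ⊗ g- N n ⊗ lhsTerm n ≡ ∑ (suc N) (λ j → ⟨q⟩ N ⊗ q^tri j ⊗ zpair j ⊗ B j n)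
      row n n<1+N = begin
        ⟨q⟩ N ⊗ g- N n ⊗ lhsTerm n
          ≡⟨ solve 8 (λ PN gn s a b P g₂ t → PN :* gn :* (s :* (a :* (b :* P) :* g₂) :* t)
                 := PN :* gn :* s :* P :* g₂ :* t :* (a :* b)) refl
               (⟨q⟩ N) (g- N n) (sgn n) (pochᵍ (⊖ z⁻¹) q (suc n)) (pochᵍ (⊖ (z ⊗ q)) q n) (⟨q⟩ n)
               (g (suc (n ℕ.+ n))) (q^tri n) ⟩
        k ⊗ theta n
          ≡⟨ cong (k ⊗_) (theta-expansion n (suc N) n<1+N) ⟩
        k ⊗ ∑ (suc N) (λ j → thetaCoeff n j ⊗ zpair j)
          ≡⟨ ⊗-distribˡ-∑ k (suc N) (λ j → thetaCoeff n j ⊗ zpair j) ⟩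
        ∑ (suc N) (λ j → k ⊗ (thetaCoeff n j ⊗ zpair j))
          ≡⟨ ∑-cong (suc N) (λ {j} _ → entry j) ⟩
        ∑ (suc N) (λ j → ⟨q⟩ N ⊗ q^tri j ⊗ zpair j ⊗ B j n) ∎
        where
        k = ⟨q⟩ N ⊗ g- N n ⊗ sgn n ⊗ ⟨q⟩ n ⊗ g (suc (n ℕ.+ n)) ⊗ q^tri n
        entry : ∀ j → k ⊗ (thetaCoeff n j ⊗ zpair j) ≡ ⟨q⟩ N ⊗ q^tri j ⊗ zpair j ⊗ B j n
        entry j = begin
          k ⊗ (thetaCoeff n j ⊗ zpair j)
            ≡⟨ solve 11 (λ PN gn s P g₂ t tj P₂ γ h x →
                 PN :* gn :* s :* P :* g₂ :* t :* (tj :* P₂ :* γ :* h :* x)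
                 := P₂ :* g₂ :* (PN :* tj :* x :* (gn :* (s :* t :* P :* γ :* h)))) refl
                 (⟨q⟩ N) (g- N n) (sgn n) (⟨q⟩ n) (g (suc (n ℕ.+ n))) (q^tri n) (q^tri j)
                 (⟨q⟩ (suc (n ℕ.+ n))) (g- n j) (g (n ℕ.+ suc j)) (zpair j) ⟩
          ⟨q⟩ (suc (n ℕ.+ n)) ⊗ g (suc (n ℕ.+ n)) ⊗ (⟨q⟩ N ⊗ q^tri j ⊗ zpair j ⊗ B j n)
            ≡⟨ trans (cong (_⊗ (⟨q⟩ N ⊗ q^tri j ⊗ zpair j ⊗ B j n)) (⟨q⟩⊗g (suc (n ℕ.+ n))))
                 (⊗-identityˡ _) ⟩
          ⟨q⟩ N ⊗ q^tri j ⊗ zpair j ⊗ B j n ∎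
      column : ∀ j → j ℕ.< suc N →
        ∑ (suc N) (λ n → ⟨q⟩ N ⊗ q^tri j ⊗ zpair j ⊗ B j n) ≡
        ⟨q⟩ N ⊗ g- N j ⊗ (⟨q⟩ N ⊗ g (N ℕ.+ suc j)) ⊗ rhsTerm j
      column j j<1+N = begin
        ∑ (suc N) (λ n → ⟨q⟩ N ⊗ q^tri j ⊗ zpair j ⊗ B j n)
          ≡⟨ ⊗-distribˡ-∑ (⟨q⟩ N ⊗ q^tri j ⊗ zpair j) (suc N) (B j) ⟨
        ⟨q⟩ N ⊗ q^tri j ⊗ zpair j ⊗ ∑ (suc N) (B j)
          ≡⟨ cong (⟨q⟩ N ⊗ q^tri j ⊗ zpair j ⊗_) (bailey-pair-sum N j (ℕ.s≤s⁻¹ j<1+N)) ⟩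
        ⟨q⟩ N ⊗ q^tri j ⊗ zpair j ⊗ (sgn j ⊗ q^tri j ⊗ ⟨q⟩ N ⊗ g- N j ⊗ g (N ℕ.+ suc j))
          ≡⟨ solve 6 (λ PN t x s γ h → PN :* t :* x :* (s :* t :* PN :* γ :* h)
                 := PN :* γ :* (PN :* h) :* (s :* (t :* t) :* x)) refl
               (⟨q⟩ N) (q^tri j) (zpair j) (sgn j) (g- N j) (g (N ℕ.+ suc j)) ⟩
        ⟨q⟩ N ⊗ g- N j ⊗ (⟨q⟩ N ⊗ g (N ℕ.+ suc j)) ⊗ rhsTerm j ∎

-- Powers of rationals

open Exp (CommutativeRing.commutativeSemiring ℚ.+-*-commutativeRing) using () renaming
  (_^_ to _^ℚ_; ^-homo-* to ^ℚ-homo-*; ^-distrib-* to ^ℚ-distrib-*; ^-assocʳ to ^ℚ-assocʳ)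

module Q = ℚSolver.+-*-Solver

0≤1 : 0ℚ ℚ.≤ 1ℚ
0≤1 = ℚ.<⇒≤ 0<1

p≤p+q : ∀ {p q} → 0ℚ ℚ.≤ q → p ℚ.≤ p ℚ.+ q
p≤p+q {p} {q} 0≤q = subst (ℚ._≤ p ℚ.+ q) (ℚ.+-identityʳ p) (ℚ.+-monoʳ-≤ p 0≤q)

q≤p+q : ∀ {p q} → 0ℚ ℚ.≤ p → q ℚ.≤ p ℚ.+ q
q≤p+q {p} {q} 0≤p = subst (ℚ._≤ p ℚ.+ q) (ℚ.+-identityˡ q) (ℚ.+-monoˡ-≤ q 0≤p)

p*q≤p : ∀ {p q} → 0ℚ ℚ.≤ p → q ℚ.≤ 1ℚ → p ℚ.* q ℚ.≤ p
p*q≤p {p} {q} 0≤p q≤1 = subst (p ℚ.* q ℚ.≤_) (ℚ.*-identityʳ p)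
  (ℚ.*-monoˡ-≤-nonNeg p {{ℚ.nonNegative 0≤p}} q≤1)

p<1⇒0<1-p : ∀ {p} → p ℚ.< 1ℚ → 0ℚ ℚ.< 1ℚ ℚ.- p
p<1⇒0<1-p {p} p<1 = subst (ℚ._< 1ℚ ℚ.- p) (ℚ.+-inverseʳ p) (ℚ.+-monoˡ-< (ℚ.- p) p<1)

square-cancel-≤ : ∀ {x y} → 0ℚ ℚ.≤ y → x ℚ.* x ℚ.≤ y ℚ.* y → x ℚ.≤ y
square-cancel-≤ {x} {y} 0≤y x²≤y² = ℚ.≮⇒≥ λ y<x → ℚ.<-irrefl refl (ℚ.<-≤-trans
  (ℚ.≤-<-trans
    (ℚ.*-monoˡ-≤-nonNeg y {{ℚ.nonNegative 0≤y}} (ℚ.<⇒≤ y<x))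
    (ℚ.*-monoˡ-<-pos x {{ℚ.positive (ℚ.≤-<-trans 0≤y y<x)}} y<x))
  x²≤y²)

^-nonneg : ∀ {r} → 0ℚ ℚ.≤ r → ∀ n → 0ℚ ℚ.≤ r ^ℚ n
^-nonneg 0≤r zero    = 0≤1
^-nonneg 0≤r (suc n) = *-nonneg 0≤r (^-nonneg 0≤r n)

^-≤1ℚ : ∀ {r} → 0ℚ ℚ.≤ r → r ℚ.≤ 1ℚ → ∀ n → r ^ℚ n ℚ.≤ 1ℚ
^-≤1ℚ 0≤r r≤1 zero    = ℚ.≤-refl
^-≤1ℚ 0≤r r≤1 (suc n) = *-mono 0≤r (^-nonneg 0≤r n) r≤1 (^-≤1ℚ 0≤r r≤1 n)

^-≥1 : ∀ {x} → 1ℚ ℚ.≤ x → ∀ n → 1ℚ ℚ.≤ x ^ℚ n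
^-≥1 1≤x zero    = ℚ.≤-refl
^-≥1 1≤x (suc n) = *-mono 0≤1 0≤1 1≤x (^-≥1 1≤x n)

^-monoˡ-≤ : ∀ {x y} → 0ℚ ℚ.≤ x → x ℚ.≤ y → ∀ n → x ^ℚ n ℚ.≤ y ^ℚ n
^-monoˡ-≤ 0≤x x≤y zero    = ℚ.≤-refl
^-monoˡ-≤ 0≤x x≤y (suc n) = *-mono 0≤x (^-nonneg 0≤x n) x≤y (^-monoˡ-≤ 0≤x x≤y n)

^-antimonoʳ-≤ : ∀ {r} → 0ℚ ℚ.≤ r → r ℚ.≤ 1ℚ → ∀ {m n} → m ℕ.≤ n → r ^ℚ n ℚ.≤ r ^ℚ m
^-antimonoʳ-≤ {r} 0≤r r≤1 {m} m≤n with ℕ.m≤n⇒∃[o]m+o≡n m≤n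
... | d , refl = subst (ℚ._≤ r ^ℚ m) (sym (^ℚ-homo-* r m d))
  (p*q≤p (^-nonneg 0≤r m) (^-≤1ℚ 0≤r r≤1 d))

^-monoʳ-≤ : ∀ {x} → 1ℚ ℚ.≤ x → ∀ {m n} → m ℕ.≤ n → x ^ℚ m ℚ.≤ x ^ℚ n
^-monoʳ-≤ {x} 1≤x {m} m≤n with ℕ.m≤n⇒∃[o]m+o≡n m≤n
... | d , refl = subst (x ^ℚ m ℚ.≤_) (sym (^ℚ-homo-* x m d))
  (subst (ℚ._≤ x ^ℚ m ℚ.* x ^ℚ d) (ℚ.*-identityʳ (x ^ℚ m))
    (ℚ.*-monoˡ-≤-nonNeg (x ^ℚ m) {{ℚ.nonNegative (^-nonneg (ℚ.≤-trans 0≤1 1≤x) m)}} (^-≥1 1≤x d)))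

fromℕ : ℕ → ℚ
fromℕ n = mkℚ (+ n) 0 (Coprime.sym (Coprime.1-coprimeTo n))

fromℕ-suc : ∀ n → fromℕ (suc n) ≡ fromℕ n ℚ.+ 1ℚ
fromℕ-suc n = ℚ.toℚᵘ-injective (ℚᵘ.≃-sym (ℚᵘ.≃-trans (ℚ.toℚᵘ-homo-+ (fromℕ n) 1ℚ)
  (ℚᵘ.*≡* (cong (ℤ._* + 1)
    (trans (cong (ℤ._+ + 1) (ℤ.*-identityʳ (+ n))) (cong +_ (ℕ.+-comm n 1)))))))

fromℕ-nonneg : ∀ n → 0ℚ ℚ.≤ fromℕ n
fromℕ-nonneg n = ℚ.nonNegative⁻¹ (fromℕ n)

-- A nonnegative fraction is at most its numerator.
archimedes : ∀ p → ∃[ n ] p ℚ.≤ fromℕ n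
archimedes p@(mkℚ (+ n) d-1 _) = n , ℚ.*≤* (ℤ.*-monoˡ-≤-nonNeg (+ n) (ℤ.+≤+ (ℕ.s≤s ℕ.z≤n)))
archimedes p@(mkℚ -[1+ n ] d-1 _) = 0 , ℚ.*≤* ℤ.-≤+

-- The bound 1 + n (1-r) ≤ 1/r^n, multiplied out. The left side decreases in n: consecutive values
-- differ by r^n (n+1) (1-r)^2.
bernoulli : ∀ {r} → 0ℚ ℚ.≤ r → r ℚ.≤ 1ℚ → ∀ n → r ^ℚ n ℚ.* (1ℚ ℚ.+ fromℕ n ℚ.* (1ℚ ℚ.- r)) ℚ.≤ 1ℚ
bernoulli {r} 0≤r r≤1 zero = ℚ.≤-reflexive
  (solve 1 (λ t → con 1ℚ :* (con 1ℚ :+ con 0ℚ :* t) := con 1ℚ) refl (1ℚ ℚ.- r))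
  where open Q
bernoulli {r} 0≤r r≤1 (suc n) = ℚ.≤-trans
  (0≤q-p⇒p≤q (subst (0ℚ ℚ.≤_) step
    (*-nonneg (*-nonneg (^-nonneg 0≤r n) (+-nonneg (fromℕ-nonneg n) 0≤1))
      (square-nonneg (1ℚ ℚ.- r)))))
  (bernoulli 0≤r r≤1 n)
  where
  open Q
  step : r ^ℚ n ℚ.* (fromℕ n ℚ.+ 1ℚ) ℚ.* ((1ℚ ℚ.- r) ℚ.* (1ℚ ℚ.- r)) ≡
         r ^ℚ n ℚ.* (1ℚ ℚ.+ fromℕ n ℚ.* (1ℚ ℚ.- r))
           ℚ.- r ℚ.* r ^ℚ n ℚ.* (1ℚ ℚ.+ fromℕ (suc n) ℚ.* (1ℚ ℚ.- r))
  step = trans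
    (solve 3 (λ x m r → x :* (m :+ con 1ℚ) :* ((con 1ℚ :- r) :* (con 1ℚ :- r))
      := x :* (con 1ℚ :+ m :* (con 1ℚ :- r)) :- r :* x :* (con 1ℚ :+ (m :+ con 1ℚ) :* (con 1ℚ :- r)))
      refl (r ^ℚ n) (fromℕ n) r)
    (cong (λ m → r ^ℚ n ℚ.* (1ℚ ℚ.+ fromℕ n ℚ.* (1ℚ ℚ.- r)) ℚ.- r ℚ.* r ^ℚ n ℚ.* (1ℚ ℚ.+ m ℚ.* (1ℚ ℚ.- r)))
      (sym (fromℕ-suc n)))

-- With t = 1 - r, `bernoulli` bounds r^N by 1/(1 + N t), and N is taken at least D/(t η).
geometric→0 : ∀ {r} → 0ℚ ℚ.≤ r → r ℚ.< 1ℚ → ∀ D {η} → 0ℚ ℚ.≤ D → 0ℚ ℚ.< η →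
  ∃[ N ] (∀ n → N ℕ.≤ n → D ℚ.* r ^ℚ n ℚ.≤ η)
geometric→0 {r} 0≤r r<1 D {η} 0≤D 0<η with archimedes (D ℚ.* recip (t ℚ.* η))
  where t = 1ℚ ℚ.- r
... | N , D/tη≤N = N , λ n N≤n → ℚ.≤-trans
  (ℚ.*-monoˡ-≤-nonNeg D {{ℚ.nonNegative 0≤D}} (^-antimonoʳ-≤ 0≤r (ℚ.<⇒≤ r<1) N≤n)) at-N
  where
  open ℚ.≤-Reasoning
  open Q using (solve; _:+_; _:*_; _:=_; con)
  t = 1ℚ ℚ.- r
  x = r ^ℚ N
  0<t : 0ℚ ℚ.< t
  0<t = p<1⇒0<1-p r<1
  0<tη = *-pos 0<t 0<η
  0≤x = ^-nonneg 0≤r N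
  at-N : D ℚ.* x ℚ.≤ η
  at-N = begin
    D ℚ.* x
      ≡⟨ trans (cong (ℚ._* (D ℚ.* x)) (*-recip 0<tη)) (ℚ.*-identityˡ (D ℚ.* x)) ⟨
    t ℚ.* η ℚ.* recip (t ℚ.* η) ℚ.* (D ℚ.* x)
      ≡⟨ solve 4 (λ a b D x → a :* b :* (D :* x) := D :* b :* (a :* x)) refl (t ℚ.* η) (recip (t ℚ.* η)) D x ⟩
    D ℚ.* recip (t ℚ.* η) ℚ.* (t ℚ.* η ℚ.* x)
      ≤⟨ ℚ.*-monoʳ-≤-nonNeg (t ℚ.* η ℚ.* x) {{ℚ.nonNegative (*-nonneg (ℚ.<⇒≤ 0<tη) 0≤x)}} D/tη≤N ⟩
    fromℕ N ℚ.* (t ℚ.* η ℚ.* x)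
      ≤⟨ p≤p+q (*-nonneg (ℚ.<⇒≤ 0<η) 0≤x) ⟩
    fromℕ N ℚ.* (t ℚ.* η ℚ.* x) ℚ.+ η ℚ.* x
      ≡⟨ solve 4 (λ m t η x → m :* (t :* η :* x) :+ η :* x := η :* (x :* (con 1ℚ :+ m :* t))) refl (fromℕ N) t η x ⟩
    η ℚ.* (x ℚ.* (1ℚ ℚ.+ fromℕ N ℚ.* t))
      ≤⟨ ℚ.*-monoˡ-≤-nonNeg η {{ℚ.nonNegative (ℚ.<⇒≤ 0<η)}} (bernoulli 0≤r (ℚ.<⇒≤ r<1) N) ⟩
    η ℚ.* 1ℚ
      ≡⟨ ℚ.*-identityʳ η ⟩
    η ∎

n≤tri : ∀ n → n ℕ.≤ tri n
n≤tri zero    = ℕ.z≤n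
n≤tri (suc n) = ℕ.m≤m+n (suc n) (tri n)

-- Induction on M: D^(n+1) r^tri(n+1) = D r ((D r)^n r^tri(n)) trades D for D r, which needs one
-- power of r less to fall below 1. In the new constant 1 + D κ the 1 serves n = 0 and D κ serves
-- all later n.
superexponential-decay : ∀ {r} → 0ℚ ℚ.≤ r → r ℚ.≤ 1ℚ → ∀ M {D} → 0ℚ ℚ.≤ D → D ℚ.* r ^ℚ M ℚ.≤ 1ℚ →
  ∃[ κ ] (0ℚ ℚ.≤ κ × (∀ n → D ^ℚ n ℚ.* r ^ℚ tri n ℚ.≤ κ ℚ.* r ^ℚ n))
superexponential-decay {r} 0≤r r≤1 zero {D} 0≤D D≤1 = 1ℚ , 0≤1 , λ n →
  *-mono (^-nonneg 0≤D n) (^-nonneg 0≤r (tri n))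
    (^-≤1ℚ 0≤D (subst (ℚ._≤ 1ℚ) (ℚ.*-identityʳ D) D≤1) n)
    (^-antimonoʳ-≤ 0≤r r≤1 (n≤tri n))
superexponential-decay {r} 0≤r r≤1 (suc M) {D} 0≤D Dr≤1
  with superexponential-decay 0≤r r≤1 M (*-nonneg 0≤D 0≤r)
         (subst (ℚ._≤ 1ℚ) (sym (ℚ.*-assoc D r (r ^ℚ M))) Dr≤1)
... | κ , 0≤κ , h = 1ℚ ℚ.+ D ℚ.* κ , +-nonneg 0≤1 0≤DC , λ
  { zero → subst (1ℚ ℚ.* 1ℚ ℚ.≤_) (sym (ℚ.*-identityʳ _)) (p≤p+q 0≤DC)
  ; (suc n) → begin
      D ℚ.* D ^ℚ n ℚ.* r ^ℚ (suc n ℕ.+ tri n)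
        ≡⟨ cong (D ℚ.* D ^ℚ n ℚ.*_) (^ℚ-homo-* r (suc n) (tri n)) ⟩
      D ℚ.* D ^ℚ n ℚ.* (r ℚ.* r ^ℚ n ℚ.* r ^ℚ tri n)
        ≡⟨ solve 5 (λ D a r b c → D :* a :* (r :* b :* c) := D :* r :* (a :* b :* c)) refl
             D (D ^ℚ n) r (r ^ℚ n) (r ^ℚ tri n) ⟩
      D ℚ.* r ℚ.* (D ^ℚ n ℚ.* r ^ℚ n ℚ.* r ^ℚ tri n)
        ≡⟨ cong (λ x → D ℚ.* r ℚ.* (x ℚ.* r ^ℚ tri n)) (^ℚ-distrib-* D r n) ⟨
      D ℚ.* r ℚ.* ((D ℚ.* r) ^ℚ n ℚ.* r ^ℚ tri n)
        ≤⟨ ℚ.*-monoˡ-≤-nonNeg (D ℚ.* r) {{ℚ.nonNegative (*-nonneg 0≤D 0≤r)}} (h n) ⟩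
      D ℚ.* r ℚ.* (κ ℚ.* r ^ℚ n)
        ≡⟨ solve 4 (λ D r κ x → D :* r :* (κ :* x) := D :* κ :* (r :* x)) refl D r κ (r ^ℚ n) ⟩
      D ℚ.* κ ℚ.* r ^ℚ suc n
        ≤⟨ ℚ.*-monoʳ-≤-nonNeg (r ^ℚ suc n) {{ℚ.nonNegative (^-nonneg 0≤r (suc n))}}
             (q≤p+q {1ℚ} {D ℚ.* κ} 0≤1) ⟩
      (1ℚ ℚ.+ D ℚ.* κ) ℚ.* r ^ℚ suc n ∎ }
  where
  open ℚ.≤-Reasoning
  open Q using (solve; _:+_; _:*_; _:=_)
  0≤DC = *-nonneg 0≤D 0≤κ

-- Bounds on Gaussian rationals

nsqᵍ : ℚ[i] → ℚ
nsqᵍ (a ,i b) = a ℚ.* a ℚ.+ b ℚ.* b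

nsqᵍ-⊗ : ∀ w v → nsqᵍ (w ⊗ v) ≡ nsqᵍ w ℚ.* nsqᵍ v
nsqᵍ-⊗ (a ,i b) (c ,i d) = solve 4
  (λ a b c d → (a :* c :- b :* d) :* (a :* c :- b :* d)
            :+ (a :* d :+ b :* c) :* (a :* d :+ b :* c)
            := (a :* a :+ b :* b) :* (c :* c :+ d :* d)) refl a b c d
  where open Q

nsqᵍ-nonneg : ∀ w → 0ℚ ℚ.≤ nsqᵍ w
nsqᵍ-nonneg (a ,i b) = +-nonneg (square-nonneg a) (square-nonneg b)

-- |w| ≤ r, squared because the absolute value of a Gaussian rational may be irrational.
infix 4 ∥_∥≤_
record ∥_∥≤_ (w : ℚ[i]) (r : ℚ) : Set where
  constructor bound
  field
    nonneg : 0ℚ ℚ.≤ r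
    nsq≤   : nsqᵍ w ℚ.≤ r ℚ.* r

∥∥-weaken : ∀ {w r s} → r ℚ.≤ s → ∥ w ∥≤ r → ∥ w ∥≤ s
∥∥-weaken r≤s (bound 0≤r h) = bound (ℚ.≤-trans 0≤r r≤s) (ℚ.≤-trans h (*-mono 0≤r 0≤r r≤s r≤s))

∥𝟘∥ : ∀ {r} → 0ℚ ℚ.≤ r → ∥ 𝟘 ∥≤ r
∥𝟘∥ 0≤r = bound 0≤r (*-nonneg 0≤r 0≤r)

∥𝟙∥ : ∥ 𝟙 ∥≤ 1ℚ
∥𝟙∥ = bound 0≤1 ℚ.≤-refl

∥⊖∥ : ∀ {w r} → ∥ w ∥≤ r → ∥ ⊖ w ∥≤ r
∥⊖∥ {a ,i b} {r} (bound 0≤r h) = bound 0≤r (subst (ℚ._≤ r ℚ.* r)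
  (solve 2 (λ a b → a :* a :+ b :* b := (:- a) :* (:- a) :+ (:- b) :* (:- b)) refl a b) h)
  where open Q

∥⊗∥ : ∀ {w v r s} → ∥ w ∥≤ r → ∥ v ∥≤ s → ∥ w ⊗ v ∥≤ r ℚ.* s
∥⊗∥ {w} {v} {r} {s} (bound 0≤r h) (bound 0≤s k) = bound (*-nonneg 0≤r 0≤s) (begin
  nsqᵍ (w ⊗ v)                ≡⟨ nsqᵍ-⊗ w v ⟩
  nsqᵍ w ℚ.* nsqᵍ v           ≤⟨ *-mono (nsqᵍ-nonneg w) (nsqᵍ-nonneg v) h k ⟩
  r ℚ.* r ℚ.* (s ℚ.* s)       ≡⟨ solve 2 (λ r s → r :* r :* (s :* s) := r :* s :* (r :* s)) refl r s ⟩
  r ℚ.* s ℚ.* (r ℚ.* s)       ∎)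
  where
  open ℚ.≤-Reasoning
  open Q using (solve; _:*_; _:=_)

-- The cross term is bounded by (ac + bd)² + (ad − bc)² = (a² + b²)(c² + d²).
∥⊕∥ : ∀ {w v r s} → ∥ w ∥≤ r → ∥ v ∥≤ s → ∥ w ⊕ v ∥≤ r ℚ.+ s
∥⊕∥ {a ,i b} {c ,i d} {r} {s} (bound 0≤r h) (bound 0≤s k) = bound (+-nonneg 0≤r 0≤s) (begin
  (a ℚ.+ c) ℚ.* (a ℚ.+ c) ℚ.+ (b ℚ.+ d) ℚ.* (b ℚ.+ d)
    ≡⟨ solve 4 (λ a b c d → (a :+ c) :* (a :+ c) :+ (b :+ d) :* (b :+ d)
         := (a :* a :+ b :* b) :+ (c :* c :+ d :* d) :+ ((a :* c :+ b :* d) :+ (a :* c :+ b :* d)))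
         refl a b c d ⟩
  (a ℚ.* a ℚ.+ b ℚ.* b) ℚ.+ (c ℚ.* c ℚ.+ d ℚ.* d) ℚ.+ (x ℚ.+ x)
    ≤⟨ ℚ.+-mono-≤ (ℚ.+-mono-≤ h k) (ℚ.+-mono-≤ x≤rs x≤rs) ⟩
  r ℚ.* r ℚ.+ s ℚ.* s ℚ.+ (r ℚ.* s ℚ.+ r ℚ.* s)
    ≡⟨ solve 2 (λ r s → r :* r :+ s :* s :+ (r :* s :+ r :* s) := (r :+ s) :* (r :+ s)) refl r s ⟩
  (r ℚ.+ s) ℚ.* (r ℚ.+ s) ∎)
  where
  open ℚ.≤-Reasoning
  open Q using (solve; _:+_; _:*_; _:-_; _:=_)
  x = a ℚ.* c ℚ.+ b ℚ.* d
  x≤rs : x ℚ.≤ r ℚ.* s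
  x≤rs = square-cancel-≤ (*-nonneg 0≤r 0≤s) (begin
    x ℚ.* x
      ≤⟨ p≤p+q (square-nonneg (a ℚ.* d ℚ.- b ℚ.* c)) ⟩
    x ℚ.* x ℚ.+ (a ℚ.* d ℚ.- b ℚ.* c) ℚ.* (a ℚ.* d ℚ.- b ℚ.* c)
      ≡⟨ solve 4 (λ a b c d → (a :* c :+ b :* d) :* (a :* c :+ b :* d)
             :+ (a :* d :- b :* c) :* (a :* d :- b :* c)
           := (a :* a :+ b :* b) :* (c :* c :+ d :* d)) refl a b c d ⟩
    (a ℚ.* a ℚ.+ b ℚ.* b) ℚ.* (c ℚ.* c ℚ.+ d ℚ.* d)
      ≤⟨ *-mono (nsqᵍ-nonneg (a ,i b)) (nsqᵍ-nonneg (c ,i d)) h k ⟩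
    r ℚ.* r ℚ.* (s ℚ.* s)
      ≡⟨ solve 2 (λ r s → r :* r :* (s :* s) := r :* s :* (r :* s)) refl r s ⟩
    r ℚ.* s ℚ.* (r ℚ.* s) ∎)

∥⊝∥ : ∀ {w v r s} → ∥ w ∥≤ r → ∥ v ∥≤ s → ∥ w ⊝ v ∥≤ r ℚ.+ s
∥⊝∥ h k = ∥⊕∥ h (∥⊖∥ k)

∥^∥ : ∀ {w r} → ∥ w ∥≤ r → ∀ n → ∥ w ^ᵍ n ∥≤ r ^ℚ n
∥^∥ h zero    = ∥𝟙∥
∥^∥ h (suc n) = ∥⊗∥ h (∥^∥ h n)

∥sgn∥ : ∀ n → ∥ sgn n ∥≤ 1ℚ
∥sgn∥ zero    = ∥𝟙∥
∥sgn∥ (suc n) = ∥⊗∥ (∥⊖∥ ∥𝟙∥) (∥sgn∥ n)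

-- The real part of x is at most s, so that of 1 - x is at least 1 - s, which is nonnegative.
nsqᵍ-1-x : ∀ {x s} → ∥ x ∥≤ s → s ℚ.≤ 1ℚ → (1ℚ ℚ.- s) ℚ.* (1ℚ ℚ.- s) ℚ.≤ nsqᵍ (𝟙 ⊝ x)
nsqᵍ-1-x {a ,i b} {s} (bound 0≤s h) s≤1 =
  ℚ.≤-trans (*-mono 0≤t 0≤t t≤1-a t≤1-a) (p≤p+q (square-nonneg (0ℚ ℚ.- b)))
  where
  0≤t : 0ℚ ℚ.≤ 1ℚ ℚ.- s
  0≤t = p≤q⇒0≤q-p s≤1
  a≤s : a ℚ.≤ s
  a≤s = square-cancel-≤ 0≤s (ℚ.≤-trans (p≤p+q (square-nonneg b)) h)
  t≤1-a : 1ℚ ℚ.- s ℚ.≤ 1ℚ ℚ.- a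
  t≤1-a = ℚ.+-monoʳ-≤ 1ℚ (ℚ.neg-antimono-≤ a≤s)

∥1-x∥⁻¹ : ∀ {u x s R} → u ⊗ (𝟙 ⊝ x) ≡ 𝟙 → ∥ x ∥≤ s → s ℚ.≤ 1ℚ → 0ℚ ℚ.≤ R → R ℚ.* (1ℚ ℚ.- s) ≡ 1ℚ →
          ∥ u ∥≤ R
∥1-x∥⁻¹ {u} {x} {s} {R} u⊗1-x ∥x∥ s≤1 0≤R R⊗1-s = bound 0≤R (begin
  nsqᵍ u
    ≡⟨ ℚ.*-identityʳ (nsqᵍ u) ⟨
  nsqᵍ u ℚ.* (1ℚ ℚ.* 1ℚ)
    ≡⟨ cong (λ y → nsqᵍ u ℚ.* (y ℚ.* y)) R⊗1-s ⟨
  nsqᵍ u ℚ.* (R ℚ.* t ℚ.* (R ℚ.* t))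
    ≡⟨ solve 3 (λ n R t → n :* (R :* t :* (R :* t)) := R :* R :* (n :* (t :* t))) refl (nsqᵍ u) R t ⟩
  R ℚ.* R ℚ.* (nsqᵍ u ℚ.* (t ℚ.* t))
    ≤⟨ ℚ.*-monoˡ-≤-nonNeg (R ℚ.* R) {{ℚ.nonNegative (*-nonneg 0≤R 0≤R)}}
         (ℚ.*-monoˡ-≤-nonNeg (nsqᵍ u) {{ℚ.nonNegative (nsqᵍ-nonneg u)}} (nsqᵍ-1-x ∥x∥ s≤1)) ⟩
  R ℚ.* R ℚ.* (nsqᵍ u ℚ.* nsqᵍ (𝟙 ⊝ x))
    ≡⟨ cong (R ℚ.* R ℚ.*_) (trans (sym (nsqᵍ-⊗ u (𝟙 ⊝ x))) (cong nsqᵍ u⊗1-x)) ⟩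
  R ℚ.* R ℚ.* 1ℚ
    ≡⟨ ℚ.*-identityʳ (R ℚ.* R) ⟩
  R ℚ.* R ∎)
  where
  open ℚ.≤-Reasoning
  open Q using (solve; _:*_; _:=_)
  t = 1ℚ ℚ.- s

∑-split : ∀ m d f → ∑ (m ℕ.+ d) f ≡ ∑ m f ⊕ ∑ d (λ i → f (m ℕ.+ i))
∑-split m zero    f = trans (cong (λ n → ∑ n f) (ℕ.+-identityʳ m)) (sym (⊕-identityʳ (∑ m f)))
∑-split m (suc d) f = trans (cong (λ n → ∑ n f) (ℕ.+-suc m d))
  (trans (cong (_⊕ f (m ℕ.+ d)) (∑-split m d f))
    (⊕-assoc (∑ m f) (∑ d (λ i → f (m ℕ.+ i))) (f (m ℕ.+ d))))

module _ {r R : ℚ} (0≤r : 0ℚ ℚ.≤ r) (0≤R : 0ℚ ℚ.≤ R) (R*1-r : R ℚ.* (1ℚ ℚ.- r) ≡ 1ℚ) where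

  ∥∑∥ : ∀ {K f} N → 0ℚ ℚ.≤ K → (∀ {n} → n ℕ.< N → ∥ f n ∥≤ K ℚ.* r ^ℚ n) → ∥ ∑ N f ∥≤ K ℚ.* R
  ∥∑∥ {K} {f} N 0≤K f≤ = ∥∥-weaken
    (0≤q-p⇒p≤q (subst (0ℚ ℚ.≤_)
      (solve 3 (λ K R x → K :* R :* x := K :* R :- K :* R :* (con 1ℚ :- x)) refl K R (r ^ℚ N))
      (*-nonneg (*-nonneg 0≤K 0≤R) (^-nonneg 0≤r N))))
    (partial N f≤)
    where
    open Q
    -- The factor 1 - r^N makes the induction work: by R (1-r) = 1 the new term K r^N equals K R
    -- (r^N - r^(N+1)).
    partial : ∀ N → (∀ {n} → n ℕ.< N → ∥ f n ∥≤ K ℚ.* r ^ℚ n) → ∥ ∑ N f ∥≤ K ℚ.* R ℚ.* (1ℚ ℚ.- r ^ℚ N)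
    partial zero    f≤ = ∥𝟘∥ (ℚ.≤-reflexive (solve 2 (λ K R → con 0ℚ := K :* R :* (con 1ℚ :- con 1ℚ)) refl K R))
    partial (suc N) f≤ = subst (∥ ∑ (suc N) f ∥≤_)
      (trans
        (cong (λ y → K ℚ.* R ℚ.* (1ℚ ℚ.- r ^ℚ N) ℚ.+ K ℚ.* y)
          (trans (sym (ℚ.*-identityˡ (r ^ℚ N))) (cong (ℚ._* r ^ℚ N) (sym R*1-r))))
        (solve 4 (λ K R x r → K :* R :* (con 1ℚ :- x) :+ K :* (R :* (con 1ℚ :- r) :* x)
          := K :* R :* (con 1ℚ :- r :* x)) refl K R (r ^ℚ N) r))
      (∥⊕∥ (partial N (λ n<N → f≤ (ℕ.m<n⇒m<1+n n<N))) (f≤ ℕ.≤-refl))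

  ∥∑-tail∥ : ∀ {K f} → 0ℚ ℚ.≤ K → (∀ n → ∥ f n ∥≤ K ℚ.* r ^ℚ n) → ∀ {m n} → m ℕ.≤ n →
             ∥ ∑ n f ⊝ ∑ m f ∥≤ K ℚ.* R ℚ.* r ^ℚ m
  ∥∑-tail∥ {K} {f} 0≤K f≤ {m} m≤n with ℕ.m≤n⇒∃[o]m+o≡n m≤n
  ... | d , refl = subst (λ w → ∥ w ∥≤ K ℚ.* R ℚ.* r ^ℚ m)
    (trans (G.solve 2 (λ a b → b G.:= a G.:+ b G.:- a) refl (∑ m f) (∑ d (λ i → f (m ℕ.+ i))))
      (cong (_⊝ ∑ m f) (sym (∑-split m d f))))
    (∥∥-weaken (ℚ.≤-reflexive (solve 3 (λ K x R → K :* x :* R := K :* R :* x) refl K (r ^ℚ m) R))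
      (∥∑∥ d (*-nonneg 0≤K (^-nonneg 0≤r m)) (λ {i} _ →
        ∥∥-weaken (ℚ.≤-reflexive (trans (cong (K ℚ.*_) (^ℚ-homo-* r m i))
          (sym (ℚ.*-assoc K (r ^ℚ m) (r ^ℚ i))))) (f≤ (m ℕ.+ i)))))
    where open Q

-- Estimates uniform in the index of the approximating sequences

-- r bounds |q|, and E bounds every other factor of the terms and weights.
record Constants : Set where
  field
    r r⁻¹ R Z E κ : ℚ
    0≤r     : 0ℚ ℚ.≤ r
    r<1     : r ℚ.< 1ℚ
    r⁻¹*r   : r⁻¹ ℚ.* r ≡ 1ℚ
    1≤r⁻¹   : 1ℚ ℚ.≤ r⁻¹
    0≤R     : 0ℚ ℚ.≤ R
    R*1-r   : R ℚ.* (1ℚ ℚ.- r) ≡ 1ℚ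
    1≤Z     : 1ℚ ℚ.≤ Z
    1+Z≤E   : 1ℚ ℚ.+ Z ℚ.≤ E
    1+R≤E   : 1ℚ ℚ.+ R ℚ.≤ E
    0≤κ     : 0ℚ ℚ.≤ κ
    E-decay : ∀ n → E ^ℚ (4 ℕ.* suc n) ℚ.* r⁻¹ ^ℚ n ℚ.* r ^ℚ tri n ℚ.≤ κ ℚ.* r ^ℚ n

  r≤1 : r ℚ.≤ 1ℚ
  r≤1 = ℚ.<⇒≤ r<1

  0≤Z : 0ℚ ℚ.≤ Z
  0≤Z = ℚ.≤-trans 0≤1 1≤Z

  2≤E : 1ℚ ℚ.+ 1ℚ ℚ.≤ E
  2≤E = ℚ.≤-trans (ℚ.+-monoʳ-≤ 1ℚ 1≤Z) 1+Z≤E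

  1≤E : 1ℚ ℚ.≤ E
  1≤E = ℚ.≤-trans (p≤p+q 0≤1) 2≤E

  0≤E : 0ℚ ℚ.≤ E
  0≤E = ℚ.≤-trans 0≤1 1≤E

  Z≤E : Z ℚ.≤ E
  Z≤E = ℚ.≤-trans (q≤p+q 0≤1) 1+Z≤E

  R≤E : R ℚ.≤ E
  R≤E = ℚ.≤-trans (q≤p+q 0≤1) 1+R≤E

  0≤r^ : ∀ n → 0ℚ ℚ.≤ r ^ℚ n
  0≤r^ = ^-nonneg 0≤r

  0≤E^ : ∀ n → 0ℚ ℚ.≤ E ^ℚ n
  0≤E^ = ^-nonneg 0≤E

  double : ∀ n → E ^ℚ n ℚ.+ E ^ℚ n ℚ.≤ E ^ℚ suc n
  double n = subst (ℚ._≤ E ^ℚ suc n)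
    (solve 1 (λ x → (con 1ℚ :+ con 1ℚ) :* x := x :+ x) refl (E ^ℚ n))
    (ℚ.*-monoʳ-≤-nonNeg (E ^ℚ n) {{ℚ.nonNegative (0≤E^ n)}} 2≤E)
    where open Q

  -- The error of a weight is of order r^d with d = N - n. The powers of r⁻¹ in `E-decay` exchange
  -- r^d for r^N, uniformly in n, and a summable r^n still remains. The cap 4(n+1) covers the
  -- exponents of E that occur: 4n+2 on the left side and 3n+4 on the right.
  decay : ∀ n d {m} → m ℕ.≤ 4 ℕ.* suc n →
    r ^ℚ d ℚ.* E ^ℚ m ℚ.* r ^ℚ tri n ℚ.≤ r ^ℚ (n ℕ.+ d) ℚ.* κ ℚ.* r ^ℚ n
  decay n d {m} m≤ = begin
    r ^ℚ d ℚ.* E ^ℚ m ℚ.* r ^ℚ tri n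
      ≤⟨ ℚ.*-monoʳ-≤-nonNeg (r ^ℚ tri n) {{ℚ.nonNegative (0≤r^ (tri n))}}
           (ℚ.*-monoˡ-≤-nonNeg (r ^ℚ d) {{ℚ.nonNegative (0≤r^ d)}} (^-monoʳ-≤ 1≤E m≤)) ⟩
    r ^ℚ d ℚ.* X ℚ.* r ^ℚ tri n
      ≡⟨ trans (cong (r ^ℚ d ℚ.* X ℚ.* r ^ℚ tri n ℚ.*_) (1^ n)) (ℚ.*-identityʳ _) ⟨
    r ^ℚ d ℚ.* X ℚ.* r ^ℚ tri n ℚ.* 1ℚ ^ℚ n
      ≡⟨ cong (λ y → r ^ℚ d ℚ.* X ℚ.* r ^ℚ tri n ℚ.* y)
           (trans (cong (_^ℚ n) (sym r⁻¹*r)) (^ℚ-distrib-* r⁻¹ r n)) ⟩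
    r ^ℚ d ℚ.* X ℚ.* r ^ℚ tri n ℚ.* (r⁻¹ ^ℚ n ℚ.* r ^ℚ n)
      ≡⟨ solve 5 (λ a b c d e → a :* b :* c :* (d :* e) := e :* a :* (b :* d :* c)) refl
           (r ^ℚ d) X (r ^ℚ tri n) (r⁻¹ ^ℚ n) (r ^ℚ n) ⟩
    r ^ℚ n ℚ.* r ^ℚ d ℚ.* (X ℚ.* r⁻¹ ^ℚ n ℚ.* r ^ℚ tri n)
      ≤⟨ ℚ.*-monoˡ-≤-nonNeg (r ^ℚ n ℚ.* r ^ℚ d) {{ℚ.nonNegative (*-nonneg (0≤r^ n) (0≤r^ d))}} (E-decay n) ⟩
    r ^ℚ n ℚ.* r ^ℚ d ℚ.* (κ ℚ.* r ^ℚ n)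
      ≡⟨ cong (ℚ._* (κ ℚ.* r ^ℚ n)) (^ℚ-homo-* r n d) ⟨
    r ^ℚ (n ℕ.+ d) ℚ.* (κ ℚ.* r ^ℚ n)
      ≡⟨ ℚ.*-assoc (r ^ℚ (n ℕ.+ d)) κ (r ^ℚ n) ⟨
    r ^ℚ (n ℕ.+ d) ℚ.* κ ℚ.* r ^ℚ n ∎
    where
    open ℚ.≤-Reasoning
    open Q using (solve; _:*_; _:=_)
    X = E ^ℚ (4 ℕ.* suc n)
    1^ : ∀ n → 1ℚ ^ℚ n ≡ 1ℚ
    1^ zero    = refl
    1^ (suc n) = trans (ℚ.*-identityˡ (1ℚ ^ℚ n)) (1^ n)

module Estimates (K : Constants)
  (q : ℚ[i]) (g : ℕ → ℚ[i]) (⟨q⟩⊗g : ∀ n → pochᵍ q q n ⊗ g n ≡ 𝟙)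
  (z z⁻¹ : ℚ[i]) (z⊗z⁻¹ : z ⊗ z⁻¹ ≡ 𝟙)
  (∥q∥ : ∥ q ∥≤ Constants.r K) (∥z∥ : ∥ z ∥≤ Constants.Z K) (∥z⁻¹∥ : ∥ z⁻¹ ∥≤ Constants.Z K) where

  open Constants K
  open QSeries q g ⟨q⟩⊗g
  open Theta z z⁻¹ z⊗z⁻¹

  ∥q^∥ : ∀ n → ∥ q ^ᵍ n ∥≤ r ^ℚ n
  ∥q^∥ = ∥^∥ ∥q∥

  ∥1-aq^∥ : ∀ {a} → ∥ a ∥≤ Z → ∀ n → ∥ 𝟙 ⊝ a ⊗ q ^ᵍ n ∥≤ E
  ∥1-aq^∥ ∥a∥ n = ∥∥-weaken
    (ℚ.≤-trans
      (ℚ.+-monoʳ-≤ 1ℚ (p*q≤p 0≤Z (^-≤1ℚ 0≤r r≤1 n)))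
      1+Z≤E)
    (∥⊝∥ ∥𝟙∥ (∥⊗∥ ∥a∥ (∥q^∥ n)))

  ∥poch∥ : ∀ {a} → ∥ a ∥≤ Z → ∀ n → ∥ pochᵍ a q n ∥≤ E ^ℚ n
  ∥poch∥ ∥a∥ zero    = ∥𝟙∥
  ∥poch∥ ∥a∥ (suc n) = ∥∥-weaken (ℚ.≤-reflexive (ℚ.*-comm (E ^ℚ n) E))
    (∥⊗∥ (∥poch∥ ∥a∥ n) (∥1-aq^∥ ∥a∥ n))

  -- Terms, weights and the distance of the weights from 1

  ratio : ℕ → ℕ → ℚ[i]
  ratio N d = ⟨q⟩ N ⊗ g (N ℕ.+ d)

  -- This is 1/(1 - q^(m+1)).
  step : ℕ → ℚ[i]
  step m = ⟨q⟩ m ⊗ g (suc m)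

  step⊗1-q : ∀ m → step m ⊗ (𝟙 ⊝ q ^ᵍ suc m) ≡ 𝟙
  step⊗1-q m = trans
    (solve 3 (λ a b c → a :* b :* c := a :* c :* b) refl (⟨q⟩ m) (g (suc m)) (𝟙 ⊝ q ^ᵍ suc m))
    (⟨q⟩⊗g (suc m))
    where open G

  ∥step∥ : ∀ m → ∥ step m ∥≤ R
  ∥step∥ m = ∥1-x∥⁻¹ (step⊗1-q m)
    (∥∥-weaken (p*q≤p 0≤r (^-≤1ℚ 0≤r r≤1 m)) (∥q^∥ (suc m)))
    r≤1 0≤R R*1-r

  ratio-suc : ∀ N d → ratio N (suc d) ≡ ratio N d ⊗ step (N ℕ.+ d)
  ratio-suc N d = begin
    ⟨q⟩ N ⊗ g (N ℕ.+ suc d)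
      ≡⟨ cong (λ n → ⟨q⟩ N ⊗ g n) (ℕ.+-suc N d) ⟩
    ⟨q⟩ N ⊗ h
      ≡⟨ ⊗-identityˡ (⟨q⟩ N ⊗ h) ⟨
    𝟙 ⊗ (⟨q⟩ N ⊗ h)
      ≡⟨ cong (_⊗ (⟨q⟩ N ⊗ h)) (⟨q⟩⊗g (N ℕ.+ d)) ⟨
    ⟨q⟩ (N ℕ.+ d) ⊗ g (N ℕ.+ d) ⊗ (⟨q⟩ N ⊗ h)
      ≡⟨ solve 4 (λ a b c d → a :* b :* (c :* d) := c :* b :* (a :* d)) refl
           (⟨q⟩ (N ℕ.+ d)) (g (N ℕ.+ d)) (⟨q⟩ N) h ⟩
    ratio N d ⊗ step (N ℕ.+ d) ∎
    where
    open ≡-Reasoning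
    open G
    h = g (suc (N ℕ.+ d))

  ∥ratio∥ : ∀ N d → ∥ ratio N d ∥≤ E ^ℚ d
  ∥ratio∥ N zero = subst (∥_∥≤ 1ℚ)
    (sym (trans (cong (λ n → ⟨q⟩ N ⊗ g n) (ℕ.+-identityʳ N)) (⟨q⟩⊗g N))) ∥𝟙∥
  ∥ratio∥ N (suc d) = subst (∥_∥≤ E ^ℚ suc d) (sym (ratio-suc N d))
    (∥∥-weaken (ℚ.≤-reflexive (ℚ.*-comm (E ^ℚ d) E))
      (∥⊗∥ (∥ratio∥ N d) (∥∥-weaken R≤E (∥step∥ (N ℕ.+ d)))))

  -- By 1/(1-x) = 1 + x/(1-x) with |x| ≤ r^N, a new factor adds at most E^d R r^N to the error, and
  -- 1 + R ≤ E absorbs the sum.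
  ∥ratio-1∥ : ∀ N d → ∥ ratio N d ⊝ 𝟙 ∥≤ r ^ℚ N ℚ.* E ^ℚ d
  ∥ratio-1∥ N zero = subst (∥_∥≤ r ^ℚ N ℚ.* 1ℚ)
    (sym (cong (_⊝ 𝟙) (trans (cong (λ n → ⟨q⟩ N ⊗ g n) (ℕ.+-identityʳ N)) (⟨q⟩⊗g N))))
    (∥𝟘∥ (*-nonneg (0≤r^ N) 0≤1))
  ∥ratio-1∥ N (suc d) = subst (∥_∥≤ r ^ℚ N ℚ.* E ^ℚ suc d) (sym eq)
    (∥∥-weaken le
      (∥⊕∥ (∥ratio-1∥ N d) (∥⊗∥ (∥ratio∥ N d) (∥⊗∥ (∥step∥ (N ℕ.+ d)) (∥q^∥ (suc (N ℕ.+ d)))))))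
    where
    H = ratio N d
    u = step (N ℕ.+ d)
    x = q ^ᵍ suc (N ℕ.+ d)
    eq : ratio N (suc d) ⊝ 𝟙 ≡ H ⊝ 𝟙 ⊕ H ⊗ (u ⊗ x)
    eq = begin
      ratio N (suc d) ⊝ 𝟙
        ≡⟨ cong (_⊝ 𝟙) (ratio-suc N d) ⟩
      H ⊗ u ⊝ 𝟙
        ≡⟨ solve 3 (λ H u x → H :* u :- I := H :* (u :* (I :- x)) :- I :+ H :* (u :* x)) refl H u x ⟩
      H ⊗ (u ⊗ (𝟙 ⊝ x)) ⊝ 𝟙 ⊕ H ⊗ (u ⊗ x)
        ≡⟨ cong (λ y → y ⊝ 𝟙 ⊕ H ⊗ (u ⊗ x))
             (trans (cong (H ⊗_) (step⊗1-q (N ℕ.+ d))) (⊗-identityʳ H)) ⟩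
      H ⊝ 𝟙 ⊕ H ⊗ (u ⊗ x) ∎
      where
      open ≡-Reasoning
      open G
    le : r ^ℚ N ℚ.* E ^ℚ d ℚ.+ E ^ℚ d ℚ.* (R ℚ.* r ^ℚ suc (N ℕ.+ d)) ℚ.≤ r ^ℚ N ℚ.* E ^ℚ suc d
    le = begin
      r ^ℚ N ℚ.* E ^ℚ d ℚ.+ E ^ℚ d ℚ.* (R ℚ.* r ^ℚ suc (N ℕ.+ d))
        ≤⟨ ℚ.+-monoʳ-≤ (r ^ℚ N ℚ.* E ^ℚ d) (ℚ.*-monoˡ-≤-nonNeg (E ^ℚ d) {{ℚ.nonNegative (0≤E^ d)}}
             (ℚ.*-monoˡ-≤-nonNeg R {{ℚ.nonNegative 0≤R}}
               (^-antimonoʳ-≤ 0≤r r≤1 (ℕ.≤-trans (ℕ.m≤m+n N d) (ℕ.n≤1+n (N ℕ.+ d)))))) ⟩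
      r ^ℚ N ℚ.* E ^ℚ d ℚ.+ E ^ℚ d ℚ.* (R ℚ.* r ^ℚ N)
        ≡⟨ solve 3 (λ x e R → x :* e :+ e :* (R :* x) := x :* e :* (con 1ℚ :+ R)) refl (r ^ℚ N) (E ^ℚ d) R ⟩
      r ^ℚ N ℚ.* E ^ℚ d ℚ.* (1ℚ ℚ.+ R)
        ≤⟨ ℚ.*-monoˡ-≤-nonNeg (r ^ℚ N ℚ.* E ^ℚ d)
             {{ℚ.nonNegative (*-nonneg (0≤r^ N) (0≤E^ d))}} 1+R≤E ⟩
      r ^ℚ N ℚ.* E ^ℚ d ℚ.* E
        ≡⟨ solve 3 (λ x e E → x :* e :* E := x :* (E :* e)) refl (r ^ℚ N) (E ^ℚ d) E ⟩
      r ^ℚ N ℚ.* E ^ℚ suc d ∎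
      where
      open ℚ.≤-Reasoning
      open Q using (solve; _:+_; _:*_; _:=_; con)

  weight : ℕ → ℕ → ℚ[i]
  weight n d = ⟨q⟩ (n ℕ.+ d) ⊗ g d

  weight-suc : ∀ n d → weight (suc n) d ≡ weight n d ⊗ (𝟙 ⊝ q ^ᵍ suc (n ℕ.+ d))
  weight-suc n d = solve 3 (λ a b c → a :* b :* c := a :* c :* b) refl
    (⟨q⟩ (n ℕ.+ d)) (𝟙 ⊝ q ^ᵍ suc (n ℕ.+ d)) (g d)
    where open G

  ∥q∥≤Z : ∥ q ∥≤ Z
  ∥q∥≤Z = ∥∥-weaken (ℚ.≤-trans r≤1 1≤Z) ∥q∥

  ∥weight∥ : ∀ n d → ∥ weight n d ∥≤ E ^ℚ n
  ∥weight∥ zero    d = subst (∥_∥≤ 1ℚ) (sym (⟨q⟩⊗g d)) ∥𝟙∥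
  ∥weight∥ (suc n) d = subst (∥_∥≤ E ^ℚ suc n) (sym (weight-suc n d))
    (∥∥-weaken (ℚ.≤-reflexive (ℚ.*-comm (E ^ℚ n) E))
      (∥⊗∥ (∥weight∥ n d) (∥1-aq^∥ ∥q∥≤Z (n ℕ.+ d))))

  -- A new factor 1 - x with |x| ≤ r^d adds at most E^n r^d to the error; this doubles the bound,
  -- and 2 ≤ E absorbs it.
  ∥weight-1∥ : ∀ n d → ∥ weight n d ⊝ 𝟙 ∥≤ r ^ℚ d ℚ.* E ^ℚ n
  ∥weight-1∥ zero d = subst (∥_∥≤ r ^ℚ d ℚ.* 1ℚ) (sym (cong (_⊝ 𝟙) (⟨q⟩⊗g d)))
    (∥𝟘∥ (*-nonneg (0≤r^ d) 0≤1))
  ∥weight-1∥ (suc n) d = subst (∥_∥≤ r ^ℚ d ℚ.* E ^ℚ suc n) (sym eq)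
    (∥∥-weaken le (∥⊝∥ (∥weight-1∥ n d) (∥⊗∥ (∥weight∥ n d) (∥q^∥ (suc (n ℕ.+ d))))))
    where
    W = weight n d
    x = q ^ᵍ suc (n ℕ.+ d)
    eq : weight (suc n) d ⊝ 𝟙 ≡ W ⊝ 𝟙 ⊝ W ⊗ x
    eq = trans (cong (_⊝ 𝟙) (weight-suc n d))
      (solve 2 (λ W x → W :* (I :- x) :- I := W :- I :- W :* x) refl W x)
      where open G
    le : r ^ℚ d ℚ.* E ^ℚ n ℚ.+ E ^ℚ n ℚ.* r ^ℚ suc (n ℕ.+ d) ℚ.≤ r ^ℚ d ℚ.* E ^ℚ suc n
    le = begin
      r ^ℚ d ℚ.* E ^ℚ n ℚ.+ E ^ℚ n ℚ.* r ^ℚ suc (n ℕ.+ d)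
        ≤⟨ ℚ.+-monoʳ-≤ (r ^ℚ d ℚ.* E ^ℚ n) (ℚ.*-monoˡ-≤-nonNeg (E ^ℚ n) {{ℚ.nonNegative (0≤E^ n)}}
             (^-antimonoʳ-≤ 0≤r r≤1 (ℕ.≤-trans (ℕ.m≤n+m d n) (ℕ.n≤1+n (n ℕ.+ d))))) ⟩
      r ^ℚ d ℚ.* E ^ℚ n ℚ.+ E ^ℚ n ℚ.* r ^ℚ d
        ≡⟨ solve 2 (λ x e → x :* e :+ e :* x := x :* (e :+ e)) refl (r ^ℚ d) (E ^ℚ n) ⟩
      r ^ℚ d ℚ.* (E ^ℚ n ℚ.+ E ^ℚ n)
        ≤⟨ ℚ.*-monoˡ-≤-nonNeg (r ^ℚ d) {{ℚ.nonNegative (0≤r^ d)}} (double n) ⟩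
      r ^ℚ d ℚ.* E ^ℚ suc n ∎
      where
      open ℚ.≤-Reasoning
      open Q using (solve; _:+_; _:*_; _:=_)

  ∥q^tri∥ : ∀ n → ∥ q^tri n ∥≤ r ^ℚ tri n
  ∥q^tri∥ n = ∥q^∥ (tri n)

  -- The exponent 3n+2 collects n+1 and n factors from the two shifted factorials in z, and n+1 from
  -- (q)_n / (q)_(2n+1).
  ∥lhsTerm∥ : ∀ n → ∥ lhsTerm n ∥≤ E ^ℚ (suc n ℕ.+ (n ℕ.+ suc n)) ℚ.* r ^ℚ tri n
  ∥lhsTerm∥ n = subst (∥_∥≤ E ^ℚ (suc n ℕ.+ (n ℕ.+ suc n)) ℚ.* r ^ℚ tri n) eq
    (∥∥-weaken (ℚ.≤-reflexive (trans (cong (ℚ._* r ^ℚ tri n) (ℚ.*-identityˡ (E ^ℚ suc n ℚ.* (E ^ℚ n ℚ.* E ^ℚ suc n))))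
      (cong (ℚ._* r ^ℚ tri n) (sym (trans (^ℚ-homo-* E (suc n) (n ℕ.+ suc n))
        (cong (E ^ℚ suc n ℚ.*_) (^ℚ-homo-* E n (suc n))))))))
      (∥⊗∥ (∥⊗∥ (∥sgn∥ n) (∥⊗∥ (∥poch∥ (∥⊖∥ ∥z⁻¹∥) (suc n))
        (∥⊗∥ (∥poch∥ (∥⊖∥ ∥z⊗q∥) n) (∥ratio∥ n (suc n))))) (∥q^tri∥ n)))
    where
    open G
    ∥z⊗q∥ : ∥ z ⊗ q ∥≤ Z
    ∥z⊗q∥ = ∥∥-weaken (p*q≤p 0≤Z r≤1) (∥⊗∥ ∥z∥ ∥q∥)
    eq : sgn n ⊗ (pochᵍ (⊖ z⁻¹) q (suc n) ⊗ (pochᵍ (⊖ (z ⊗ q)) q n ⊗ ratio n (suc n))) ⊗ q^tri n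
         ≡ lhsTerm n
    eq = trans
      (cong (λ m → sgn n ⊗ (pochᵍ (⊖ z⁻¹) q (suc n) ⊗ (pochᵍ (⊖ (z ⊗ q)) q n ⊗ (⟨q⟩ n ⊗ g m))) ⊗ q^tri n)
        (ℕ.+-suc n n))
      (solve 6 (λ s a b P γ t → s :* (a :* (b :* (P :* γ))) :* t := s :* (a :* (b :* P) :* γ) :* t) refl
        (sgn n) (pochᵍ (⊖ z⁻¹) q (suc n)) (pochᵍ (⊖ (z ⊗ q)) q n) (⟨q⟩ n) (g (suc (n ℕ.+ n))) (q^tri n))

  ∥lhs-error∥ : ∀ n d →
    ∥ weight n d ⊗ lhsTerm n ⊝ lhsTerm n ∥≤ r ^ℚ (n ℕ.+ d) ℚ.* κ ℚ.* r ^ℚ n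
  ∥lhs-error∥ n d = subst (∥_∥≤ r ^ℚ (n ℕ.+ d) ℚ.* κ ℚ.* r ^ℚ n)
    (G.solve 2 (λ w l → (w G.:- I) G.:* l G.:= w G.:* l G.:- l) refl (weight n d) (lhsTerm n))
    (∥∥-weaken
      (ℚ.≤-trans (ℚ.≤-reflexive
        (trans (solve 4 (λ a b c t → a :* b :* (c :* t) := a :* (b :* c) :* t) refl
                 (r ^ℚ d) (E ^ℚ n) (E ^ℚ (suc n ℕ.+ (n ℕ.+ suc n))) (r ^ℚ tri n))
          (cong (λ x → r ^ℚ d ℚ.* x ℚ.* r ^ℚ tri n) (sym (^ℚ-homo-* E n (suc n ℕ.+ (n ℕ.+ suc n)))))))
        (decay n d (subst (n ℕ.+ (suc n ℕ.+ (n ℕ.+ suc n)) ℕ.≤_) (count n) (ℕ.m≤m+n _ 2))))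
      (∥⊗∥ (∥weight-1∥ n d) (∥lhsTerm∥ n)))
    where
    open Q
    count : ∀ n → n ℕ.+ (suc n ℕ.+ (n ℕ.+ suc n)) ℕ.+ 2 ≡ 4 ℕ.* suc n
    count = ℕS.solve 1 (λ n → n ℕS.:+ ((ℕS.con 1 ℕS.:+ n) ℕS.:+ (n ℕS.:+ (ℕS.con 1 ℕS.:+ n))) ℕS.:+ ℕS.con 2
      ℕS.:= ℕS.con 4 ℕS.:* (ℕS.con 1 ℕS.:+ n)) refl
      where module ℕS = ℕSolver.+-*-Solver

  -- One of the two copies of q^tri(j) is bounded by 1; the other one suffices for `decay`.
  ∥sgn-q∥ : ∀ j → ∥ sgn j ⊗ (q^tri j ⊗ q^tri j) ∥≤ r ^ℚ tri j
  ∥sgn-q∥ j = ∥∥-weaken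
    (subst (ℚ._≤ r ^ℚ tri j) (sym (ℚ.*-identityˡ _))
      (p*q≤p (0≤r^ (tri j)) (^-≤1ℚ 0≤r r≤1 (tri j))))
    (∥⊗∥ (∥sgn∥ j) (∥⊗∥ (∥q^tri∥ j) (∥q^tri∥ j)))

  ∥zpair∥ : ∀ j → ∥ zpair j ∥≤ E ^ℚ suc (suc j)
  ∥zpair∥ j = ∥∥-weaken
    (ℚ.≤-trans
      (ℚ.+-mono-≤
        (ℚ.≤-trans (^-monoˡ-≤ 0≤Z Z≤E j) (^-monoʳ-≤ 1≤E (ℕ.n≤1+n j)))
        (^-monoˡ-≤ 0≤Z Z≤E (suc j)))
      (double (suc j)))
    (∥⊕∥ (∥^∥ ∥z∥ j) (∥^∥ ∥z⁻¹∥ (suc j)))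

  -- With w = (q)_N/(q)_(N-j) and h = (q)_N/(q)_(N+j+1), the error splits by w h - 1 = (w - 1) + w
  -- (h - 1).
  ∥rhs-error∥ : ∀ j d →
    ∥ weight j d ⊗ ratio (j ℕ.+ d) (suc j) ⊗ rhsTerm j ⊝ rhsTerm j ∥≤ r ^ℚ (j ℕ.+ d) ℚ.* κ ℚ.* r ^ℚ j
  ∥rhs-error∥ j d = subst (∥_∥≤ r ^ℚ (j ℕ.+ d) ℚ.* κ ℚ.* r ^ℚ j)
    (G.solve 3 (λ w h l → ((w G.:- I) G.:+ w G.:* (h G.:- I)) G.:* l G.:= w G.:* h G.:* l G.:- l) refl
      (weight j d) (ratio (j ℕ.+ d) (suc j)) (rhsTerm j))
    (∥∥-weaken
      (ℚ.≤-trans (ℚ.≤-reflexive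
        (trans (solve 4 (λ a b c t → a :* b :* (t :* c) := a :* (b :* c) :* t) refl
                 (r ^ℚ d) (E ^ℚ suc (j ℕ.+ suc j)) (E ^ℚ suc (suc j)) (r ^ℚ tri j))
          (cong (λ x → r ^ℚ d ℚ.* x ℚ.* r ^ℚ tri j)
            (sym (^ℚ-homo-* E (suc (j ℕ.+ suc j)) (suc (suc j)))))))
        (decay j d (subst (suc (j ℕ.+ suc j) ℕ.+ suc (suc j) ℕ.≤_) (count j) (ℕ.m≤m+n _ j))))
      (∥⊗∥ (∥∥-weaken le (∥⊕∥ (∥weight-1∥ j d) (∥⊗∥ (∥weight∥ j d) (∥ratio-1∥ (j ℕ.+ d) (suc j)))))
        (∥⊗∥ (∥sgn-q∥ j) (∥zpair∥ j))))
    where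
    open Q using (solve; _:+_; _:*_; _:=_)
    count : ∀ n → suc (n ℕ.+ suc n) ℕ.+ suc (suc n) ℕ.+ n ≡ 4 ℕ.* suc n
    count = ℕS.solve 1 (λ n → (ℕS.con 1 ℕS.:+ (n ℕS.:+ (ℕS.con 1 ℕS.:+ n))) ℕS.:+ (ℕS.con 2 ℕS.:+ n) ℕS.:+ n
      ℕS.:= ℕS.con 4 ℕS.:* (ℕS.con 1 ℕS.:+ n)) refl
      where module ℕS = ℕSolver.+-*-Solver
    le : r ^ℚ d ℚ.* E ^ℚ j ℚ.+ E ^ℚ j ℚ.* (r ^ℚ (j ℕ.+ d) ℚ.* E ^ℚ suc j) ℚ.≤
         r ^ℚ d ℚ.* E ^ℚ suc (j ℕ.+ suc j)
    le = begin
      r ^ℚ d ℚ.* E ^ℚ j ℚ.+ E ^ℚ j ℚ.* (r ^ℚ (j ℕ.+ d) ℚ.* E ^ℚ suc j)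
        ≤⟨ ℚ.+-mono-≤
             (ℚ.*-monoˡ-≤-nonNeg (r ^ℚ d) {{ℚ.nonNegative (0≤r^ d)}}
               (^-monoʳ-≤ 1≤E (ℕ.m≤m+n j (suc j))))
             (ℚ.*-monoˡ-≤-nonNeg (E ^ℚ j) {{ℚ.nonNegative (0≤E^ j)}}
               (ℚ.*-monoʳ-≤-nonNeg (E ^ℚ suc j) {{ℚ.nonNegative (0≤E^ (suc j))}}
                 (^-antimonoʳ-≤ 0≤r r≤1 (ℕ.m≤n+m d j)))) ⟩
      r ^ℚ d ℚ.* E ^ℚ (j ℕ.+ suc j) ℚ.+ E ^ℚ j ℚ.* (r ^ℚ d ℚ.* E ^ℚ suc j)
        ≡⟨ cong (r ^ℚ d ℚ.* E ^ℚ (j ℕ.+ suc j) ℚ.+_)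
             (trans (solve 3 (λ e x f → e :* (x :* f) := x :* (e :* f)) refl (E ^ℚ j) (r ^ℚ d) (E ^ℚ suc j))
               (cong (r ^ℚ d ℚ.*_) (sym (^ℚ-homo-* E j (suc j))))) ⟩
      r ^ℚ d ℚ.* E ^ℚ (j ℕ.+ suc j) ℚ.+ r ^ℚ d ℚ.* E ^ℚ (j ℕ.+ suc j)
        ≡⟨ ℚ.*-distribˡ-+ (r ^ℚ d) _ _ ⟨
      r ^ℚ d ℚ.* (E ^ℚ (j ℕ.+ suc j) ℚ.+ E ^ℚ (j ℕ.+ suc j))
        ≤⟨ ℚ.*-monoˡ-≤-nonNeg (r ^ℚ d) {{ℚ.nonNegative (0≤r^ d)}} (double (j ℕ.+ suc j)) ⟩
      r ^ℚ d ℚ.* E ^ℚ suc (j ℕ.+ suc j) ∎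
      where open ℚ.≤-Reasoning

  ∥lhs-rhs∥ : ∀ N → ∥ ∑ (suc N) lhsTerm ⊝ ∑ (suc N) rhsTerm ∥≤ (κ ℚ.* R ℚ.+ κ ℚ.* R) ℚ.* r ^ℚ N
  ∥lhs-rhs∥ N = subst (∥_∥≤ (κ ℚ.* R ℚ.+ κ ℚ.* R) ℚ.* r ^ℚ N) eq
    (∥∥-weaken (ℚ.≤-reflexive (solve 3 (λ x κ R → x :* κ :* R :+ x :* κ :* R := (κ :* R :+ κ :* R) :* x) refl
        (r ^ℚ N) κ R))
      (∥⊝∥ (∥∑∥ 0≤r 0≤R R*1-r (suc N) (*-nonneg (0≤r^ N) 0≤κ) rhs≤)
        (∥∑∥ 0≤r 0≤R R*1-r (suc N) (*-nonneg (0≤r^ N) 0≤κ) lhs≤)))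
    where
    open Q using (solve; _:+_; _:*_; _:=_)
    wl wr : ℕ → ℚ[i]
    wl n = ⟨q⟩ N ⊗ g- N n ⊗ lhsTerm n
    wr j = ⟨q⟩ N ⊗ g- N j ⊗ (⟨q⟩ N ⊗ g (N ℕ.+ suc j)) ⊗ rhsTerm j
    lhs≤ : ∀ {n} → n ℕ.< suc N → ∥ wl n ⊝ lhsTerm n ∥≤ r ^ℚ N ℚ.* κ ℚ.* r ^ℚ n
    lhs≤ {n} n<1+N with ℕ.m≤n⇒∃[o]m+o≡n (ℕ.s≤s⁻¹ n<1+N)
    ... | d , refl = subst (λ x → ∥ ⟨q⟩ N ⊗ x ⊗ lhsTerm n ⊝ lhsTerm n ∥≤ r ^ℚ N ℚ.* κ ℚ.* r ^ℚ n)
      (sym (g-+ n d)) (∥lhs-error∥ n d)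
    rhs≤ : ∀ {j} → j ℕ.< suc N → ∥ wr j ⊝ rhsTerm j ∥≤ r ^ℚ N ℚ.* κ ℚ.* r ^ℚ j
    rhs≤ {j} j<1+N with ℕ.m≤n⇒∃[o]m+o≡n (ℕ.s≤s⁻¹ j<1+N)
    ... | d , refl = subst
      (λ x → ∥ ⟨q⟩ N ⊗ x ⊗ ratio N (suc j) ⊗ rhsTerm j ⊝ rhsTerm j ∥≤ r ^ℚ N ℚ.* κ ℚ.* r ^ℚ j)
      (sym (g-+ j d)) (∥rhs-error∥ j d)
    -- The weighted sums agree by `finite-identity` and cancel, so only the two errors remain.
    eq : ∑ (suc N) (λ j → wr j ⊝ rhsTerm j) ⊝ ∑ (suc N) (λ n → wl n ⊝ lhsTerm n)
         ≡ ∑ (suc N) lhsTerm ⊝ ∑ (suc N) rhsTerm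
    eq = begin
      ∑ (suc N) (λ j → wr j ⊝ rhsTerm j) ⊝ ∑ (suc N) (λ n → wl n ⊝ lhsTerm n)
        ≡⟨ cong₂ _⊝_ (∑-⊝ (suc N) wr rhsTerm) (∑-⊝ (suc N) wl lhsTerm) ⟩
      (∑ (suc N) wr ⊝ ∑ (suc N) rhsTerm) ⊝ (∑ (suc N) wl ⊝ ∑ (suc N) lhsTerm)
        ≡⟨ cong (λ x → (∑ (suc N) wr ⊝ ∑ (suc N) rhsTerm) ⊝ (x ⊝ ∑ (suc N) lhsTerm)) (finite-identity N) ⟩
      (∑ (suc N) wr ⊝ ∑ (suc N) rhsTerm) ⊝ (∑ (suc N) wr ⊝ ∑ (suc N) lhsTerm)
        ≡⟨ G.solve 3 (λ a b c → (a G.:- b) G.:- (a G.:- c) G.:= c G.:- b) refl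
             (∑ (suc N) wr) (∑ (suc N) rhsTerm) (∑ (suc N) lhsTerm) ⟩
      ∑ (suc N) lhsTerm ⊝ ∑ (suc N) rhsTerm ∎
      where open ≡-Reasoning

  -- `rhs⁻Term j` is the summand at index -1-j: its exponent is (-1-j)(-j) = j(j+1), and its minus
  -- sign comes from (-1)^(-1-j) = -(-1)^j.
  rhs⁺Term rhs⁻Term : ℕ → ℚ[i]
  rhs⁺Term j = sgn j ⊗ (q^tri j ⊗ q^tri j) ⊗ z ^ᵍ j
  rhs⁻Term j = ⊖ (sgn j ⊗ (q^tri j ⊗ q^tri j) ⊗ z⁻¹ ^ᵍ suc j)

  ∑rhsTerm : ∀ N → ∑ N rhsTerm ≡ ∑ N rhs⁺Term ⊝ ∑ N rhs⁻Term
  ∑rhsTerm N = trans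
    (∑-cong N (λ {j} _ → solve 3 (λ a x y → a :* (x :+ y) := a :* x :- (:- (a :* y))) refl
      (sgn j ⊗ (q^tri j ⊗ q^tri j)) (z ^ᵍ j) (z⁻¹ ^ᵍ suc j)))
    (∑-⊝ N rhs⁺Term rhs⁻Term)
    where open G

  rhs-decay : ∀ {w} j {m} → ∥ w ∥≤ Z → m ℕ.≤ suc j →
    ∥ sgn j ⊗ (q^tri j ⊗ q^tri j) ⊗ w ^ᵍ m ∥≤ κ ℚ.* r ^ℚ j
  rhs-decay j {m} ∥w∥ m≤1+j = ∥∥-weaken le (∥⊗∥ (∥sgn-q∥ j) (∥^∥ ∥w∥ m))
    where
    open ℚ.≤-Reasoning
    X = E ^ℚ (4 ℕ.* suc j)
    le : r ^ℚ tri j ℚ.* Z ^ℚ m ℚ.≤ κ ℚ.* r ^ℚ j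
    le = begin
      r ^ℚ tri j ℚ.* Z ^ℚ m
        ≤⟨ ℚ.*-monoˡ-≤-nonNeg (r ^ℚ tri j) {{ℚ.nonNegative (0≤r^ (tri j))}}
             (ℚ.≤-trans (^-monoˡ-≤ 0≤Z Z≤E m) (^-monoʳ-≤ 1≤E (ℕ.≤-trans m≤1+j (ℕ.m≤m+n (suc j) _)))) ⟩
      r ^ℚ tri j ℚ.* X
        ≡⟨ trans (ℚ.*-comm (r ^ℚ tri j) X) (cong (ℚ._* r ^ℚ tri j) (sym (ℚ.*-identityʳ X))) ⟩
      X ℚ.* 1ℚ ℚ.* r ^ℚ tri j
        ≤⟨ ℚ.*-monoʳ-≤-nonNeg (r ^ℚ tri j) {{ℚ.nonNegative (0≤r^ (tri j))}}
             (ℚ.*-monoˡ-≤-nonNeg X {{ℚ.nonNegative (0≤E^ (4 ℕ.* suc j))}} (^-≥1 1≤r⁻¹ j)) ⟩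
      X ℚ.* r⁻¹ ^ℚ j ℚ.* r ^ℚ tri j
        ≤⟨ E-decay j ⟩
      κ ℚ.* r ^ℚ j ∎

  ∥rhs⁺Term∥ : ∀ j → ∥ rhs⁺Term j ∥≤ κ ℚ.* r ^ℚ j
  ∥rhs⁺Term∥ j = rhs-decay j ∥z∥ (ℕ.n≤1+n j)

  ∥rhs⁻Term∥ : ∀ j → ∥ rhs⁻Term j ∥≤ κ ℚ.* r ^ℚ j
  ∥rhs⁻Term∥ j = ∥⊖∥ (rhs-decay j ∥z⁻¹∥ ℕ.≤-refl)

-- Passage to the limit

-- Evaluation at one index commutes with the ring operations by computation, so identities and
-- bounds over ℚ[i] apply directly to the entries of complex numbers.
at : ℂ → ℕ → ℚ[i]
at w k = seq (re w) k ,i seq (im w) k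

at-^ : ∀ w n k → at (w ^ n) k ≡ at w k ^ᵍ n
at-^ w zero    k = refl
at-^ w (suc n) k = cong (at w k ⊗_) (at-^ w n k)

at-poch : ∀ a q n k → at (poch a q n) k ≡ pochᵍ (at a k) (at q k) n
at-poch a q zero    k = refl
at-poch a q (suc n) k =
  cong₂ (λ x y → x ⊗ (𝟙 ⊝ at a k ⊗ y)) (at-poch a q n k) (at-^ q n k)

at-∑ : ∀ N f k → at (∑< N f) k ≡ ∑ N (λ n → at (f n) k)
at-∑ zero    f k = refl
at-∑ (suc N) f k = cong (_⊕ at (f N) k) (at-∑ N f k)

-- Built on the same `recip` as `inv`, default value included, so that `at-inv` holds by computation
-- at every index.
invᵍ : ℚ[i] → ℚ[i]
invᵍ (a ,i b) = (a ℚ.* ρ) ,i (ℚ.- b ℚ.* ρ)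
  where ρ = recip (a ℚ.* a ℚ.+ b ℚ.* b)

at-inv : ∀ w w≄0 k → at (inv w w≄0) k ≡ invᵍ (at w k)
at-inv w w≄0 k = refl

⊗-invᵍ : ∀ {w} → 0ℚ ℚ.< nsqᵍ w → w ⊗ invᵍ w ≡ 𝟙
⊗-invᵍ {a ,i b} 0<w = cong₂ _,i_
  (trans (solve 3 (λ a b ρ → a :* (a :* ρ) :- b :* ((:- b) :* ρ) := (a :* a :+ b :* b) :* ρ) refl a b _)
    (*-recip 0<w))
  (solve 3 (λ a b ρ → a :* ((:- b) :* ρ) :+ b :* (a :* ρ) := con 0ℚ) refl a b _)
  where open Q

∣∣-≤ : ∀ {a r} → 0ℚ ℚ.≤ r → a ℚ.* a ℚ.≤ r ℚ.* r → ℚ.∣ a ∣ ℚ.≤ r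
∣∣-≤ {a} {r} 0≤r h = square-cancel-≤ 0≤r (subst (ℚ._≤ r ℚ.* r)
  (trans (sym (ℚ.0≤p⇒∣p∣≡p (square-nonneg a))) (ℚ.∣p*q∣≡∣p∣*∣q∣ a a)) h)

∥∥⇒∣re∣ : ∀ {a b r} → ∥ a ,i b ∥≤ r → ℚ.∣ a ∣ ℚ.≤ r
∥∥⇒∣re∣ {a} {b} (bound 0≤r h) = ∣∣-≤ {a} 0≤r (ℚ.≤-trans (p≤p+q (square-nonneg b)) h)

∥∥⇒∣im∣ : ∀ {a b r} → ∥ a ,i b ∥≤ r → ℚ.∣ b ∣ ℚ.≤ r
∥∥⇒∣im∣ {a} {b} {r} (bound 0≤r h) = ∣∣-≤ {b} 0≤r
  (ℚ.≤-trans (q≤p+q (square-nonneg a)) h)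

square-≤ : ∀ {a r} → ℚ.∣ a ∣ ℚ.≤ r → a ℚ.* a ℚ.≤ r ℚ.* r
square-≤ {a} {r} h = subst (ℚ._≤ r ℚ.* r)
  (trans (sym (ℚ.∣p*q∣≡∣p∣*∣q∣ a a)) (ℚ.0≤p⇒∣p∣≡p (square-nonneg a)))
  (*-mono (ℚ.0≤∣p∣ a) (ℚ.0≤∣p∣ a) h h)

∥,i∥ : ∀ {a b A B} → 0ℚ ℚ.≤ A → 0ℚ ℚ.≤ B → ℚ.∣ a ∣ ℚ.≤ A → ℚ.∣ b ∣ ℚ.≤ B → ∥ a ,i b ∥≤ A ℚ.+ B
∥,i∥ {a} {b} {A} {B} 0≤A 0≤B ∣a∣≤A ∣b∣≤B = bound (+-nonneg 0≤A 0≤B) (begin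
  a ℚ.* a ℚ.+ b ℚ.* b
    ≤⟨ ℚ.+-mono-≤ (square-≤ {a} ∣a∣≤A) (square-≤ {b} ∣b∣≤B) ⟩
  A ℚ.* A ℚ.+ B ℚ.* B
    ≤⟨ p≤p+q 0≤2AB ⟩
  A ℚ.* A ℚ.+ B ℚ.* B ℚ.+ (A ℚ.* B ℚ.+ A ℚ.* B)
    ≡⟨ solve 2 (λ A B → A :* A :+ B :* B :+ (A :* B :+ A :* B) := (A :+ B) :* (A :+ B)) refl A B ⟩
  (A ℚ.+ B) ℚ.* (A ℚ.+ B) ∎)
  where
  open ℚ.≤-Reasoning
  open Q using (solve; _:+_; _:*_; _:=_)
  0≤AB : 0ℚ ℚ.≤ A ℚ.* B
  0≤AB = *-nonneg 0≤A 0≤B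
  0≤2AB : 0ℚ ℚ.≤ A ℚ.* B ℚ.+ A ℚ.* B
  0≤2AB = +-nonneg 0≤AB 0≤AB

eventually-bounded : ∀ w → ∃[ B ] (0ℚ ℚ.≤ B × ∃[ N ] (∀ k → N ℕ.≤ k → ∥ at w k ∥≤ B))
eventually-bounded w = combine (bounded {seq (re w)} (cauchy (re w))) (bounded {seq (im w)} (cauchy (im w)))
  where
  EventuallyBounded : (ℕ → ℚ) → Set
  EventuallyBounded x = ∃[ B ] (0ℚ ℚ.< B × ∃[ N ] (∀ n → N ℕ.≤ n → ℚ.∣ x n ∣ ℚ.≤ B))
  combine : EventuallyBounded (seq (re w)) → EventuallyBounded (seq (im w)) →
            ∃[ B ] (0ℚ ℚ.≤ B × ∃[ N ] (∀ k → N ℕ.≤ k → ∥ at w k ∥≤ B))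
  combine (A , 0<A , M , hA) (B , 0<B , N , hB) =
    A ℚ.+ B , +-nonneg (ℚ.<⇒≤ 0<A) (ℚ.<⇒≤ 0<B) , M ℕ.⊔ N , λ k k≥ →
    ∥,i∥ (ℚ.<⇒≤ 0<A) (ℚ.<⇒≤ 0<B)
      (hA k (ℕ.≤-trans (ℕ.m≤m⊔n M N) k≥)) (hB k (ℕ.≤-trans (ℕ.m≤n⊔m M N) k≥))

-- Sums of series along the diagonal

twice-square-≤ : ∀ η → η ℚ.* η ℚ.+ η ℚ.* η ℚ.≤ (η ℚ.+ η) ℚ.* (η ℚ.+ η)
twice-square-≤ η = subst (η ℚ.* η ℚ.+ η ℚ.* η ℚ.≤_)
  (solve 1 (λ η → η :* η :+ η :* η :+ (η :* η :+ η :* η) := (η :+ η) :* (η :+ η)) refl η)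
  (p≤p+q 0≤2η²)
  where
  open Q
  0≤2η² : 0ℚ ℚ.≤ η ℚ.* η ℚ.+ η ℚ.* η
  0≤2η² = +-nonneg (square-nonneg η) (square-nonneg η)

-- The bound is asked only for n ≤ k, because entry k of a diagonal limit comes from the partial sum
-- of length k. A fixed n still sees all late k.
hasSum : ∀ {f S r K k₀} → 0ℚ ℚ.≤ r → r ℚ.< 1ℚ → 0ℚ ℚ.≤ K →
  (∀ {n k} → n ℕ.≤ k → k₀ ℕ.≤ k → ∥ at (∑< n f) k ⊝ at S k ∥≤ K ℚ.* r ^ℚ n) → HasSum f S
hasSum {f} {S} {r} {K} {k₀} 0≤r r<1 0≤K close ε 0<ε =
  combine (½ ℚ.* ε) (*-pos 0<½ 0<ε) (halves ε) (geometric→0 0≤r r<1 K 0≤K (*-pos 0<½ 0<ε))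
  where
  combine : ∀ η → 0ℚ ℚ.< η → η ℚ.+ η ≡ ε → ∃[ N ] (∀ n → N ℕ.≤ n → K ℚ.* r ^ℚ n ℚ.≤ η) →
    ∃[ N ] (∀ n → N ℕ.≤ n → ∣ ∑< n f - S ∣< ε)
  -- The strict inequality with ε = 2η is witnessed by the gap η², since η² + η² ≤ (2η)².
  combine η 0<η refl (N , small) = N , λ n n≥N → η ℚ.* η , *-pos 0<η 0<η , n ℕ.⊔ k₀ , λ k k≥ →
    ℚ.≤-trans
      (ℚ.+-monoˡ-≤ (η ℚ.* η) (∥_∥≤_.nsq≤ (∥∥-weaken (small n n≥N)
        (close (ℕ.≤-trans (ℕ.m≤m⊔n n k₀) k≥) (ℕ.≤-trans (ℕ.m≤n⊔m n k₀) k≥)))))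
      (twice-square-≤ η)

-- Both diagonal entries are compared with one fixed sequence `x m`; the three errors are ε/4, ε/2
-- and ε/4.
diagonal-cauchy : (x : ℕ → ℝ) →
  (∀ η → 0ℚ ℚ.< η → ∃[ m ] ∃[ M ] (∀ k → M ℕ.≤ k → ℚ.∣ seq (x k) k ℚ.- seq (x m) k ∣ ℚ.≤ η)) →
  Cauchy (λ k → seq (x k) k)
diagonal-cauchy x close ε 0<ε with close (½ ℚ.* (½ ℚ.* ε)) (*-pos 0<½ (*-pos 0<½ 0<ε))
... | m , M , near with cauchy (x m) (½ ℚ.* ε) (*-pos 0<½ 0<ε)
... | M′ , near′ = M ℕ.⊔ M′ , λ k l k≥ l≥ →
  let a = seq (x k) k ; b = seq (x m) k ; c = seq (x m) l ; d = seq (x l) l in begin-strict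
  ℚ.∣ a ℚ.- d ∣
    ≡⟨ cong ℚ.∣_∣ (solve 4 (λ a b c d → a :- d := (a :- b) :+ ((b :- c) :+ (:- (d :- c)))) refl a b c d) ⟩
  ℚ.∣ (a ℚ.- b) ℚ.+ ((b ℚ.- c) ℚ.+ (ℚ.- (d ℚ.- c))) ∣
    ≤⟨ ℚ.≤-trans (ℚ.∣p+q∣≤∣p∣+∣q∣ (a ℚ.- b) _)
         (ℚ.+-monoʳ-≤ ℚ.∣ a ℚ.- b ∣ (ℚ.∣p+q∣≤∣p∣+∣q∣ (b ℚ.- c) (ℚ.- (d ℚ.- c)))) ⟩
  ℚ.∣ a ℚ.- b ∣ ℚ.+ (ℚ.∣ b ℚ.- c ∣ ℚ.+ ℚ.∣ ℚ.- (d ℚ.- c) ∣)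
    <⟨ ℚ.+-mono-≤-< (near k (ℕ.≤-trans (ℕ.m≤m⊔n M M′) k≥))
         (ℚ.+-mono-<-≤
           (near′ k l (ℕ.≤-trans (ℕ.m≤n⊔m M M′) k≥) (ℕ.≤-trans (ℕ.m≤n⊔m M M′) l≥))
           (subst (ℚ._≤ η) (sym (ℚ.∣-p∣≡∣p∣ (d ℚ.- c))) (near l (ℕ.≤-trans (ℕ.m≤m⊔n M M′) l≥)))) ⟩
  η ℚ.+ (½ ℚ.* ε ℚ.+ η)
    ≡⟨ solve 1 (λ ε → con ½ :* (con ½ :* ε) :+ (con ½ :* ε :+ con ½ :* (con ½ :* ε)) := ε) refl ε ⟩
  ε ∎
  where
  open ℚ.≤-Reasoning
  open Q using (solve; _:+_; _:*_; _:-_; :-_; _:=_; con)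
  η = ½ ℚ.* (½ ℚ.* ε)

module GeometricSeries {r R κ : ℚ} (0≤r : 0ℚ ℚ.≤ r) (r<1 : r ℚ.< 1ℚ) (0≤R : 0ℚ ℚ.≤ R)
  (R*1-r : R ℚ.* (1ℚ ℚ.- r) ≡ 1ℚ) (0≤κ : 0ℚ ℚ.≤ κ)
  (f : ℕ → ℂ) (k₀ : ℕ) (f≤ : ∀ n {k} → k₀ ℕ.≤ k → ∥ at (f n) k ∥≤ κ ℚ.* r ^ℚ n) where

  0≤κR : 0ℚ ℚ.≤ κ ℚ.* R
  0≤κR = *-nonneg 0≤κ 0≤R

  partial-sums-close : ∀ {m n k} → m ℕ.≤ n → k₀ ℕ.≤ k →
    ∥ at (∑< n f) k ⊝ at (∑< m f) k ∥≤ κ ℚ.* R ℚ.* r ^ℚ m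
  partial-sums-close {m} {n} {k} m≤n k≥ = subst (∥_∥≤ κ ℚ.* R ℚ.* r ^ℚ m)
    (cong₂ _⊝_ (sym (at-∑ n f k)) (sym (at-∑ m f k)))
    (∥∑-tail∥ 0≤r 0≤R R*1-r {κ} {λ i → at (f i) k} 0≤κ (λ i → f≤ i k≥) m≤n)

  diagonal-close : ∀ η → 0ℚ ℚ.< η →
    ∃[ m ] ∃[ M ] (∀ k → M ℕ.≤ k → ∥ at (∑< k f) k ⊝ at (∑< m f) k ∥≤ η)
  diagonal-close η 0<η = settle (geometric→0 0≤r r<1 (κ ℚ.* R) 0≤κR 0<η)
    where
    settle : ∃[ N ] (∀ n → N ℕ.≤ n → κ ℚ.* R ℚ.* r ^ℚ n ℚ.≤ η) →
      ∃[ m ] ∃[ M ] (∀ k → M ℕ.≤ k → ∥ at (∑< k f) k ⊝ at (∑< m f) k ∥≤ η)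
    settle (m , small) = m , m ℕ.⊔ k₀ , λ k k≥ → ∥∥-weaken (small m ℕ.≤-refl)
      (partial-sums-close (ℕ.≤-trans (ℕ.m≤m⊔n m k₀) k≥) (ℕ.≤-trans (ℕ.m≤n⊔m m k₀) k≥))

  seriesSum : ℂ
  seriesSum =
    real (λ k → seq (re (∑< k f)) k) (diagonal-cauchy (λ n → re (∑< n f)) λ η 0<η →
      let m , M , h = diagonal-close η 0<η in m , M , λ k k≥ → ∥∥⇒∣re∣ (h k k≥))
    +i
    real (λ k → seq (im (∑< k f)) k) (diagonal-cauchy (λ n → im (∑< n f)) λ η 0<η →
      let m , M , h = diagonal-close η 0<η in m , M , λ k k≥ → ∥∥⇒∣im∣ (h k k≥))

  at-seriesSum : ∀ k → at seriesSum k ≡ at (∑< k f) k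
  at-seriesSum k = refl

  seriesSum-close : ∀ {n k} → n ℕ.≤ k → k₀ ℕ.≤ k →
    ∥ at (∑< n f) k ⊝ at seriesSum k ∥≤ κ ℚ.* R ℚ.* r ^ℚ n
  seriesSum-close {n} {k} n≤k k≥ = subst (∥_∥≤ κ ℚ.* R ℚ.* r ^ℚ n)
    (trans (⊖-⊝ (at (∑< k f) k) (at (∑< n f) k)) (cong (at (∑< n f) k ⊝_) (sym (at-seriesSum k))))
    (∥⊖∥ (partial-sums-close n≤k k≥))
    where
    ⊖-⊝ : ∀ a b → ⊖ (a ⊝ b) ≡ b ⊝ a
    ⊖-⊝ = solve 2 (λ a b → :- (a :- b) := b :- a) refl
      where open G

  seriesSum-hasSum : HasSum f seriesSum
  seriesSum-hasSum = hasSum {f} {seriesSum} {k₀ = k₀} 0≤r r<1 0≤κR seriesSum-close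

-- From |q|² + ε ≤ 1 the root-free choice r = 1 - ε/2 works, because (1 - ε/2)² ≥ 1 - ε. It is
-- positive even for q = 0, so that `r⁻¹` makes sense.
eventually-contracting : ∀ {q} → ∣ q ∣< 1ℚ →
  ∃[ r ] (0ℚ ℚ.< r × r ℚ.< 1ℚ × ∃[ N ] (∀ k → N ℕ.≤ k → ∥ at q k ∥≤ r))
eventually-contracting {q} (ε , 0<ε , N , h) =
  1ℚ ℚ.- t , 0<1-t , ℚ.+-monoʳ-< 1ℚ (ℚ.neg-antimono-< 0<t) , N , λ k k≥ →
  bound (ℚ.<⇒≤ 0<1-t) (n≤[1-t]² (nsqᵍ (at q k)) t
    (subst (λ e → nsqᵍ (at q k) ℚ.+ e ℚ.≤ 1ℚ) (sym (halves ε)) (h k k≥)))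
  where
  t = ½ ℚ.* ε
  0<t : 0ℚ ℚ.< t
  0<t = *-pos 0<½ 0<ε
  n≤[1-t]² : ∀ n t → n ℚ.+ (t ℚ.+ t) ℚ.≤ 1ℚ → n ℚ.≤ (1ℚ ℚ.- t) ℚ.* (1ℚ ℚ.- t)
  n≤[1-t]² n t h = 0≤q-p⇒p≤q (subst (0ℚ ℚ.≤_)
    (solve 2 (λ n t → (con 1ℚ :- (n :+ (t :+ t))) :+ t :* t := (con 1ℚ :- t) :* (con 1ℚ :- t) :- n) refl n t)
    (+-nonneg (p≤q⇒0≤q-p h) (square-nonneg t)))
    where open Q
  ε≤1 : ε ℚ.≤ 1ℚ
  ε≤1 = ℚ.≤-trans (q≤p+q (nsqᵍ-nonneg (at q N))) (h N ℕ.≤-refl)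
  t<1 : t ℚ.< 1ℚ
  t<1 = ℚ.≤-<-trans (ℚ.*-monoˡ-≤-nonNeg ½ ε≤1) (toWitness {a? = ½ ℚ.<? 1ℚ} tt)
  0<1-t : 0ℚ ℚ.< 1ℚ ℚ.- t
  0<1-t = p<1⇒0<1-p t<1

-- Choice of the constants

module MakeConstants {r Z : ℚ} (0<r : 0ℚ ℚ.< r) (r<1 : r ℚ.< 1ℚ) (1≤Z : 1ℚ ℚ.≤ Z) where

  R r⁻¹ E D : ℚ
  R = recip (1ℚ ℚ.- r)
  r⁻¹ = recip r
  E = 1ℚ ℚ.+ (Z ℚ.+ R)
  -- `D` is the growth per step of E^(4(n+1)) r⁻¹^n; the remaining E^4 goes into the constant `κ`.
  D = E ^ℚ 4 ℚ.* r⁻¹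

  0<1-r : 0ℚ ℚ.< 1ℚ ℚ.- r
  0<1-r = p<1⇒0<1-p r<1

  0≤R : 0ℚ ℚ.≤ R
  0≤R = ℚ.<⇒≤ (recip-pos 0<1-r)

  0≤r⁻¹ : 0ℚ ℚ.≤ r⁻¹
  0≤r⁻¹ = ℚ.<⇒≤ (recip-pos 0<r)

  r⁻¹*r : r⁻¹ ℚ.* r ≡ 1ℚ
  r⁻¹*r = trans (ℚ.*-comm r⁻¹ r) (*-recip 0<r)

  0≤Z : 0ℚ ℚ.≤ Z
  0≤Z = ℚ.≤-trans 0≤1 1≤Z

  0≤E : 0ℚ ℚ.≤ E
  0≤E = +-nonneg 0≤1 (+-nonneg 0≤Z 0≤R)

  0≤D : 0ℚ ℚ.≤ D
  0≤D = *-nonneg (^-nonneg 0≤E 4) 0≤r⁻¹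

  D-decay : ∃[ κ ] (0ℚ ℚ.≤ κ × (∀ n → D ^ℚ n ℚ.* r ^ℚ tri n ℚ.≤ κ ℚ.* r ^ℚ n))
  D-decay = decay (geometric→0 (ℚ.<⇒≤ 0<r) r<1 D 0≤D 0<1)
    where
    decay : ∃[ M ] (∀ n → M ℕ.≤ n → D ℚ.* r ^ℚ n ℚ.≤ 1ℚ) →
      ∃[ κ ] (0ℚ ℚ.≤ κ × (∀ n → D ^ℚ n ℚ.* r ^ℚ tri n ℚ.≤ κ ℚ.* r ^ℚ n))
    decay (M , small) =
      superexponential-decay (ℚ.<⇒≤ 0<r) (ℚ.<⇒≤ r<1) M 0≤D (small M ℕ.≤-refl)

  E-decay : ∀ {κ} n → D ^ℚ n ℚ.* r ^ℚ tri n ℚ.≤ κ ℚ.* r ^ℚ n →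
    E ^ℚ (4 ℕ.* suc n) ℚ.* r⁻¹ ^ℚ n ℚ.* r ^ℚ tri n ℚ.≤ E ^ℚ 4 ℚ.* κ ℚ.* r ^ℚ n
  E-decay {κ} n h = begin
    E ^ℚ (4 ℕ.* suc n) ℚ.* r⁻¹ ^ℚ n ℚ.* r ^ℚ tri n
      ≡⟨ cong (λ x → x ℚ.* r⁻¹ ^ℚ n ℚ.* r ^ℚ tri n) (sym (^ℚ-assocʳ E 4 (suc n))) ⟩
    E ^ℚ 4 ℚ.* (E ^ℚ 4) ^ℚ n ℚ.* r⁻¹ ^ℚ n ℚ.* r ^ℚ tri n
      ≡⟨ solve 4 (λ a b c d → a :* b :* c :* d := a :* (b :* c :* d)) refl
           (E ^ℚ 4) ((E ^ℚ 4) ^ℚ n) (r⁻¹ ^ℚ n) (r ^ℚ tri n) ⟩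
    E ^ℚ 4 ℚ.* ((E ^ℚ 4) ^ℚ n ℚ.* r⁻¹ ^ℚ n ℚ.* r ^ℚ tri n)
      ≡⟨ cong (λ x → E ^ℚ 4 ℚ.* (x ℚ.* r ^ℚ tri n)) (sym (^ℚ-distrib-* (E ^ℚ 4) r⁻¹ n)) ⟩
    E ^ℚ 4 ℚ.* (D ^ℚ n ℚ.* r ^ℚ tri n)
      ≤⟨ ℚ.*-monoˡ-≤-nonNeg (E ^ℚ 4) {{ℚ.nonNegative (^-nonneg 0≤E 4)}} h ⟩
    E ^ℚ 4 ℚ.* (κ ℚ.* r ^ℚ n)
      ≡⟨ ℚ.*-assoc (E ^ℚ 4) κ (r ^ℚ n) ⟨
    E ^ℚ 4 ℚ.* κ ℚ.* r ^ℚ n ∎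
    where
    open ℚ.≤-Reasoning
    open Q using (solve; _:*_; _:=_)

  constants : Constants
  constants = record
    { r = r ; r⁻¹ = r⁻¹ ; R = R ; Z = Z ; E = E ; κ = E ^ℚ 4 ℚ.* proj₁ D-decay
    ; 0≤r     = ℚ.<⇒≤ 0<r
    ; r<1     = r<1
    ; r⁻¹*r   = r⁻¹*r
    ; 1≤r⁻¹   = subst (ℚ._≤ r⁻¹) r⁻¹*r (p*q≤p 0≤r⁻¹ (ℚ.<⇒≤ r<1))
    ; 0≤R     = 0≤R
    ; R*1-r   = trans (ℚ.*-comm R (1ℚ ℚ.- r)) (*-recip 0<1-r)
    ; 1≤Z     = 1≤Z
    ; 1+Z≤E   = ℚ.+-monoʳ-≤ 1ℚ (p≤p+q {Z} {R} 0≤R)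
    ; 1+R≤E   = ℚ.+-monoʳ-≤ 1ℚ (q≤p+q {Z} {R} 0≤Z)
    ; 0≤κ     = *-nonneg (^-nonneg 0≤E 4) (proj₁ (proj₂ D-decay))
    ; E-decay = λ n → E-decay n (proj₂ (proj₂ D-decay) n)
    }

-- The exponents as triangular numbers

[1+n]C2≡tri : ∀ n → suc n C 2 ≡ tri n
[1+n]C2≡tri zero    = refl
[1+n]C2≡tri (suc n) = trans (sym (nCk+nC[k+1]≡[n+1]C[k+1] (suc n) 1))
  (cong₂ ℕ._+_ (nC1≡n (suc n)) ([1+n]C2≡tri n))

n[n+1]≡tri+tri : ∀ n → n ℕ.* (n ℕ.+ 1) ≡ tri n ℕ.+ tri n
n[n+1]≡tri+tri zero    = refl
n[n+1]≡tri+tri (suc n) = begin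
  suc n ℕ.* (suc n ℕ.+ 1)
    ≡⟨ solve 1 (λ n → (con 1 :+ n) :* (con 1 :+ n :+ con 1) := n :* (n :+ con 1) :+ (con 2 :+ (n :+ n))) refl n ⟩
  n ℕ.* (n ℕ.+ 1) ℕ.+ (2 ℕ.+ (n ℕ.+ n))
    ≡⟨ cong (ℕ._+ (2 ℕ.+ (n ℕ.+ n))) (n[n+1]≡tri+tri n) ⟩
  tri n ℕ.+ tri n ℕ.+ (2 ℕ.+ (n ℕ.+ n))
    ≡⟨ solve 2 (λ n t → t :+ t :+ (con 2 :+ (n :+ n)) := con 1 :+ n :+ t :+ (con 1 :+ n :+ t)) refl n (tri n) ⟩
  suc n ℕ.+ tri n ℕ.+ (suc n ℕ.+ tri n) ∎
  where
  open ≡-Reasoning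
  open ℕSolver.+-*-Solver

∣n[n+1]∣⁺ : ∀ j → ℤ.∣ + j ℤ.* (+ j ℤ.+ + 1) ∣ ≡ tri j ℕ.+ tri j
∣n[n+1]∣⁺ j = trans (ℤ.abs-* (+ j) (+ j ℤ.+ + 1)) (n[n+1]≡tri+tri j)

∣n[n+1]∣⁻ : ∀ m → ℤ.∣ -[1+ m ] ℤ.* (-[1+ m ] ℤ.+ + 1) ∣ ≡ tri m ℕ.+ tri m
∣n[n+1]∣⁻ m = begin
  ℤ.∣ -[1+ m ] ℤ.* (-[1+ m ] ℤ.+ + 1) ∣
    ≡⟨ ℤ.abs-* -[1+ m ] (-[1+ m ] ℤ.+ + 1) ⟩
  suc m ℕ.* ℤ.∣ -[1+ m ] ℤ.+ + 1 ∣
    ≡⟨ cong (suc m ℕ.*_) (∣-[1+m]+1∣ m) ⟩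
  suc m ℕ.* m
    ≡⟨ trans (ℕ.*-comm (suc m) m) (cong (m ℕ.*_) (ℕ.+-comm 1 m)) ⟩
  m ℕ.* (m ℕ.+ 1)
    ≡⟨ n[n+1]≡tri+tri m ⟩
  tri m ℕ.+ tri m ∎
  where
  open ≡-Reasoning
  ∣-[1+m]+1∣ : ∀ m → ℤ.∣ -[1+ m ] ℤ.+ + 1 ∣ ≡ m
  ∣-[1+m]+1∣ zero    = refl
  ∣-[1+m]+1∣ (suc m) = refl

-- Makes the reciprocals of (q;q)ₙ at a late index genuine ones: every factor has absolute value at
-- least 1 - r.
nsqᵍ-poch-pos : ∀ {q r} → ∥ q ∥≤ r → r ℚ.< 1ℚ → ∀ n → 0ℚ ℚ.< nsqᵍ (pochᵍ q q n)
nsqᵍ-poch-pos ∥q∥ r<1 zero = 0<1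
nsqᵍ-poch-pos {q} {r} ∥q∥@(bound 0≤r _) r<1 (suc n) =
  subst (0ℚ ℚ.<_) (sym (nsqᵍ-⊗ (pochᵍ q q n) (𝟙 ⊝ q ⊗ q ^ᵍ n)))
    (*-pos (nsqᵍ-poch-pos ∥q∥ r<1 n)
      (ℚ.<-≤-trans (*-pos 0<1-r 0<1-r) (nsqᵍ-1-x ∥q^1+n∥ (ℚ.<⇒≤ r<1))))
  where
  0<1-r : 0ℚ ℚ.< 1ℚ ℚ.- r
  0<1-r = p<1⇒0<1-p r<1
  ∥q^1+n∥ : ∥ q ⊗ q ^ᵍ n ∥≤ r
  ∥q^1+n∥ = ∥∥-weaken (p*q≤p 0≤r (^-≤1ℚ 0≤r (ℚ.<⇒≤ r<1) n)) (∥^∥ ∥q∥ (suc n))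

-- The series of the theorem, at a fixed index and in the limit

module Series (q z : ℂ) (|q|<1 : ∣ q ∣< 1ℚ) (z≄0 : z ≄0) where

  lhs : ℕ → ℂ
  lhs n = (- 1ℂ) ^ n
        * ((poch (- inv z z≄0) q (suc n) * (poch (- (z * q)) q n * poch q q n))
           * inv (poch q q (2 ℕ.* n ℕ.+ 1)) (poch≄0 |q|<1 (2 ℕ.* n ℕ.+ 1)))
        * q ^ (suc n C 2)

  rhs : ℤ → ℂ
  rhs n = zpow (- 1ℂ) -1≄0 n * q ^ ℤ.∣ n ℤ.* (n ℤ.+ + 1) ∣ * zpow z z≄0 n

  rhs⁺ rhs⁻ : ℕ → ℂ
  rhs⁺ n = rhs (+ n)
  rhs⁻ m = rhs -[1+ m ]

  module Pointwise (K : Constants) {k : ℕ}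
    (∥q∥ : ∥ at q k ∥≤ Constants.r K) (∥z∥ : ∥ at z k ∥≤ Constants.Z K)
    (∥z⁻¹∥ : ∥ at (inv z z≄0) k ∥≤ Constants.Z K) (0<z : 0ℚ ℚ.< nsqᵍ (at z k)) where

    open Constants K

    g : ℕ → ℚ[i]
    g n = invᵍ (pochᵍ (at q k) (at q k) n)

    ⟨q⟩⊗g : ∀ n → pochᵍ (at q k) (at q k) n ⊗ g n ≡ 𝟙
    ⟨q⟩⊗g n = ⊗-invᵍ (nsqᵍ-poch-pos ∥q∥ r<1 n)

    z⊗z⁻¹ : at z k ⊗ at (inv z z≄0) k ≡ 𝟙
    z⊗z⁻¹ = ⊗-invᵍ {at z k} 0<z

    open QSeries (at q k) g ⟨q⟩⊗g
    open Theta (at z k) (at (inv z z≄0) k) z⊗z⁻¹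
    open Estimates K (at q k) g ⟨q⟩⊗g (at z k) (at (inv z z≄0) k) z⊗z⁻¹ ∥q∥ ∥z∥ ∥z⁻¹∥

    at-lhs : ∀ n → at (lhs n) k ≡ lhsTerm n
    at-lhs n = cong₂ _⊗_
      (cong₂ _⊗_ (at-^ (- 1ℂ) n k)
        (cong₂ _⊗_
          (cong₂ _⊗_ (at-poch (- inv z z≄0) q (suc n) k)
            (cong₂ _⊗_ (at-poch (- (z * q)) q n k) (at-poch q q n k)))
          (trans (at-inv (poch q q (2 ℕ.* n ℕ.+ 1)) (poch≄0 |q|<1 (2 ℕ.* n ℕ.+ 1)) k)
            (trans (cong invᵍ (at-poch q q (2 ℕ.* n ℕ.+ 1) k)) (cong g 2n+1)))))
      (trans (cong (λ m → at (q ^ m) k) ([1+n]C2≡tri n)) (at-^ q (tri n) k))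
      where
      2n+1 : 2 ℕ.* n ℕ.+ 1 ≡ suc (n ℕ.+ n)
      2n+1 = trans (ℕ.+-comm (2 ℕ.* n) 1) (cong (λ m → suc (n ℕ.+ m)) (ℕ.+-identityʳ n))

    at-q^n[n+1] : ∀ {m} j → m ≡ tri j ℕ.+ tri j → at (q ^ m) k ≡ q^tri j ⊗ q^tri j
    at-q^n[n+1] j refl = trans (at-^ q (tri j ℕ.+ tri j) k) (^ᵍ-homo-⊗ (at q k) (tri j) (tri j))

    at-rhs⁺ : ∀ j → at (rhs⁺ j) k ≡ rhs⁺Term j
    at-rhs⁺ j = cong₂ _⊗_
      (cong₂ _⊗_ (at-^ (- 1ℂ) j k) (at-q^n[n+1] j (∣n[n+1]∣⁺ j)))
      (at-^ z j k)

    at-rhs⁻ : ∀ j → at (rhs⁻ j) k ≡ rhs⁻Term j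
    at-rhs⁻ j = trans
      (cong₂ _⊗_
        (cong₂ _⊗_ (trans (at-^ (inv (- 1ℂ) -1≄0) (suc j) k) inv-1^) (at-q^n[n+1] j (∣n[n+1]∣⁻ j)))
        (at-^ (inv z z≄0) (suc j) k))
      (solve 3 (λ s t y → (:- I) :* s :* t :* y := :- (s :* t :* y)) refl
        (sgn j) (q^tri j ⊗ q^tri j) (at (inv z z≄0) k ^ᵍ suc j))
      where
      open G
      inv-1^ : at (inv (- 1ℂ) -1≄0) k ^ᵍ suc j ≡ ⊖ 𝟙 ⊗ sgn j
      -- The entries of -1 are constant, so its reciprocal is a computation with closed rationals.
      inv-1^ = refl

    ∥rhs⁺∥ : ∀ j → ∥ at (rhs⁺ j) k ∥≤ κ ℚ.* r ^ℚ j
    ∥rhs⁺∥ j = subst (∥_∥≤ κ ℚ.* r ^ℚ j) (sym (at-rhs⁺ j)) (∥rhs⁺Term∥ j)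

    ∥rhs⁻∥ : ∀ j → ∥ at (rhs⁻ j) k ∥≤ κ ℚ.* r ^ℚ j
    ∥rhs⁻∥ j = subst (∥_∥≤ κ ℚ.* r ^ℚ j) (sym (at-rhs⁻ j)) (∥rhs⁻Term∥ j)

    ∥lhs-rhs-partial∥ : ∀ n →
      ∥ at (∑< n lhs) k ⊝ (at (∑< n rhs⁺) k ⊝ at (∑< n rhs⁻) k) ∥≤ (κ ℚ.* R ℚ.+ κ ℚ.* R) ℚ.* r⁻¹ ℚ.* r ^ℚ n
    ∥lhs-rhs-partial∥ n = subst (∥_∥≤ (κ ℚ.* R ℚ.+ κ ℚ.* R) ℚ.* r⁻¹ ℚ.* r ^ℚ n) (sym eq) (shifted n)
      where
      0≤2κR : 0ℚ ℚ.≤ κ ℚ.* R ℚ.+ κ ℚ.* R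
      0≤2κR = +-nonneg (*-nonneg 0≤κ 0≤R) (*-nonneg 0≤κ 0≤R)
      eq : at (∑< n lhs) k ⊝ (at (∑< n rhs⁺) k ⊝ at (∑< n rhs⁻) k) ≡ ∑ n lhsTerm ⊝ ∑ n rhsTerm
      eq = cong₂ _⊝_
        (trans (at-∑ n lhs k) (∑-cong n (λ {i} _ → at-lhs i)))
        (trans
          (cong₂ _⊝_ (trans (at-∑ n rhs⁺ k) (∑-cong n (λ {i} _ → at-rhs⁺ i)))
            (trans (at-∑ n rhs⁻ k) (∑-cong n (λ {i} _ → at-rhs⁻ i))))
          (sym (∑rhsTerm n)))
      -- `∥lhs-rhs∥` bounds sums of length N+1 by a multiple of r^N; the factor r⁻¹ restores the
      -- power r^(N+1).
      shifted : ∀ n → ∥ ∑ n lhsTerm ⊝ ∑ n rhsTerm ∥≤ (κ ℚ.* R ℚ.+ κ ℚ.* R) ℚ.* r⁻¹ ℚ.* r ^ℚ n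
      shifted zero = ∥𝟘∥ (*-nonneg (*-nonneg 0≤2κR (ℚ.≤-trans 0≤1 1≤r⁻¹)) 0≤1)
      shifted (suc N) = ∥∥-weaken (ℚ.≤-reflexive (begin
        (κ ℚ.* R ℚ.+ κ ℚ.* R) ℚ.* r ^ℚ N
          ≡⟨ cong (ℚ._* r ^ℚ N) (trans (sym (ℚ.*-identityʳ (κ ℚ.* R ℚ.+ κ ℚ.* R))) (cong ((κ ℚ.* R ℚ.+ κ ℚ.* R) ℚ.*_) (sym r⁻¹*r))) ⟩
        (κ ℚ.* R ℚ.+ κ ℚ.* R) ℚ.* (r⁻¹ ℚ.* r) ℚ.* r ^ℚ N
          ≡⟨ solve 4 (λ a b c d → a :* (b :* c) :* d := a :* b :* (c :* d)) refl
               (κ ℚ.* R ℚ.+ κ ℚ.* R) r⁻¹ r (r ^ℚ N) ⟩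
        (κ ℚ.* R ℚ.+ κ ℚ.* R) ℚ.* r⁻¹ ℚ.* r ^ℚ suc N ∎))
        (∥lhs-rhs∥ N)
        where
        open ≡-Reasoning
        open Q using (solve; _:*_; _:=_)

  module Limits (K : Constants) (k₀ : ℕ)
    (∥q∥ : ∀ k → k₀ ℕ.≤ k → ∥ at q k ∥≤ Constants.r K)
    (∥z∥ : ∀ k → k₀ ℕ.≤ k → ∥ at z k ∥≤ Constants.Z K)
    (∥z⁻¹∥ : ∀ k → k₀ ℕ.≤ k → ∥ at (inv z z≄0) k ∥≤ Constants.Z K)
    (0<z : ∀ k → k₀ ℕ.≤ k → 0ℚ ℚ.< nsqᵍ (at z k)) where

    open Constants K

    module At {k} (k≥ : k₀ ℕ.≤ k) = Pointwise K {k} (∥q∥ k k≥) (∥z∥ k k≥) (∥z⁻¹∥ k k≥) (0<z k k≥)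

    ∥rhs⁺∥ : ∀ n {k} → k₀ ℕ.≤ k → ∥ at (rhs⁺ n) k ∥≤ κ ℚ.* r ^ℚ n
    ∥rhs⁺∥ n k≥ = At.∥rhs⁺∥ k≥ n

    ∥rhs⁻∥ : ∀ n {k} → k₀ ℕ.≤ k → ∥ at (rhs⁻ n) k ∥≤ κ ℚ.* r ^ℚ n
    ∥rhs⁻∥ n k≥ = At.∥rhs⁻∥ k≥ n

    module Sum⁺ = GeometricSeries 0≤r r<1 0≤R R*1-r 0≤κ rhs⁺ k₀ ∥rhs⁺∥
    module Sum⁻ = GeometricSeries 0≤r r<1 0≤R R*1-r 0≤κ rhs⁻ k₀ ∥rhs⁻∥

    A B : ℂ
    A = Sum⁺.seriesSum
    B = Sum⁻.seriesSum

    2κR/r : ℚ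
    2κR/r = (κ ℚ.* R ℚ.+ κ ℚ.* R) ℚ.* r⁻¹

    0≤2κR/r : 0ℚ ℚ.≤ 2κR/r
    0≤2κR/r = *-nonneg (+-nonneg Sum⁺.0≤κR Sum⁺.0≤κR) (ℚ.≤-trans 0≤1 1≤r⁻¹)

    lhs-close : ∀ {n k} → n ℕ.≤ k → k₀ ℕ.≤ k →
      ∥ at (∑< n lhs) k ⊝ at (A - B) k ∥≤ (2κR/r ℚ.+ (κ ℚ.* R ℚ.+ κ ℚ.* R)) ℚ.* r ^ℚ n
    lhs-close {n} {k} n≤k k≥ = subst (∥_∥≤ (2κR/r ℚ.+ (κ ℚ.* R ℚ.+ κ ℚ.* R)) ℚ.* r ^ℚ n)
      (telescope (at (∑< n lhs) k) (at (∑< n rhs⁺) k) (at (∑< n rhs⁻) k) (at A k) (at B k))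
      (∥∥-weaken (ℚ.≤-reflexive
        (solve 3 (λ a b x → a :* x :+ (b :* x :+ b :* x) := (a :+ (b :+ b)) :* x) refl
          2κR/r (κ ℚ.* R) (r ^ℚ n)))
        (∥⊕∥ (At.∥lhs-rhs-partial∥ k≥ n)
          (∥⊝∥ (Sum⁺.seriesSum-close n≤k k≥)
            (Sum⁻.seriesSum-close n≤k k≥))))
      where
      open Q using (solve; _:+_; _:*_; _:=_)
      telescope : ∀ l a b α β → l ⊝ (a ⊝ b) ⊕ ((a ⊝ α) ⊝ (b ⊝ β)) ≡ l ⊝ (α ⊝ β)
      telescope = G.solve 5 (λ l a b α β → l G.:- (a G.:- b) G.:+ ((a G.:- α) G.:- (b G.:- β))
        G.:= l G.:- (α G.:- β)) refl

    sums : ∃[ A ] ∃[ B ] (HasSum rhs⁺ A × HasSum rhs⁻ B × HasSum lhs (A - B))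
    sums = A , B
      , Sum⁺.seriesSum-hasSum
      , Sum⁻.seriesSum-hasSum
      , hasSum {lhs} {A - B} {k₀ = k₀} 0≤r r<1 (+-nonneg 0≤2κR/r (+-nonneg Sum⁺.0≤κR Sum⁺.0≤κR)) lhs-close

theorem3p3 :
    (q z : ℂ) (|q|<1 : ∣ q ∣< 1ℚ) (z≄0 : z ≄0) →
    let lhs : ℕ → ℂ
        lhs n = (- 1ℂ) ^ n
              * ((poch (- inv z z≄0) q (suc n) * (poch (- (z * q)) q n * poch q q n))
                 * inv (poch q q (2 ℕ.* n ℕ.+ 1)) (poch≄0 |q|<1 (2 ℕ.* n ℕ.+ 1)))
              * q ^ (suc n C 2)
        rhs : ℤ → ℂ
        rhs n = zpow (- 1ℂ) -1≄0 n * q ^ ℤ.∣ n ℤ.* (n ℤ.+ + 1) ∣ * zpow z z≄0 n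
    in ∃[ A ] ∃[ B ]
         HasSum (λ n → rhs (+ n)) A
       × HasSum (λ m → rhs -[1+ m ]) B
       × HasSum lhs (A - B)
theorem3p3 q z |q|<1 z≄0@(δ , 0<δ , N₀ , δ≤z) =
  combine (eventually-contracting {q} |q|<1) (eventually-bounded z) (eventually-bounded (inv z z≄0))
  where
  open Series q z |q|<1 z≄0
  combine : ∃[ r ] (0ℚ ℚ.< r × r ℚ.< 1ℚ × ∃[ N ] (∀ k → N ℕ.≤ k → ∥ at q k ∥≤ r)) →
    ∃[ B ] (0ℚ ℚ.≤ B × ∃[ N ] (∀ k → N ℕ.≤ k → ∥ at z k ∥≤ B)) →
    ∃[ B ] (0ℚ ℚ.≤ B × ∃[ N ] (∀ k → N ℕ.≤ k → ∥ at (inv z z≄0) k ∥≤ B)) →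
    ∃[ A ] ∃[ B ] (HasSum rhs⁺ A × HasSum rhs⁻ B × HasSum lhs (A - B))
  combine (r , 0<r , r<1 , N₁ , ∥q∥) (B₂ , 0≤B₂ , N₂ , ∥z∥) (B₃ , 0≤B₃ , N₃ , ∥z⁻¹∥) =
    -- The summand 1 gives 1 ≤ Z, whence Z bounds q along with z and 1/z. The threshold joins those
    -- of |q| < r, of the two bounds, and of the separation of z from 0.
    Limits.sums (MakeConstants.constants {r} {1ℚ ℚ.+ (B₂ ℚ.+ B₃)} 0<r r<1 (p≤p+q 0≤B₂+B₃))
      ((N₀ ℕ.⊔ N₁) ℕ.⊔ (N₂ ℕ.⊔ N₃))
      (λ k k≥ → ∥q∥ k (ℕ.m⊔n≤o⇒n≤o N₀ N₁ (ℕ.m⊔n≤o⇒m≤o (N₀ ℕ.⊔ N₁) (N₂ ℕ.⊔ N₃) k≥)))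
      (λ k k≥ → ∥∥-weaken B₂≤ (∥z∥ k (ℕ.m⊔n≤o⇒m≤o N₂ N₃ (ℕ.m⊔n≤o⇒n≤o (N₀ ℕ.⊔ N₁) (N₂ ℕ.⊔ N₃) k≥))))
      (λ k k≥ → ∥∥-weaken B₃≤ (∥z⁻¹∥ k (ℕ.m⊔n≤o⇒n≤o N₂ N₃ (ℕ.m⊔n≤o⇒n≤o (N₀ ℕ.⊔ N₁) (N₂ ℕ.⊔ N₃) k≥))))
      (λ k k≥ → ℚ.<-≤-trans 0<δ (subst (ℚ._≤ nsqᵍ (at z k)) (ℚ.+-identityˡ δ)
        (δ≤z k (ℕ.m⊔n≤o⇒m≤o N₀ N₁ (ℕ.m⊔n≤o⇒m≤o (N₀ ℕ.⊔ N₁) (N₂ ℕ.⊔ N₃) k≥)))))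
    where
    0≤B₂+B₃ : 0ℚ ℚ.≤ B₂ ℚ.+ B₃
    0≤B₂+B₃ = +-nonneg 0≤B₂ 0≤B₃
    B₂≤ : B₂ ℚ.≤ 1ℚ ℚ.+ (B₂ ℚ.+ B₃)
    B₂≤ = ℚ.≤-trans (p≤p+q {B₂} {B₃} 0≤B₃) (q≤p+q {1ℚ} {B₂ ℚ.+ B₃} 0≤1)
    B₃≤ : B₃ ℚ.≤ 1ℚ ℚ.+ (B₂ ℚ.+ B₃)
    B₃≤ = ℚ.≤-trans (q≤p+q {B₂} {B₃} 0≤B₂) (q≤p+q {1ℚ} {B₂ ℚ.+ B₃} 0≤1)
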